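{- In the Congested Clique model, the $(k,d)$-nearest problem can be solved in unweighted $n$-vertex graphs in $O\!\left(\left(\frac{k}{n^{2/3}}+\log d\right)\log d\right)$ rounds.
   Context: Congested Clique model: the $n$ vertices of the input graph communicate in synchronous rounds; in each round every pair of vertices may exchange $O(\log n)$ bits; initially each vertex knows only its incident edges. In the $(k,d)$-nearest problem, given integers $k,d$, each vertex $v$ must learn its distances to the $k$ closest vertices among the vertices at distance at most $d$ from $v$ (ties broken arbitrarily); if fewer than $k$ vertices are at distance at most $d$ from $v$, it must learn the distances to all vertices at distance at most $d$. -}

module Defs where

open import Data.Nat using (ℕ; zero; suc; _+_; _*_; _^_; _≤_; _<_)
open import Data.Nat.Logarithm using (⌈log₂_⌉)
open import Data.Fin using (Fin)
open import Data.Bool using (Bool; true; false)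
open import Data.Vec using (Vec)
open import Data.List using (List; length; map)
open import Data.List.Membership.Propositional using (_∈_)
open import Data.List.Relation.Unary.Unique.Propositional using (Unique)
open import Data.Product using (Σ; _×_; _,_; proj₁)
open import Data.Sum using (_⊎_)
open import Relation.Binary.PropositionalEquality using (_≡_)
open import Relation.Nullary using (¬_)

record Graph (n : ℕ) : Set where
  field
    adj   : Fin n → Fin n → Bool
    sym   : ∀ u v → adj u v ≡ adj v u
    irrefl : ∀ v → adj v v ≡ false
open Graph public

Within : ∀ {n} → Graph n → ℕ → Fin n → Fin n → Set
Within G zero    u v = u ≡ v
Within G (suc t) u v = Within G t u v ⊎ Σ (Fin _) (λ w → Within G t u w × adj G w v ≡ true)

Dist : ∀ {n} → Graph n → Fin n → Fin n → ℕ → Set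
Dist G u v t = Within G t u v × (∀ s → s < t → ¬ Within G s u v)

CorrectOutput : ∀ {n} → Graph n → ℕ → ℕ → Fin n → List (Fin n × ℕ) → Set
CorrectOutput {n} G k d v out =
    (∀ u t → (u , t) ∈ out → Dist G v u t × t ≤ d)
  × Unique (map proj₁ out)
  × length out ≤ k
  × (length out ≡ k ⊎ (∀ u t → Dist G v u t → t ≤ d → (u , t) ∈ out))
  × (∀ u t → Dist G v u t → t ≤ d → ¬ ((u , t) ∈ out) →
       ∀ u' t' → (u' , t') ∈ out → t' ≤ t)

-- Congested Clique model (deterministic, unbounded local computation).
-- Vertices are identified with Fin n (IDs known to everybody); in each
-- round every vertex sends to every vertex a message of exactly L bits.

record CCAlgorithm (n L : ℕ) : Set₁ where
  field
    State : Set
    -- initial knowledge: own identifier and own row of incident edges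
    init  : Fin n → (Fin n → Bool) → State
    send  : ℕ → Fin n → State → Fin n → Vec Bool L
    recv  : ℕ → Fin n → State → (Fin n → Vec Bool L) → State
    output : Fin n → State → List (Fin n × ℕ)
open CCAlgorithm public

run : ∀ {n L} (A : CCAlgorithm n L) → Graph n → ℕ → Fin n → State A
run A G zero    i = init A i (adj G i)
run A G (suc r) i =
  recv A r i (run A G r i) (λ j → send A r j (run A G r j) i)

SolvesNearest : ∀ {n L} → CCAlgorithm n L → ℕ → ℕ → ℕ → Set
SolvesNearest {n} A k d T =
  ∀ (G : Graph n) (v : Fin n) → CorrectOutput G k d v (output A v (run A G T v))

bandwidth : ℕ → ℕ → ℕ
bandwidth c n = c * suc ⌈log₂ n ⌉

{-# OPTIONS --safe #-}
-- Vertices simulate, O(1) each, the nodes of a clique of size N = p ^ 6 with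
-- n ≤ N ≤ 64 n, so that P = p ^ 2 is the cube root of N and p ^ 3 its square root.
-- There every instance in which each node sends and receives O(r N) words is
-- routed obliviously in O(r) rounds.  With K = O(k + P ^ 2), the nodes keep a
-- K-truncated distance table h, correct up to distance D.  The tables for 2 D
-- are the K smallest values, in each row v, of min over w of h v w + h w u:
-- the P ^ 3 nodes divide the triples (v , w , u) among them so that each handles
-- O((K / P ^ 2) N) table entries, and each row of each partial product is cut down
-- to its K smallest values by a distributed binary search of O(log d) rounds before it
-- is sent back.  After O(log d) doublings the tables reach distance d.
module Submission where

open import Defs hiding (sym)
open import Data.Bool using (Bool; true; false; _∧_; _∨_; not; if_then_else_)
open import Data.Bool.Properties using (∧-identityʳ; ∧-zeroʳ; ∨-zeroʳ; ∧-comm; ∧-idem) renaming (_≟_ to _≟B_)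
open import Data.Empty using (⊥; ⊥-elim)
open import Data.Fin using (Fin; zero; suc; toℕ; combine; quotient; remainder; fromℕ<; inject≤; _↑ˡ_; _↑ʳ_; finToFun; funToFin)
open import Data.Fin.Properties using (combine-injective; combine-remQuot; remQuot-combine; toℕ-fromℕ<; toℕ-inject≤; toℕ<n; toℕ-injective; inject≤-injective; injective⇒≤; finToFun-funToFin; any?; all?) renaming (_≟_ to _≟F_; suc-injective to sucF-injective)
open import Data.List using (List; []; _∷_; _++_; length; map; filter; allFin; tabulate)
open import Data.List.Membership.Propositional using (_∈_)
open import Data.List.Membership.Propositional.Properties using (∈-filter⁺; ∈-filter⁻; ∈-map⁺; ∈-map⁻; ∈-allFin)
open import Data.List.Properties using (length-map; map-cong; map-tabulate)
open import Data.List.Relation.Unary.AllPairs using ([])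
import Data.List.Relation.Unary.AllPairs.Properties as AllPairs
open import Data.List.Relation.Unary.Unique.Propositional using (Unique)
open import Data.List.Relation.Unary.Unique.Propositional.Properties using (allFin⁺)
open import Data.Maybe using (Maybe; just; nothing)
open import Data.Nat
open import Data.Nat.DivMod
open import Data.Nat.Induction using (<-rec)
open import Data.Nat.Logarithm using (⌈log₂_⌉; ⌈log₂⌉-mono-≤; ⌈log₂⌈n/2⌉⌉≡⌈log₂n⌉∸1)
open import Data.Nat.Properties
open import Data.Nat.Tactic.RingSolver using (solve-∀)
open import Data.Product using (Σ; ∃; _×_; _,_; proj₁; proj₂)
open import Data.Sum using (_⊎_; inj₁; inj₂)
open import Data.Unit using (⊤; tt)
open import Data.Vec as Vec using (Vec)
open import Data.Vec.Properties using (≡-dec) renaming (∷-injective to Vec-∷-injective)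
open import Function using (_∘_; id; case_of_; it)
open import Relation.Binary.Definitions using (tri<; tri≈; tri>)
open import Relation.Binary.PropositionalEquality hiding ([_])
open import Relation.Nullary using (¬_; Dec; yes; no)
open import Relation.Nullary.Decidable using (⌊_⌋; _×-dec_)

-- A table has at most `K` finite entries in each row, but its columns may be crowded, so a fixed
-- division of the triples would overload some node. Middle vertices and columns are therefore cut
-- into `P` intervals of bounded weight. For columns the weight has two sources. What a node
-- receives can be counted beforehand; what it returns are the entries that survive trimming, and
-- these depend on cutoffs that only the products reveal. So the right factor is distributed twice:
-- by input weight alone, to find the cutoffs and to count the survivors, and then by input plus
-- output weight. A cutoff belongs to a whole row of a partial product, not to a division of its
-- columns, so it stays valid for the second distribution. Without trimming, a row could collect `P`
-- partial results of up to `N` entries each; with it, at most `P * K`, which is `q * N` and fits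
-- the routing bound.

-- Finite sums and Boolean indicators

opaque
  sum : ∀ {n} → (Fin n → ℕ) → ℕ
  sum {zero}  f = 0
  sum {suc n} f = f zero + sum (f ∘ suc)

opaque
  unfolding sum

  sum-cong-≗ : ∀ {n} {f g : Fin n → ℕ} → (∀ i → f i ≡ g i) → sum f ≡ sum g
  sum-cong-≗ {zero}  e = refl
  sum-cong-≗ {suc n} e = cong₂ _+_ (e zero) (sum-cong-≗ (e ∘ suc))

  ∑-distrib-+ : ∀ {n} (f g : Fin n → ℕ) → sum (λ i → f i + g i) ≡ sum f + sum g
  ∑-distrib-+ {zero}  f g = refl
  ∑-distrib-+ {suc n} f g = trans (cong (f zero + g zero +_) (∑-distrib-+ (f ∘ suc) (g ∘ suc))) (lem (f zero) (g zero) _ _)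
    where
    lem : ∀ a b c d → a + b + (c + d) ≡ a + c + (b + d)
    lem = solve-∀

  ∑-comm : ∀ {m n} (f : Fin m → Fin n → ℕ) → sum (λ i → sum (λ j → f i j)) ≡ sum (λ j → sum (λ i → f i j))
  ∑-comm {zero}  {n} f = sym (zeros n)
    where
    zeros : ∀ n → sum {n} (λ _ → 0) ≡ 0
    zeros zero = refl
    zeros (suc n) = zeros n
  ∑-comm {suc m} f = trans (cong (sum (f zero) +_) (∑-comm (f ∘ suc))) (sym (∑-distrib-+ (f zero) _))

𝟙 : Bool → ℕ
𝟙 true  = 1
𝟙 false = 0

𝟙≤1 : ∀ b → 𝟙 b ≤ 1
𝟙≤1 true  = ≤-refl
𝟙≤1 false = z≤n

𝟙-∧ : ∀ a b → 𝟙 (a ∧ b) ≡ 𝟙 a * 𝟙 b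
𝟙-∧ true  b = sym (+-identityʳ (𝟙 b))
𝟙-∧ false b = refl

_==_ : ∀ {n} → Fin n → Fin n → Bool
i == j = ⌊ i ≟F j ⌋

==-refl : ∀ {n} (i : Fin n) → (i == i) ≡ true
==-refl i with i ≟F i
... | yes _ = refl
... | no ne = ⊥-elim (ne refl)

==⇒≡ : ∀ {n} {i j : Fin n} → (i == j) ≡ true → i ≡ j
==⇒≡ {i = i} {j} e with i ≟F j
... | yes p = p

≢⇒== : ∀ {n} {i j : Fin n} → i ≢ j → (i == j) ≡ false
≢⇒== {i = i} {j} ne with i ≟F j
... | yes p = ⊥-elim (ne p)
... | no _ = refl

==-suc : ∀ {n} (i j : Fin n) → (suc i == suc j) ≡ (i == j)
==-suc i j with i ≟F j
... | yes p = refl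
... | no _ = refl

∧-split : ∀ {a b} → a ∧ b ≡ true → a ≡ true × b ≡ true
∧-split {true} {true} _ = refl , refl

∧-join : ∀ {a b} → a ≡ true → b ≡ true → a ∧ b ≡ true
∧-join refl refl = refl

∨-true : ∀ {a b} → a ≡ true → a ∨ b ≡ true
∨-true refl = refl

true-ext : ∀ {a b : Bool} → (a ≡ true → b ≡ true) → (b ≡ true → a ≡ true) → a ≡ b
true-ext {true}  {true}  f g = refl
true-ext {false} {false} f g = refl
true-ext {true}  {false} f g = sym (f refl)
true-ext {false} {true}  f g = g refl

<ᵇ-true : ∀ {m n} → m < n → (m <ᵇ n) ≡ true
<ᵇ-true {zero}  {suc n} _ = refl
<ᵇ-true {suc m} {suc n} (s≤s p) = <ᵇ-true p

true-<ᵇ : ∀ {m n} → (m <ᵇ n) ≡ true → m < n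
true-<ᵇ {zero}  {suc n} _ = s≤s z≤n
true-<ᵇ {suc m} {suc n} e = s≤s (true-<ᵇ e)

<ᵇ-false : ∀ {m n} → n ≤ m → (m <ᵇ n) ≡ false
<ᵇ-false {m} {zero} _ = refl
<ᵇ-false {suc m} {suc n} (s≤s p) = <ᵇ-false p

≡ᵇ-refl : ∀ m → (m ≡ᵇ m) ≡ true
≡ᵇ-refl zero = refl
≡ᵇ-refl (suc m) = ≡ᵇ-refl m

true-≡ᵇ : ∀ {m n} → (m ≡ᵇ n) ≡ true → m ≡ n
true-≡ᵇ {zero} {zero} _ = refl
true-≡ᵇ {suc m} {suc n} e = cong suc (true-≡ᵇ e)

opaque
  unfolding sum

  sum-mono : ∀ {n} {f g : Fin n → ℕ} → (∀ i → f i ≤ g i) → sum f ≤ sum g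
  sum-mono {zero}  p = z≤n
  sum-mono {suc n} p = +-mono-≤ (p zero) (sum-mono (p ∘ suc))

  sum-const : ∀ n c → sum {n} (λ _ → c) ≡ n * c
  sum-const zero    c = refl
  sum-const (suc n) c = cong (c +_) (sum-const n c)

sum-≤-const : ∀ {n} {f : Fin n → ℕ} c → (∀ i → f i ≤ c) → sum f ≤ n * c
sum-≤-const {n} c p = ≤-trans (sum-mono p) (≤-reflexive (sum-const n c))

sum-zero : ∀ {n} {f : Fin n → ℕ} → (∀ i → f i ≡ 0) → sum f ≡ 0
sum-zero {n} p = trans (sum-cong-≗ p) (trans (sum-const n 0) (*-zeroʳ n))

opaque
  unfolding sum

  sum-* : ∀ {n} c (f : Fin n → ℕ) → sum (λ i → c * f i) ≡ c * sum f
  sum-* {zero}  c f = sym (*-zeroʳ c)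
  sum-* {suc n} c f = trans (cong (c * f zero +_) (sum-* c (f ∘ suc))) (sym (*-distribˡ-+ c (f zero) _))

  term≤sum : ∀ {n} (f : Fin n → ℕ) i → f i ≤ sum f
  term≤sum f zero    = m≤m+n _ _
  term≤sum f (suc i) = ≤-trans (term≤sum (f ∘ suc) i) (m≤n+m _ _)

  sum-indicator : ∀ {n} (j : Fin n) (f : Fin n → ℕ) → sum (λ i → 𝟙 (i == j) * f i) ≡ f j
  sum-indicator {suc n} zero f =
    trans (cong₂ _+_ (+-identityʳ (f zero)) (sum-zero {n} (λ _ → refl))) (+-identityʳ _)
  sum-indicator (suc j) f =
    trans (sum-cong-≗ (λ i → cong (λ b → 𝟙 b * f (suc i)) (==-suc i j))) (sum-indicator j (f ∘ suc))

sum-indicator-one : ∀ {n} (j : Fin n) → sum (λ i → 𝟙 (j == i)) ≡ 1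
sum-indicator-one j = trans (sum-cong-≗ lem) (sum-indicator j (λ _ → 1))
  where
  lem : ∀ i → 𝟙 (j == i) ≡ 𝟙 (i == j) * 1
  lem i = trans (cong 𝟙 (true-ext (λ e → trans (cong (_== j) (sym (==⇒≡ {i = j} e))) (==-refl j))
                                   (λ e → trans (cong (j ==_) (==⇒≡ {i = i} e)) (==-refl j))))
                (sym (*-identityʳ _))

opaque
  unfolding sum

  -- Load bounds sum over all possible senders or destinations of which the addressing scheme admits
  -- only one; such a sum costs no more than one term.
  sum-unique : ∀ {n} (f : Fin n → ℕ) b → (∀ i → f i ≤ b) →
    (∀ i j → 1 ≤ f i → 1 ≤ f j → i ≡ j) → sum f ≤ b
  sum-unique {zero} f b _ _ = z≤n
  sum-unique {suc n} f b le un with f zero in eq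
  ... | zero = sum-unique (f ∘ suc) b (le ∘ suc) (λ i j p q → sucF-injective (un (suc i) (suc j) p q))
  ... | suc m = subst (_≤ b) (trans eq (trans (sym (+-identityʳ _)) (cong (suc m +_) (sym rest)))) (le zero)
    where
    at : ∀ k → (f (suc k) ≡ 0) ⊎ (1 ≤ f (suc k))
    at k with f (suc k)
    ... | zero = inj₁ refl
    ... | suc _ = inj₂ (s≤s z≤n)
    rest : sum (f ∘ suc) ≡ 0
    rest = sum-zero λ k → case at k of λ where
      (inj₁ z) → z
      (inj₂ p) → case un zero (suc k) (subst (1 ≤_) (sym eq) (s≤s z≤n)) p of λ ()

  sum-positive : ∀ {n} (f : Fin n → ℕ) → 1 ≤ sum f → ∃ λ i → 1 ≤ f i
  sum-positive {suc n} f p with f zero in eq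
  ... | suc m = zero , subst (1 ≤_) (sym eq) (s≤s z≤n)
  ... | zero with sum-positive (f ∘ suc) p
  ... | i , q = suc i , q

  sum-++ : ∀ m {n} (f : Fin (m + n) → ℕ) → sum f ≡ sum (λ i → f (i ↑ˡ n)) + sum (λ j → f (m ↑ʳ j))
  sum-++ zero f = refl
  sum-++ (suc m) f = trans (cong (f zero +_) (sum-++ m (f ∘ suc))) (sym (+-assoc (f zero) _ _))

  sum-combine : ∀ m {n} (f : Fin (m * n) → ℕ) → sum f ≡ sum {m} (λ i → sum {n} (λ j → f (combine i j)))
  sum-combine zero f = refl
  sum-combine (suc m) {n} f = trans (sum-++ n f) (cong (sum (λ j → f (j ↑ˡ (m * n))) +_) (sum-combine m (λ j → f (n ↑ʳ j))))

-- Counting in finite sets and lists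

# : ∀ {n} → (Fin n → Bool) → ℕ
# p = sum (λ i → 𝟙 (p i))

#-cong : ∀ {n} {p q : Fin n → Bool} → (∀ i → p i ≡ q i) → # p ≡ # q
#-cong e = sum-cong-≗ (λ i → cong 𝟙 (e i))

𝟙-mono : ∀ {a b} → (a ≡ true → b ≡ true) → 𝟙 a ≤ 𝟙 b
𝟙-mono {false} f = z≤n
𝟙-mono {true} f rewrite f refl = ≤-refl

1≤𝟙 : ∀ {a} → 1 ≤ 𝟙 a → a ≡ true
1≤𝟙 {true} _ = refl

#-mono : ∀ {n} {p q : Fin n → Bool} → (∀ i → p i ≡ true → q i ≡ true) → # p ≤ # q
#-mono e = sum-mono (λ i → 𝟙-mono (e i))

#-≤ : ∀ {n} (p : Fin n → Bool) → # p ≤ n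
#-≤ {n} p = ≤-trans (sum-≤-const 1 (λ i → 𝟙≤1 (p i))) (≤-reflexive (*-identityʳ n))

#-exists : ∀ {n} (p : Fin n → Bool) → 1 ≤ # p → ∃ λ i → p i ≡ true
#-exists p q with sum-positive (λ i → 𝟙 (p i)) q
... | i , r = i , 1≤𝟙 r

#-fibres : ∀ {n m} (key : Fin n → Fin m) (p : Fin n → Bool) →
  # p ≡ sum (λ κ → # (λ i → (key i == κ) ∧ p i))
#-fibres key p = sym (trans (∑-comm _) (sum-cong-≗ λ i →
  trans (sum-cong-≗ (λ κ → trans (𝟙-∧ (key i == κ) (p i)) (*-comm _ (𝟙 (p i)))))
  (trans (sum-* (𝟙 (p i)) _) (trans (cong (𝟙 (p i) *_) (sum-indicator-one (key i))) (*-identityʳ _)))))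

#-zero : ∀ {n} {p : Fin n → Bool} → (∀ i → p i ≡ false) → # p ≡ 0
#-zero e = sum-zero (λ i → cong 𝟙 (e i))

-- Packet lists are treated as multisets: a delivery is specified by how many received items satisfy
-- each predicate, which hides the order produced by the relays.
cnt : {A : Set} → (A → Bool) → List A → ℕ
cnt p [] = 0
cnt p (x ∷ xs) = 𝟙 (p x) + cnt p xs

module _ {A : Set} where

  cnt-cong : {p q : A → Bool} → (∀ x → p x ≡ q x) → ∀ xs → cnt p xs ≡ cnt q xs
  cnt-cong e [] = refl
  cnt-cong e (x ∷ xs) = cong₂ _+_ (cong 𝟙 (e x)) (cnt-cong e xs)

  cnt-mono : {p q : A → Bool} → (∀ x → p x ≡ true → q x ≡ true) → ∀ xs → cnt p xs ≤ cnt q xs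
  cnt-mono e [] = z≤n
  cnt-mono e (x ∷ xs) = +-mono-≤ (𝟙-mono (e x)) (cnt-mono e xs)

  cnt-++ : (p : A → Bool) → ∀ xs ys → cnt p (xs ++ ys) ≡ cnt p xs + cnt p ys
  cnt-++ p [] ys = refl
  cnt-++ p (x ∷ xs) ys = trans (cong (𝟙 (p x) +_) (cnt-++ p xs ys)) (sym (+-assoc (𝟙 (p x)) _ _))

  cnt-false : {p : A → Bool} → (∀ x → p x ≡ false) → ∀ xs → cnt p xs ≡ 0
  cnt-false e [] = refl
  cnt-false e (x ∷ xs) rewrite e x = cnt-false e xs

  cnt-true : ∀ (xs : List A) → cnt (λ _ → true) xs ≡ length xs
  cnt-true [] = refl
  cnt-true (x ∷ xs) = cong suc (cnt-true xs)

  cnt-positive : (p : A → Bool) → ∀ xs → 1 ≤ cnt p xs → ∃ λ x → p x ≡ true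
  cnt-positive p (x ∷ xs) q with p x in eq
  ... | true = x , eq
  ... | false = cnt-positive p xs q

  cnt-fibres : ∀ {m} (key : A → Fin m) (p : A → Bool) xs →
    cnt p xs ≡ sum (λ κ → cnt (λ x → (key x == κ) ∧ p x) xs)
  cnt-fibres {m} key p [] = sym (sum-zero {m} (λ _ → refl))
  cnt-fibres key p (x ∷ xs) = sym (trans (∑-distrib-+ _ _) (cong₂ _+_ here-part (sym (cnt-fibres key p xs))))
    where
    here-part : sum (λ κ → 𝟙 ((key x == κ) ∧ p x)) ≡ 𝟙 (p x)
    here-part = trans (sum-cong-≗ (λ κ → trans (𝟙-∧ (key x == κ) (p x)) (*-comm _ (𝟙 (p x)))))
      (trans (sum-* (𝟙 (p x)) _) (trans (cong (𝟙 (p x) *_) (sum-indicator-one (key x))) (*-identityʳ _)))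

  cnt-map : ∀ {B : Set} (f : B → A) (p : A → Bool) xs → cnt p (map f xs) ≡ cnt (λ x → p (f x)) xs
  cnt-map f p [] = refl
  cnt-map f p (x ∷ xs) = cong (𝟙 (p (f x)) +_) (cnt-map f p xs)

  opaque
    ⨁ : ∀ {n} → (Fin n → List A) → List A
    ⨁ {zero}  f = []
    ⨁ {suc n} f = f zero ++ ⨁ (f ∘ suc)

  opaque
    unfolding ⨁ sum

    cnt-⨁ : ∀ {n} (p : A → Bool) (f : Fin n → List A) → cnt p (⨁ f) ≡ sum (λ i → cnt p (f i))
    cnt-⨁ {zero} p f = refl
    cnt-⨁ {suc n} p f = trans (cnt-++ p (f zero) _) (cong (cnt p (f zero) +_) (cnt-⨁ p (f ∘ suc)))

    ⨁-cong : ∀ {n} {f g : Fin n → List A} → (∀ i → f i ≡ g i) → ⨁ f ≡ ⨁ g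
    ⨁-cong {zero} e = refl
    ⨁-cong {suc n} e = cong₂ _++_ (e zero) (⨁-cong (e ∘ suc))

  when : Bool → A → List A
  when true  a = a ∷ []
  when false a = []

  cnt-when : ∀ p b a → cnt p (when b a) ≡ 𝟙 (b ∧ p a)
  cnt-when p true a = +-identityʳ _
  cnt-when p false a = refl

  select : (A → Bool) → List A → List A
  select p [] = []
  select p (x ∷ xs) = when (p x) x ++ select p xs

  cnt-select : ∀ (p φ : A → Bool) xs → cnt φ (select p xs) ≡ cnt (λ x → p x ∧ φ x) xs
  cnt-select p φ [] = refl
  cnt-select p φ (x ∷ xs) = trans (cnt-++ φ (when (p x) x) _) (cong₂ _+_ (cnt-when φ (p x) x) (cnt-select p φ xs))

  length-select : ∀ (p : A → Bool) xs → length (select p xs) ≡ cnt p xs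
  length-select p [] = refl
  length-select p (x ∷ xs) with p x
  ... | true = cong suc (length-select p xs)
  ... | false = length-select p xs

cnt-∧ˡ : ∀ {A : Set} b (φ : A → Bool) xs → cnt (λ x → b ∧ φ x) xs ≡ 𝟙 b * cnt φ xs
cnt-∧ˡ true φ xs = sym (+-identityʳ _)
cnt-∧ˡ false φ xs = cnt-false (λ _ → refl) xs

nth : {A : Set} → ℕ → List A → Maybe A
nth r       []       = nothing
nth zero    (x ∷ xs) = just x
nth (suc r) (x ∷ xs) = nth r xs

-- The answer `nothing` beyond the end marks termination, so sending one position per round conveys
-- a list without conveying its length.
nth-ext : {A : Set} → ∀ b (xs ys : List A) → length xs ≤ b → length ys ≤ b →
  (∀ (r : Fin b) → nth (toℕ r) xs ≡ nth (toℕ r) ys) → xs ≡ ys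
nth-ext zero [] [] _ _ _ = refl
nth-ext (suc b) [] [] _ _ _ = refl
nth-ext (suc b) [] (y ∷ ys) _ _ e = case e zero of λ ()
nth-ext (suc b) (x ∷ xs) [] _ _ e = case e zero of λ ()
nth-ext (suc b) (x ∷ xs) (y ∷ ys) (s≤s p) (s≤s q) e
  with refl ← e zero = cong (x ∷_) (nth-ext b xs ys p q (e ∘ suc))

-- Knowledge and communication in a clique

hop : ∀ {N} {A : Set} → (Fin N → List (Fin N × A)) → Fin N → List A
hop out j = ⨁ (λ i → map proj₂ (select (λ p → proj₁ p == j) (out i)))

cnt-hop : ∀ {N} {A : Set} (out : Fin N → List (Fin N × A)) j (φ : A → Bool) →
  cnt φ (hop out j) ≡ sum (λ i → cnt (λ p → (proj₁ p == j) ∧ φ (proj₂ p)) (out i))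
cnt-hop out j φ = trans (cnt-⨁ φ _) (sum-cong-≗ (λ i → trans (cnt-map proj₂ φ (select (λ p → proj₁ p == j) (out i)))
    (cnt-select (λ p → proj₁ p == j) (λ p → φ (proj₂ p)) (out i))))

Rel : ℕ → Set → Set₁
Rel N Ω = Fin N → Ω → Ω → Set

record Enc (X : Set) (M : ℕ) : Set where
  field
    enc : X → Fin M
    enc-injective : ∀ {x y} → enc x ≡ enc y → x ≡ y
open Enc public

-- Knowledge is modelled as indistinguishability: E i ω ω' says that node i
-- cannot tell the inputs ω and ω' apart.  A round is legitimate when every
-- message is constant on the sender's indistinguishability classes.
module Clique {Ω : Set} {N : ℕ} (M : ℕ) (E₀ : Rel N Ω) where

  data Reach : ℕ → Rel N Ω → Set₁ where
    start : Reach 0 E₀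
    round : ∀ {t E} → Reach t E → (m : Ω → Fin N → Fin N → Fin M) →
      (∀ i ω ω' → E i ω ω' → ∀ j → m ω i j ≡ m ω' i j) →
      Reach (suc t) (λ j ω ω' → E j ω ω' × (∀ i → m ω i j ≡ m ω' i j))

  -- `P i ω ω'` typically equates quantities computed from `ω` and from `ω'`. That the view implies
  -- these equations says that node `i` could compute the quantities from what it has seen. Since
  -- `time` may be smaller than `T`, bounds can be relaxed without idle rounds.
  record Knows (T : ℕ) (P : Rel N Ω) : Set₁ where
    constructor knows
    field
      time  : ℕ
      time≤ : time ≤ T
      view  : Rel N Ω
      reach : Reach time view
      imp   : ∀ i ω ω' → view i ω ω' → P i ω ω'

  weaken : ∀ {T T' P Q} → T ≤ T' → (∀ i ω ω' → P i ω ω' → Q i ω ω') → Knows T P → Knows T' Q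
  weaken le f (knows t l E r g) = knows t (≤-trans l le) E r (λ i ω ω' e → f i ω ω' (g i ω ω' e))

  sendMsg : ∀ {T P} {X : Set} → Enc X M → Knows T P → (m : Ω → Fin N → Fin N → X) →
    (∀ i ω ω' → P i ω ω' → ∀ j → m ω i j ≡ m ω' i j) →
    Knows (suc T) (λ j ω ω' → P j ω ω' × (∀ i → m ω i j ≡ m ω' i j))
  sendMsg c (knows t l E r g) m det =
    knows (suc t) (s≤s l) _
      (round r (λ ω i j → enc c (m ω i j)) (λ i ω ω' e j → cong (enc c) (det i ω ω' (g i ω ω' e) j)))
      (λ i ω ω' e → g i ω ω' (proj₁ e) , λ j → enc-injective c (proj₂ e j))

  sendℕ : ∀ {T P} → Knows T P → (m : Ω → Fin N → Fin N → ℕ) → (∀ ω i j → m ω i j < M) →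
    (∀ i ω ω' → P i ω ω' → ∀ j → m ω i j ≡ m ω' i j) →
    Knows (suc T) (λ j ω ω' → P j ω ω' × (∀ i → m ω i j ≡ m ω' i j))
  sendℕ (knows t l E r g) m bound det =
    knows (suc t) (s≤s l) _
      (round r (λ ω i j → fromℕ< (bound ω i j))
        (λ i ω ω' e j → toℕ-injective (trans (toℕ-fromℕ< (bound ω i j))
          (trans (det i ω ω' (g i ω ω' e) j) (sym (toℕ-fromℕ< (bound ω' i j)))))))
      (λ i ω ω' e → g i ω ω' (proj₁ e) , λ j →
        trans (sym (toℕ-fromℕ< (bound ω j i))) (trans (cong toℕ (proj₂ e j)) (toℕ-fromℕ< (bound ω' j i))))

  sends : ∀ {T P} {X : Set} → Enc X M → ∀ b → Knows T P → (m : Fin b → Ω → Fin N → Fin N → X) →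
    (∀ i ω ω' → P i ω ω' → ∀ β j → m β ω i j ≡ m β ω' i j) →
    Knows (T + b) (λ j ω ω' → P j ω ω' × (∀ β i → m β ω i j ≡ m β ω' i j))
  sends {T} c zero k m det = weaken (m≤m+n T 0) (λ i ω ω' p → p , λ ()) k
  sends {T} c (suc b) k m det =
    weaken (≤-reflexive (sym (+-suc T b)))
      (λ i ω ω' p → proj₁ (proj₁ p) , λ where
        zero    → proj₂ (proj₁ p)
        (suc β) → proj₂ p β)
      (sends c b (sendMsg c k (m zero) (λ i ω ω' p → det i ω ω' p zero)) (m ∘ suc)
        (λ i ω ω' p β → det i ω ω' (proj₁ p) (suc β)))

  -- Every ordered pair of nodes carries at most `b` packets, so each of the `b` rounds moves one
  -- position of all these queues.
  sendLists : ∀ {T P} {A : Set} → Enc (Maybe A) M → Knows T P → ∀ b →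
    (out : Ω → Fin N → List (Fin N × A)) →
    (∀ i ω ω' → P i ω ω' → out ω i ≡ out ω' i) →
    (∀ ω i j → cnt (λ p → proj₁ p == j) (out ω i) ≤ b) →
    Knows (T + b) (λ j ω ω' → P j ω ω' × hop (out ω) j ≡ hop (out ω') j)
  sendLists {A = A} c k b out det load =
    weaken ≤-refl (λ j ω ω' p → proj₁ p , ⨁-cong (λ i →
        nth-ext b (packets ω i j) (packets ω' i j) (short ω i j) (short ω' i j) (λ r → proj₂ p r i)))
      (sends c b k (λ r ω i j → nth (toℕ r) (packets ω i j))
        (λ i ω ω' p r j → cong (λ xs → nth (toℕ r) (map proj₂ (select (λ q → proj₁ q == j) xs))) (det i ω ω' p)))
    where
    packets : Ω → Fin N → Fin N → List A
    packets ω i j = map proj₂ (select (λ p → proj₁ p == j) (out ω i))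
    short : ∀ ω i j → length (packets ω i j) ≤ b
    short ω i j = ≤-trans (≤-reflexive (trans (length-map proj₂ (select (λ p → proj₁ p == j) (out ω i))) (length-select _ (out ω i)))) (load ω i j)

-- Dealing packets in rotation

toℕ-mod : ∀ m s .{{_ : NonZero s}} → toℕ (m mod s) ≡ m % s
toℕ-mod m s = toℕ-fromℕ< (m%n<n m s)

_⊕_ : ∀ {s} .{{_ : NonZero s}} → Fin s → Fin s → Fin s
_⊕_ {s} a b = (toℕ a + toℕ b) mod s

⊕-cancelˡ : ∀ {s} .{{_ : NonZero s}} (a : Fin s) {b c : Fin s} → a ⊕ b ≡ a ⊕ c → b ≡ c
⊕-cancelˡ {s} a {b} {c} e = toℕ-injective (trans (sym (recover b)) (trans (cong (λ x → ((s ∸ toℕ a) % s + x) % s) e') (recover c)))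
  where
  e' : (toℕ a + toℕ b) % s ≡ (toℕ a + toℕ c) % s
  e' = trans (sym (toℕ-mod _ s)) (trans (cong toℕ e) (toℕ-mod _ s))
  recover : ∀ x → ((s ∸ toℕ a) % s + (toℕ a + toℕ x) % s) % s ≡ toℕ x
  recover x = begin
    ((s ∸ toℕ a) % s + (toℕ a + toℕ x) % s) % s ≡⟨ %-distribˡ-+ (s ∸ toℕ a) (toℕ a + toℕ x) s ⟨
    (s ∸ toℕ a + (toℕ a + toℕ x)) % s           ≡⟨ cong (_% s) (sym (+-assoc (s ∸ toℕ a) (toℕ a) (toℕ x))) ⟩
    (s ∸ toℕ a + toℕ a + toℕ x) % s             ≡⟨ cong (λ y → (y + toℕ x) % s) (m∸n+n≡m (<⇒≤ (toℕ<n a))) ⟩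
    (s + toℕ x) % s                             ≡⟨ cong (_% s) (+-comm s (toℕ x)) ⟩
    (toℕ x + s) % s                             ≡⟨ [m+n]%n≡m%n (toℕ x) s ⟩
    toℕ x % s                                   ≡⟨ m<n⇒m%n≡m (toℕ<n x) ⟩
    toℕ x ∎
    where open ≡-Reasoning

⊕-cancelʳ : ∀ {s} .{{_ : NonZero s}} {a b : Fin s} (c : Fin s) → a ⊕ c ≡ b ⊕ c → a ≡ b
⊕-cancelʳ {s} {a} {b} c e = ⊕-cancelˡ c
  (trans (cong (_mod s) (+-comm (toℕ c) (toℕ a))) (trans e (cong (_mod s) (+-comm (toℕ b) (toℕ c)))))

-- Deals each key class in rotation to `s` labels; the position in the rotation is the number of
-- later elements with the same key. All classes are divided evenly at once, and the rule is local
-- to the holder of the list.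
spread : ∀ {A : Set} {m} s .{{_ : NonZero s}} → (A → Fin m) → List A → List (Fin s × A)
spread s key []       = []
spread s key (x ∷ xs) = (cnt (λ y → key y == key x) xs mod s , x) ∷ spread s key xs

-- The share of label `y` in a class of `m` elements: how many numbers below `m` are congruent to
-- `y` modulo `s`.
ranks : ∀ {s} .{{_ : NonZero s}} → Fin s → ℕ → ℕ
ranks y zero = 0
ranks {s} y (suc m) = 𝟙 ((m mod s) == y) + ranks y m

-- Each of the `q` full turns serves `y` once, and the partial turn of length `r` serves it when `y`
-- is below `r`. The recursion lowers `r` and borrows a full turn when it reaches 0.
ranks-≤ : ∀ {s} .{{_ : NonZero s}} (y : Fin s) q r → r ≤ s →
  ranks y (r + q * s) ≤ q + 𝟙 (toℕ y <ᵇ r)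
ranks-≤ y zero zero _ = z≤n
ranks-≤ {s} y (suc q) zero _ = ≤-trans (ranks-≤ y q s ≤-refl)
  (≤-reflexive (trans (cong (λ b → q + 𝟙 b) (<ᵇ-true (toℕ<n y))) (trans (+-comm q 1) (sym (+-identityʳ (suc q))))))
ranks-≤ {s} y q (suc r) r<s = ≤-trans (+-mono-≤ head-≤ (ranks-≤ y q r (<⇒≤ r<s))) tail-≤
  where
  rem≡ : toℕ ((r + q * s) mod s) ≡ r
  rem≡ = trans (toℕ-mod _ s) (trans ([m+kn]%n≡m%n r q s) (m<n⇒m%n≡m r<s))
  head-≤ : 𝟙 (((r + q * s) mod s) == y) ≤ 𝟙 (r ≡ᵇ toℕ y)
  head-≤ = 𝟙-mono (λ e → trans (cong (_≡ᵇ toℕ y) (trans (sym rem≡) (cong toℕ (==⇒≡ e)))) (≡ᵇ-refl (toℕ y)))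
  split : ∀ a b → 𝟙 (a ≡ᵇ b) + 𝟙 (b <ᵇ a) ≤ 𝟙 (b <ᵇ suc a)
  split zero zero = ≤-refl
  split zero (suc b) = ≤-refl
  split (suc a) zero = ≤-refl
  split (suc a) (suc b) = split a b
  comm : ∀ a b c → a + (b + c) ≡ b + (a + c)
  comm = solve-∀
  tail-≤ : 𝟙 (r ≡ᵇ toℕ y) + (q + 𝟙 (toℕ y <ᵇ r)) ≤ q + 𝟙 (toℕ y <ᵇ suc r)
  tail-≤ = ≤-trans (≤-reflexive (comm (𝟙 (r ≡ᵇ toℕ y)) q _)) (+-monoʳ-≤ q (split r (toℕ y)))

-- The bound `m / s + 1`, multiplied by `s`. Later load bounds keep this scaled form, so that
-- rounding errors simply add up.
ranks-bound : ∀ {s} .{{_ : NonZero s}} (y : Fin s) m → s * ranks y m ≤ m + s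
ranks-bound {s} y m = begin
  s * ranks y m                     ≡⟨ cong (λ k → s * ranks y k) (m≡m%n+[m/n]*n m s) ⟩
  s * ranks y (m % s + m / s * s)   ≤⟨ *-monoʳ-≤ s (ranks-≤ y (m / s) (m % s) (<⇒≤ (m%n<n m s))) ⟩
  s * (m / s + 𝟙 (toℕ y <ᵇ m % s))  ≤⟨ *-monoʳ-≤ s (+-monoʳ-≤ (m / s) (𝟙≤1 _)) ⟩
  s * (m / s + 1)                   ≡⟨ lem s (m / s) ⟩
  m / s * s + s                     ≤⟨ +-monoˡ-≤ s (m/n*n≤m m s) ⟩
  m + s                             ∎
  where
  open ≤-Reasoning
  lem : ∀ s q → s * (q + 1) ≡ q * s + s
  lem = solve-∀

module _ {A : Set} {m : ℕ} {s : ℕ} .{{_ : NonZero s}} (key : A → Fin m) where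

  cnt-spread : ∀ (φ : A → Bool) xs → cnt (λ p → φ (proj₂ p)) (spread s key xs) ≡ cnt φ xs
  cnt-spread φ [] = refl
  cnt-spread φ (x ∷ xs) = cong (𝟙 (φ x) +_) (cnt-spread φ xs)

  cnt-spread-class : ∀ y κ xs →
    cnt (λ p → (proj₁ p == y) ∧ (key (proj₂ p) == κ)) (spread s key xs) ≡ ranks y (cnt (λ x → key x == κ) xs)
  cnt-spread-class y κ [] = refl
  cnt-spread-class y κ (x ∷ xs) with key x == κ in eq
  ... | true rewrite ==⇒≡ {i = key x} eq = cong₂ _+_ (cong 𝟙 (∧-identityʳ _)) (cnt-spread-class y κ xs)
  ... | false = trans (cong (λ b → 𝟙 b + cnt (λ p → (proj₁ p == y) ∧ (key (proj₂ p) == κ)) (spread s key xs)) (∧-zeroʳ _)) (cnt-spread-class y κ xs)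

  spread-class-≤ : ∀ y κ xs →
    s * cnt (λ p → (proj₁ p == y) ∧ (key (proj₂ p) == κ)) (spread s key xs) ≤ cnt (λ x → key x == κ) xs + s
  spread-class-≤ y κ xs = ≤-trans (≤-reflexive (cong (s *_) (cnt-spread-class y κ xs))) (ranks-bound y _)

  -- Each of the `m` key classes may leave one extra element on a label, whence the error `m * s`
  -- after scaling.
  spread-label-≤ : ∀ y xs → s * cnt (λ p → proj₁ p == y) (spread s key xs) ≤ length xs + m * s
  spread-label-≤ y xs = begin
    s * cnt (λ p → proj₁ p == y) L                                        ≡⟨ cong (s *_) (cnt-fibres (λ p → key (proj₂ p)) (λ p → proj₁ p == y) L) ⟩
    s * sum (λ κ → cnt (λ p → (key (proj₂ p) == κ) ∧ (proj₁ p == y)) L)   ≡⟨ sum-* s (λ κ → cnt (λ p → (key (proj₂ p) == κ) ∧ (proj₁ p == y)) L) ⟨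
    sum (λ κ → s * cnt (λ p → (key (proj₂ p) == κ) ∧ (proj₁ p == y)) L)   ≤⟨ sum-mono (λ κ → ≤-trans (*-monoʳ-≤ s (cnt-mono (λ p e → ∧-join (proj₂ (∧-split e)) (proj₁ (∧-split {key (proj₂ p) == κ} e))) L)) (spread-class-≤ y κ xs)) ⟩
    sum (λ κ → cnt (λ x → key x == κ) xs + s)                             ≡⟨ ∑-distrib-+ (λ κ → cnt (λ x → key x == κ) xs) (λ _ → s) ⟩
    sum (λ κ → cnt (λ x → key x == κ) xs) + sum {m} (λ _ → s)             ≡⟨ cong₂ _+_ total (sum-const m s) ⟩
    length xs + m * s                                                     ∎
    where
    open ≤-Reasoning
    L = spread s key xs
    total : sum (λ κ → cnt (λ x → key x == κ) xs) ≡ length xs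
    total = trans (sum-cong-≗ (λ κ → cnt-cong (λ x → sym (∧-identityʳ (key x == κ))) xs))
      (trans (sym (cnt-fibres key (λ _ → true) xs)) (cnt-true xs))

cnt-at : ∀ {A : Set} {n} (key : A → Fin n) (ψ : Fin n → A → Bool) xs →
  sum (λ j → cnt (λ x → (key x == j) ∧ ψ j x) xs) ≡ cnt (λ x → ψ (key x) x) xs
cnt-at key ψ xs = trans (sum-cong-≗ (λ j → cnt-cong (λ x → swap j x) xs)) (sym (cnt-fibres key _ xs))
  where
  swap : ∀ j x → (key x == j) ∧ ψ j x ≡ (key x == j) ∧ ψ (key x) x
  swap j x with key x ≟F j
  ... | yes refl = refl
  ... | no _ = refl

-- Conservation of packets. The predicate also sees the node, so that packets arriving at a
-- particular place can be traced back to their senders.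
hop-total : ∀ {N} {A : Set} (out : Fin N → List (Fin N × A)) (ψ : Fin N → A → Bool) →
  sum (λ j → cnt (ψ j) (hop out j)) ≡ sum (λ i → cnt (λ p → ψ (proj₁ p) (proj₂ p)) (out i))
hop-total out ψ = trans (sum-cong-≗ (λ j → cnt-hop out j (ψ j)))
  (trans (∑-comm (λ j i → cnt (λ p → (proj₁ p == j) ∧ ψ j (proj₂ p)) (out i)))
  (sum-cong-≗ (λ i → cnt-at proj₁ (λ j p → ψ j (proj₂ p)) (out i))))

-- Delivery inside the groups of a square arrangement

module Square (s : ℕ) .{{_ : NonZero s}} where

  V : Set
  V = Fin (s * s)

  opaque
    grp mem : V → Fin s
    grp v = quotient {s} s v
    mem v = remainder {s} s v

    node : Fin s → Fin s → V
    node a b = combine a b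

    grp-node : ∀ a b → grp (node a b) ≡ a
    grp-node a b = cong proj₁ (remQuot-combine {s} {s} a b)

    mem-node : ∀ a b → mem (node a b) ≡ b
    mem-node a b = cong proj₂ (remQuot-combine {s} {s} a b)

    node-grp-mem : ∀ v → node (grp v) (mem v) ≡ v
    node-grp-mem v = combine-remQuot {s} s v

    sum-nodes : ∀ f → sum f ≡ sum (λ a → sum (λ b → f (node a b)))
    sum-nodes f = sum-combine s f

  node≡⇒grp : ∀ {a b v} → node a b ≡ v → a ≡ grp v
  node≡⇒grp {a} {b} e = trans (sym (grp-node a b)) (cong grp e)

  node≡⇒mem : ∀ {a b v} → node a b ≡ v → b ≡ mem v
  node≡⇒mem {a} {b} e = trans (sym (mem-node a b)) (cong mem e)

  module _ {X : Set} where

    -- Packets from member c to member d of a group travel through the group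
    -- c ⊕ d, so that a relay handles one source per target and conversely.
    relayed : (V → List (Fin s × X)) → V → List (V × (V × X))
    relayed out i = map (λ p → node (mem i ⊕ proj₁ (proj₂ p)) (proj₁ p) , (node (grp i) (proj₁ (proj₂ p)) , proj₂ (proj₂ p)))
                        (spread s proj₁ (out i))

    inGroup : (V → List (Fin s × X)) → V → List X
    inGroup out = hop (hop (relayed out))

    inGroup-total : ∀ out (ψ : V → X → Bool) →
      sum (λ t → cnt (ψ t) (inGroup out t)) ≡ sum (λ i → cnt (λ p → ψ (node (grp i) (proj₁ p)) (proj₂ p)) (out i))
    inGroup-total out ψ = trans (hop-total (hop (relayed out)) ψ)
      (trans (hop-total (relayed out) (λ _ q → ψ (proj₁ q) (proj₂ q)))
      (sum-cong-≗ (λ i → trans (cnt-map _ (λ q → ψ (proj₁ (proj₂ q)) (proj₂ (proj₂ q))) (spread s proj₁ (out i)))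
        (cnt-spread proj₁ (λ p → ψ (node (grp i) (proj₁ p)) (proj₂ p)) (out i)))))

    module _ (out : V → List (Fin s × X)) (Q : ℕ) (load : ∀ i d → cnt (λ p → proj₁ p == d) (out i) ≤ Q * s) where

      label-load : ∀ i y d → cnt (λ p → (proj₁ p == y) ∧ (proj₁ (proj₂ p) == d)) (spread s proj₁ (out i)) ≤ suc Q
      label-load i y d = *-cancelˡ-≤ s (begin
        s * cnt (λ p → (proj₁ p == y) ∧ (proj₁ (proj₂ p) == d)) (spread s proj₁ (out i)) ≤⟨ spread-class-≤ proj₁ y d (out i) ⟩
        cnt (λ p → proj₁ p == d) (out i) + s ≤⟨ +-monoˡ-≤ s (load i d) ⟩
        Q * s + s ≡⟨ trans (+-comm (Q * s) s) (*-comm (suc Q) s) ⟩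
        s * suc Q ∎)
        where open ≤-Reasoning

      -- The group of the relay is `mem i ⊕ d`, so `i` and `h` determine the destination `d` by
      -- cancellation, and the member number of `h` determines the label.
      first-load : ∀ i h → cnt (λ p → proj₁ p == h) (relayed out i) ≤ suc Q
      first-load i h = begin
        cnt (λ p → proj₁ p == h) (relayed out i) ≡⟨ cnt-map _ (λ p → proj₁ p == h) L ⟩
        cnt φ L                                  ≡⟨ cnt-fibres (λ p → proj₁ (proj₂ p)) φ L ⟩
        sum f                                    ≤⟨ sum-unique f (suc Q) f≤ unique ⟩
        suc Q                                    ∎
        where
        open ≤-Reasoning
        L = spread s proj₁ (out i)
        φ : Fin s × (Fin s × X) → Bool
        φ p = node (mem i ⊕ proj₁ (proj₂ p)) (proj₁ p) == h
        f : Fin s → ℕ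
        f d = cnt (λ p → (proj₁ (proj₂ p) == d) ∧ φ p) L
        f≤ : ∀ d → f d ≤ suc Q
        f≤ d = ≤-trans (cnt-mono (λ p e → ∧-join (trans (cong (proj₁ p ==_) (sym (node≡⇒mem (==⇒≡ (proj₂ (∧-split {proj₁ (proj₂ p) == d} e)))))) (==-refl (proj₁ p)))
                 (proj₁ (∧-split e))) L) (label-load i (mem h) d)
        witness : ∀ d → 1 ≤ f d → mem i ⊕ d ≡ grp h
        witness d q with cnt-positive _ L q
        ... | p , e with ∧-split {proj₁ (proj₂ p) == d} e
        ... | e₁ , e₂ = trans (cong (mem i ⊕_) (sym (==⇒≡ e₁))) (node≡⇒grp (==⇒≡ e₂))
        unique : ∀ d d' → 1 ≤ f d → 1 ≤ f d' → d ≡ d'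
        unique d d' q q' = ⊕-cancelˡ (mem i) (trans (witness d q) (sym (witness d' q')))

      -- The target fixes the group of the sender, and `grp h` together with `mem t` fixes its
      -- member number by cancellation.
      second-load : ∀ h t → cnt (λ p → proj₁ p == t) (hop (relayed out) h) ≤ suc Q
      second-load h t = begin
        cnt (λ p → proj₁ p == t) (hop (relayed out) h) ≡⟨ cnt-hop (relayed out) h _ ⟩
        sum f                                          ≤⟨ sum-unique f (suc Q) f≤ unique ⟩
        suc Q                                          ∎
        where
        open ≤-Reasoning
        f : V → ℕ
        f i = cnt (λ p → (proj₁ p == h) ∧ (proj₁ (proj₂ p) == t)) (relayed out i)
        φ : V → Fin s × (Fin s × X) → Bool
        φ i p = (node (mem i ⊕ proj₁ (proj₂ p)) (proj₁ p) == h) ∧ (node (grp i) (proj₁ (proj₂ p)) == t)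
        f≡ : ∀ i → f i ≡ cnt (φ i) (spread s proj₁ (out i))
        f≡ i = cnt-map _ (λ p → (proj₁ p == h) ∧ (proj₁ (proj₂ p) == t)) (spread s proj₁ (out i))
        facts : ∀ i p → φ i p ≡ true → (proj₁ p ≡ mem h × proj₁ (proj₂ p) ≡ mem t) × (mem i ⊕ mem t ≡ grp h × grp i ≡ grp t)
        facts i p e with ∧-split {node (mem i ⊕ proj₁ (proj₂ p)) (proj₁ p) == h} e
        ... | e₁ , e₂ = (node≡⇒mem (==⇒≡ e₁) , d≡) , (trans (cong (mem i ⊕_) (sym d≡)) (node≡⇒grp (==⇒≡ e₁)) , node≡⇒grp (==⇒≡ e₂))
          where d≡ = node≡⇒mem (==⇒≡ e₂)
        f≤ : ∀ i → f i ≤ suc Q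
        f≤ i = ≤-trans (≤-reflexive (f≡ i)) (≤-trans (cnt-mono (λ p e → ∧-join
            (trans (cong (proj₁ p ==_) (sym (proj₁ (proj₁ (facts i p e))))) (==-refl (proj₁ p)))
            (trans (cong (proj₁ (proj₂ p) ==_) (sym (proj₂ (proj₁ (facts i p e))))) (==-refl (proj₁ (proj₂ p))))) (spread s proj₁ (out i)))
          (label-load i (mem h) (mem t)))
        witness : ∀ i → 1 ≤ f i → mem i ⊕ mem t ≡ grp h × grp i ≡ grp t
        witness i q with cnt-positive (φ i) (spread s proj₁ (out i)) (subst (1 ≤_) (f≡ i) q)
        ... | p , e = proj₂ (facts i p e)
        unique : ∀ i i' → 1 ≤ f i → 1 ≤ f i' → i ≡ i'
        unique i i' q q' with witness i q | witness i' q'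
        ... | r , g | r' , g' = trans (sym (node-grp-mem i)) (trans (cong₂ node (trans g (sym g')) (⊕-cancelʳ (mem t) (trans r (sym r')))) (node-grp-mem i'))

    -- Dealing with the labels read as members of the holder's own group: afterwards the group
    -- shares every key class almost equally, and nothing has left it.
    balance : (X → Fin s) → (V → List X) → V → List X
    balance key σ = inGroup (λ i → spread s key (σ i))

    balance-total : ∀ key σ (ψ : Fin s → X → Bool) →
      sum (λ t → cnt (ψ (grp t)) (balance key σ t)) ≡ sum (λ i → cnt (ψ (grp i)) (σ i))
    balance-total key σ ψ = trans (inGroup-total (λ i → spread s key (σ i)) (λ t → ψ (grp t)))
      (sum-cong-≗ (λ i → trans (cnt-cong (λ p → cong (λ g → ψ g (proj₂ p)) (grp-node (grp i) (proj₁ p))) (spread s key (σ i)))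
        (cnt-spread key (ψ (grp i)) (σ i))))

    -- Each of the `s` members of the group rounds once, which costs `s` after scaling; together
    -- they cost `s * s`.
    balance-class : ∀ key σ t κ →
      s * cnt (λ x → key x == κ) (balance key σ t) ≤ sum (λ i → cnt (λ x → (grp i == grp t) ∧ (key x == κ)) (σ i)) + s * s
    balance-class key σ t κ = begin
      s * cnt (λ x → key x == κ) (balance key σ t) ≡⟨ cong (s *_) (trans (cnt-at-node) (inGroup-total (λ i → spread s key (σ i)) ψ)) ⟩
      s * sum f                                    ≡⟨ sum-* s f ⟨
      sum (λ i → s * f i)                          ≤⟨ sum-mono f≤ ⟩
      sum (λ i → g i + 𝟙 (grp i == grp t) * s)     ≡⟨ ∑-distrib-+ g _ ⟩
      sum g + sum (λ i → 𝟙 (grp i == grp t) * s)   ≡⟨ cong (sum g +_) (trans (sum-cong-≗ (λ i → *-comm (𝟙 (grp i == grp t)) s)) (trans (sum-* s _) (cong (s *_) (group-size (grp t))))) ⟩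
      sum g + s * s                                ∎
      where
      open ≤-Reasoning
      ψ : V → X → Bool
      ψ j x = (j == t) ∧ (key x == κ)
      g : V → ℕ
      g i = cnt (λ x → (grp i == grp t) ∧ (key x == κ)) (σ i)
      f : V → ℕ
      f i = cnt (λ p → ψ (node (grp i) (proj₁ p)) (proj₂ p)) (spread s key (σ i))
      cnt-at-node : cnt (λ x → key x == κ) (balance key σ t) ≡ sum (λ j → cnt (ψ j) (balance key σ j))
      cnt-at-node = sym (trans (sum-cong-≗ (λ j → cnt-∧ˡ (j == t) (λ x → key x == κ) (balance key σ j))) (sum-indicator t _))
      group-size : ∀ a → sum (λ i → 𝟙 (grp i == a)) ≡ s
      group-size a = trans (sum-nodes (λ i → 𝟙 (grp i == a))) (trans (sum-cong-≗ (λ c → trans (sum-cong-≗ (λ b → cong (λ z → 𝟙 (z == a)) (grp-node c b))) (trans (sum-const s _) (*-comm s _))))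
        (trans (sum-indicator a (λ _ → s)) refl))
      f≤ : ∀ i → s * f i ≤ g i + 𝟙 (grp i == grp t) * s
      f≤ i with grp i ≟F grp t
      ... | no ne = ≤-trans (≤-reflexive (trans (cong (s *_) (trans (cnt-cong (λ p → cong (_∧ (key (proj₂ p) == κ)) (≢⇒== (λ e → ne (node≡⇒grp e)))) (spread s key (σ i))) (cnt-false (λ _ → refl) (spread s key (σ i))))) (*-zeroʳ s))) z≤n
      ... | yes _ = ≤-trans (*-monoʳ-≤ s (cnt-mono (λ p e → ∧-join
              (trans (cong (proj₁ p ==_) (sym (node≡⇒mem (==⇒≡ (proj₁ (∧-split e)))))) (==-refl (proj₁ p)))
              (proj₂ (∧-split {node (grp i) (proj₁ p) == t} e))) (spread s key (σ i))))
            (≤-trans (spread-class-≤ key (mem t) κ (σ i)) (+-monoʳ-≤ _ (≤-reflexive (sym (+-identityʳ s)))))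

length-hop-≤ : ∀ {N} {A : Set} (out : Fin N → List (Fin N × A)) b →
  (∀ i j → cnt (λ p → proj₁ p == j) (out i) ≤ b) → ∀ j → length (hop out j) ≤ N * b
length-hop-≤ {N} out b load j = begin
  length (hop out j)                                    ≡⟨ cnt-true (hop out j) ⟨
  cnt (λ _ → true) (hop out j)                          ≡⟨ cnt-hop out j (λ _ → true) ⟩
  sum (λ i → cnt (λ p → (proj₁ p == j) ∧ true) (out i)) ≤⟨ sum-≤-const b (λ i → ≤-trans (≤-reflexive (cnt-cong (λ p → ∧-identityʳ (proj₁ p == j)) (out i))) (load i j)) ⟩
  N * b                                                 ∎
  where open ≤-Reasoning

-- Oblivious routing in five stages

module Pipeline (s : ℕ) .{{_ : NonZero s}} {A : Set} where
  open Square s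

  X : Set
  X = V × A

  tgrp tmem : X → Fin s
  tgrp x = grp (proj₁ x)
  tmem x = mem (proj₁ x)

  -- The first label, dealt by target group, picks the group to visit, so that the groups share the
  -- traffic towards each target group. The second is dealt among packets with the same first label
  -- and picks the member, which keeps every single link light.
  scatter : (V → List X) → V → List (V × X)
  scatter σ i = map (λ p → node (proj₁ (proj₂ p)) (proj₁ p) , proj₂ (proj₂ p)) (spread s proj₁ (spread s tgrp (σ i)))

  approach : (V → List X) → V → List (V × X)
  approach σ i = map (λ p → node (tgrp (proj₂ p)) (proj₁ p) , proj₂ p) (spread s tgrp (σ i))

  addressed : (V → List X) → V → List (Fin s × X)
  addressed σ i = map (λ x → tmem x , x) (σ i)

  -- The two balancing stages prepare their successors: the third stage needs every node to hold few
  -- packets per target group, the fifth needs few per target member.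
  stage₁ stage₂ stage₃ stage₄ stage₅ : (V → List X) → V → List X
  stage₁ σ = hop (scatter σ)
  stage₂ σ = balance tgrp (stage₁ σ)
  stage₃ σ = hop (approach (stage₂ σ))
  stage₄ σ = balance tmem (stage₃ σ)
  stage₅ σ = inGroup (addressed (stage₄ σ))

  module _ (σ : V → List X) (r : ℕ)
    (outLoad : ∀ i → length (σ i) ≤ r * (s * s))
    (inLoad : ∀ t → sum (λ i → cnt (λ x → proj₁ x == t) (σ i)) ≤ r * (s * s)) where

    stage₁-total : ∀ (ψ : Fin s → X → Bool) → sum (λ t → cnt (ψ (grp t)) (stage₁ σ t)) ≡
      sum (λ i → cnt (λ p → ψ (proj₁ p) (proj₂ p)) (spread s tgrp (σ i)))
    stage₁-total ψ = trans (hop-total (scatter σ) (λ t → ψ (grp t))) (sum-cong-≗ λ i →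
      trans (cnt-map _ _ (spread s proj₁ (spread s tgrp (σ i))))
      (trans (cnt-cong (λ p → cong (λ g → ψ g (proj₂ (proj₂ p))) (grp-node (proj₁ (proj₂ p)) (proj₁ p))) (spread s proj₁ (spread s tgrp (σ i))))
        (cnt-spread proj₁ (λ p → ψ (proj₁ p) (proj₂ p)) (spread s tgrp (σ i)))))

    stage₁-plain : ∀ φ → sum (λ t → cnt φ (stage₁ σ t)) ≡ sum (λ i → cnt φ (σ i))
    stage₁-plain φ = trans (stage₁-total (λ _ → φ)) (sum-cong-≗ (λ i → cnt-spread tgrp φ (σ i)))

    stage₂-plain : ∀ φ → sum (λ t → cnt φ (stage₂ σ t)) ≡ sum (λ i → cnt φ (σ i))
    stage₂-plain φ = trans (balance-total tgrp (stage₁ σ) (λ _ → φ)) (stage₁-plain φ)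

    stage₃-total : ∀ (ψ : Fin s → X → Bool) → sum (λ t → cnt (ψ (grp t)) (stage₃ σ t)) ≡
      sum (λ i → cnt (λ x → ψ (tgrp x) x) (σ i))
    stage₃-total ψ = trans (hop-total (approach (stage₂ σ)) (λ t → ψ (grp t)))
      (trans (sum-cong-≗ λ i → trans (cnt-map _ _ (spread s tgrp (stage₂ σ i)))
        (trans (cnt-cong (λ p → cong (λ g → ψ g (proj₂ p)) (grp-node (tgrp (proj₂ p)) (proj₁ p))) (spread s tgrp (stage₂ σ i)))
          (cnt-spread tgrp (λ x → ψ (tgrp x) x) (stage₂ σ i))))
      (stage₂-plain (λ x → ψ (tgrp x) x)))

    -- Every stage conserves packets. The third puts a packet into its target group and the fifth
    -- hands it to its target member, so the place where it ends is rebuilt from the two coordinates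
    -- of its address.
    stage₅-count : ∀ t φ → cnt φ (stage₅ σ t) ≡ sum (λ i → cnt (λ x → (proj₁ x == t) ∧ φ x) (σ i))
    stage₅-count t φ = trans (sym point) (trans (inGroup-total (addressed (stage₄ σ)) (λ j x → (j == t) ∧ φ x))
      (trans (sum-cong-≗ (λ i → cnt-map _ _ (stage₄ σ i)))
      (trans (balance-total tmem (stage₃ σ) (λ g x → (node g (tmem x) == t) ∧ φ x))
      (trans (stage₃-total (λ g x → (node g (tmem x) == t) ∧ φ x))
        (sum-cong-≗ (λ i → cnt-cong (λ x → cong (λ v → (v == t) ∧ φ x) (node-grp-mem (proj₁ x))) (σ i)))))))
      where
      point : sum (λ j → cnt (λ x → (j == t) ∧ φ x) (stage₅ σ j)) ≡ cnt φ (stage₅ σ t)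
      point = trans (sum-cong-≗ (λ j → cnt-∧ˡ (j == t) φ (stage₅ σ j))) (sum-indicator t _)

    groupInLoad : ∀ b → sum (λ i → cnt (λ x → tgrp x == b) (σ i)) ≤ s * (r * (s * s))
    groupInLoad b = begin
      sum (λ i → cnt (λ x → tgrp x == b) (σ i)) ≡⟨ sum-cong-≗ (λ i → cnt-fibres tmem (λ x → tgrp x == b) (σ i)) ⟩
      sum (λ i → sum (λ τ → cnt (λ x → (tmem x == τ) ∧ (tgrp x == b)) (σ i))) ≡⟨ ∑-comm _ ⟩
      sum (λ τ → sum (λ i → cnt (λ x → (tmem x == τ) ∧ (tgrp x == b)) (σ i))) ≤⟨ sum-≤-const (r * (s * s)) (λ τ → ≤-trans (sum-mono (λ i → cnt-mono (λ x e → is-target τ x e) (σ i))) (inLoad (node b τ))) ⟩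
      s * (r * (s * s)) ∎
      where
      open ≤-Reasoning
      is-target : ∀ τ x → (tmem x == τ) ∧ (tgrp x == b) ≡ true → (proj₁ x == node b τ) ≡ true
      is-target τ x e with ∧-split {tmem x == τ} e
      ... | e₁ , e₂ = trans (cong (proj₁ x ==_) (trans (cong₂ node (sym (==⇒≡ e₂)) (sym (==⇒≡ e₁))) (node-grp-mem (proj₁ x)))) (==-refl (proj₁ x))

    scatter-load : ∀ i h → cnt (λ p → proj₁ p == h) (scatter σ i) ≤ 2 + r
    scatter-load i h = *-cancelˡ-≤ s (*-cancelˡ-≤ s (begin
      s * (s * cnt (λ p → proj₁ p == h) (scatter σ i))    ≡⟨ cong (λ z → s * (s * z)) (cnt-map _ _ L₂) ⟩
      s * (s * cnt (λ p → node (proj₁ (proj₂ p)) (proj₁ p) == h) L₂) ≤⟨ *-monoʳ-≤ s (*-monoʳ-≤ s (cnt-mono (λ p e → coordinates p (==⇒≡ e)) L₂)) ⟩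
      s * (s * cnt (λ p → (proj₁ p == mem h) ∧ (proj₁ (proj₂ p) == grp h)) L₂) ≤⟨ *-monoʳ-≤ s (spread-class-≤ proj₁ (mem h) (grp h) L₁) ⟩
      s * (cnt (λ p → proj₁ p == grp h) L₁ + s)           ≡⟨ *-distribˡ-+ s _ s ⟩
      s * cnt (λ p → proj₁ p == grp h) L₁ + s * s         ≤⟨ +-monoˡ-≤ (s * s) (spread-label-≤ tgrp (grp h) (σ i)) ⟩
      length (σ i) + s * s + s * s                        ≤⟨ +-monoˡ-≤ (s * s) (+-monoˡ-≤ (s * s) (outLoad i)) ⟩
      r * (s * s) + s * s + s * s                         ≡⟨ arith r s ⟩
      s * (s * (2 + r)) ∎))
      where
      open ≤-Reasoning
      L₁ = spread s tgrp (σ i)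
      L₂ = spread s proj₁ L₁
      arith : ∀ r s → r * (s * s) + s * s + s * s ≡ s * (s * (2 + r))
      arith = solve-∀
      coordinates : ∀ p → node (proj₁ (proj₂ p)) (proj₁ p) ≡ h → (proj₁ p == mem h) ∧ (proj₁ (proj₂ p) == grp h) ≡ true
      coordinates p e = ∧-join (trans (cong (proj₁ p ==_) (sym (node≡⇒mem e))) (==-refl (proj₁ p)))
                               (trans (cong (proj₁ (proj₂ p) ==_) (sym (node≡⇒grp e))) (==-refl (proj₁ (proj₂ p))))

    balance-load : ∀ (key : X → Fin s) (τ : V → List X) Q → (∀ i → length (τ i) ≤ s * s * Q) →
      ∀ i d → cnt (λ p → proj₁ p == d) (spread s key (τ i)) ≤ suc Q * s
    balance-load key τ Q len i d = *-cancelˡ-≤ s (begin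
      s * cnt (λ p → proj₁ p == d) (spread s key (τ i)) ≤⟨ spread-label-≤ key d (τ i) ⟩
      length (τ i) + s * s                              ≤⟨ +-monoˡ-≤ (s * s) (len i) ⟩
      s * s * Q + s * s                                 ≡⟨ arith s Q ⟩
      s * (suc Q * s)                                   ∎)
      where
      open ≤-Reasoning
      arith : ∀ s Q → s * s * Q + s * s ≡ s * (suc Q * s)
      arith = solve-∀

    stage₁-length : ∀ i → length (stage₁ σ i) ≤ s * s * (2 + r)
    stage₁-length = length-hop-≤ (scatter σ) (2 + r) scatter-load

    -- At most `r * s ^ 3` packets head for group `b`. Dealing them over `s` groups leaves at most
    -- `suc r * s ^ 2` in each, the extra `s ^ 2` being one rounding for each of the `s ^ 2`
    -- senders; sharing inside the group then leaves `(2 + r) * s` per node.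
    stage₂-class : ∀ t b → cnt (λ x → tgrp x == b) (stage₂ σ t) ≤ (2 + r) * s
    stage₂-class t b = *-cancelˡ-≤ s (begin
      s * cnt (λ x → tgrp x == b) (stage₂ σ t) ≤⟨ balance-class tgrp (stage₁ σ) t b ⟩
      sum (λ i → cnt (λ x → (grp i == grp t) ∧ (tgrp x == b)) (stage₁ σ i)) + s * s ≡⟨ cong (_+ s * s) (stage₁-total (λ g x → (g == grp t) ∧ (tgrp x == b))) ⟩
      sum f + s * s             ≤⟨ +-monoˡ-≤ (s * s) (*-cancelˡ-≤ s total) ⟩
      suc r * (s * s) + s * s   ≡⟨ arith r s ⟩
      s * ((2 + r) * s) ∎)
      where
      open ≤-Reasoning
      f : V → ℕ
      f i = cnt (λ p → (proj₁ p == grp t) ∧ (tgrp (proj₂ p) == b)) (spread s tgrp (σ i))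
      arith : ∀ r s → suc r * (s * s) + s * s ≡ s * ((2 + r) * s)
      arith = solve-∀
      arith' : ∀ r s → s * (r * (s * s)) + s * s * s ≡ s * (suc r * (s * s))
      arith' = solve-∀
      total : s * sum f ≤ s * (suc r * (s * s))
      total = begin
        s * sum f             ≡⟨ sum-* s f ⟨
        sum (λ i → s * f i)   ≤⟨ sum-mono (λ i → spread-class-≤ tgrp (grp t) b (σ i)) ⟩
        sum (λ i → cnt (λ x → tgrp x == b) (σ i) + s) ≡⟨ ∑-distrib-+ _ (λ _ → s) ⟩
        sum (λ i → cnt (λ x → tgrp x == b) (σ i)) + sum {s * s} (λ _ → s) ≤⟨ +-mono-≤ (groupInLoad b) (≤-reflexive (sum-const (s * s) s)) ⟩
        s * (r * (s * s)) + s * s * s ≡⟨ arith' r s ⟩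
        s * (suc r * (s * s)) ∎

    approach-load : ∀ i h → cnt (λ p → proj₁ p == h) (approach (stage₂ σ) i) ≤ 3 + r
    approach-load i h = *-cancelˡ-≤ s (begin
      s * cnt (λ p → proj₁ p == h) (approach (stage₂ σ) i) ≡⟨ cong (s *_) (cnt-map _ _ L) ⟩
      s * cnt (λ p → node (tgrp (proj₂ p)) (proj₁ p) == h) L ≤⟨ *-monoʳ-≤ s (cnt-mono (λ p e → coordinates p (==⇒≡ e)) L) ⟩
      s * cnt (λ p → (proj₁ p == mem h) ∧ (tgrp (proj₂ p) == grp h)) L ≤⟨ spread-class-≤ tgrp (mem h) (grp h) (stage₂ σ i) ⟩
      cnt (λ x → tgrp x == grp h) (stage₂ σ i) + s         ≤⟨ +-monoˡ-≤ s (stage₂-class i (grp h)) ⟩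
      (2 + r) * s + s                                      ≡⟨ arith r s ⟩
      s * (3 + r) ∎)
      where
      open ≤-Reasoning
      L = spread s tgrp (stage₂ σ i)
      arith : ∀ r s → (2 + r) * s + s ≡ s * (3 + r)
      arith = solve-∀
      coordinates : ∀ p → node (tgrp (proj₂ p)) (proj₁ p) ≡ h → (proj₁ p == mem h) ∧ (tgrp (proj₂ p) == grp h) ≡ true
      coordinates p e = ∧-join (trans (cong (proj₁ p ==_) (sym (node≡⇒mem e))) (==-refl (proj₁ p)))
                               (trans (cong (tgrp (proj₂ p) ==_) (sym (node≡⇒grp e))) (==-refl (tgrp (proj₂ p))))

    stage₃-length : ∀ i → length (stage₃ σ i) ≤ s * s * (3 + r)
    stage₃-length = length-hop-≤ (approach (stage₂ σ)) (3 + r) approach-load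

    -- By now a group holds only packets addressed to itself, so those for member `τ` are the input
    -- load of a single node, shared by `s` holders.
    stage₄-class : ∀ t τ → cnt (λ x → tmem x == τ) (stage₄ σ t) ≤ suc r * s
    stage₄-class t τ = *-cancelˡ-≤ s (begin
      s * cnt (λ x → tmem x == τ) (stage₄ σ t) ≤⟨ balance-class tmem (stage₃ σ) t τ ⟩
      sum (λ i → cnt (λ x → (grp i == grp t) ∧ (tmem x == τ)) (stage₃ σ i)) + s * s ≡⟨ cong (_+ s * s) (stage₃-total (λ g x → (g == grp t) ∧ (tmem x == τ))) ⟩
      sum (λ i → cnt (λ x → (tgrp x == grp t) ∧ (tmem x == τ)) (σ i)) + s * s ≤⟨ +-monoˡ-≤ (s * s) (≤-trans (sum-mono (λ i → cnt-mono is-target (σ i))) (inLoad (node (grp t) τ))) ⟩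
      r * (s * s) + s * s ≡⟨ arith r s ⟩
      s * (suc r * s) ∎)
      where
      open ≤-Reasoning
      arith : ∀ r s → r * (s * s) + s * s ≡ s * (suc r * s)
      arith = solve-∀
      is-target : ∀ x → (tgrp x == grp t) ∧ (tmem x == τ) ≡ true → (proj₁ x == node (grp t) τ) ≡ true
      is-target x e with ∧-split {tgrp x == grp t} e
      ... | e₁ , e₂ = trans (cong (proj₁ x ==_) (trans (cong₂ node (sym (==⇒≡ e₁)) (sym (==⇒≡ e₂))) (node-grp-mem (proj₁ x)))) (==-refl (proj₁ x))

    final-load : ∀ i d → cnt (λ p → proj₁ p == d) (addressed (stage₄ σ) i) ≤ suc r * s
    final-load i d = ≤-trans (≤-reflexive (cnt-map _ _ (stage₄ σ i))) (stage₄-class i d)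

module Routing (s : ℕ) .{{_ : NonZero s}} {Ω : Set} (M : ℕ) (E₀ : Rel (s * s) Ω) where
  open Square s
  open Clique M E₀

  learn-inGroup : ∀ {T P} {X : Set} → Enc (Maybe X) M → Enc (Maybe (V × X)) M → Knows T P →
    (out : Ω → V → List (Fin s × X)) → (∀ i ω ω' → P i ω ω' → out ω i ≡ out ω' i) →
    ∀ Q → (∀ ω i d → cnt (λ p → proj₁ p == d) (out ω i) ≤ Q * s) →
    Knows (T + suc Q + suc Q) (λ j ω ω' → P j ω ω' × inGroup (out ω) j ≡ inGroup (out ω') j)
  learn-inGroup c c' k out det Q load =
    weaken ≤-refl (λ j ω ω' p → proj₁ (proj₁ p) , proj₂ p)
      (sendLists c
        (sendLists c' k (suc Q) (λ ω → relayed (out ω)) (λ i ω ω' p → cong (relay-rule i) (det i ω ω' p))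
          (λ ω → first-load (out ω) Q (load ω)))
        (suc Q) (λ ω → hop (relayed (out ω))) (λ i ω ω' → proj₂)
        (λ ω → second-load (out ω) Q (load ω)))
    where
    relay-rule : V → List (Fin s × _) → List (V × (V × _))
    relay-rule i xs = relayed (λ _ → xs) i

  -- The time `27 + 8 * r` consists of `2 + r` for scattering, `3 + r` for the approach, and twice
  -- `4 + r`, `5 + r` and `2 + r` for the three deliveries inside groups.
  route : ∀ {T P} {A : Set} → Enc (Maybe (V × A)) M → Enc (Maybe (V × (V × A))) M → Knows T P →
    (out : Ω → V → List (V × A)) → (∀ i ω ω' → P i ω ω' → out ω i ≡ out ω' i) →
    ∀ r → (∀ ω i → length (out ω i) ≤ r * (s * s)) →
    (∀ ω t → sum (λ i → cnt (λ x → proj₁ x == t) (out ω i)) ≤ r * (s * s)) →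
    Σ (Ω → V → List A) λ inbox →
      Knows (T + (27 + 8 * r)) (λ j ω ω' → P j ω ω' × inbox ω j ≡ inbox ω' j)
      × (∀ ω t φ → cnt φ (inbox ω t) ≡ sum (λ i → cnt (λ x → (proj₁ x == t) ∧ φ (proj₂ x)) (out ω i)))
  route {T} {P} {A} c c' k out det r outLoad inLoad =
    (λ ω t → map proj₂ (stage₅ (out ω) t)) ,
    weaken (≤-reflexive (arith T r)) (λ j ω ω' p → proj₁ (proj₁ (proj₁ (proj₁ (proj₁ p)))) , cong (map proj₂) (proj₂ p)) k₅ ,
    (λ ω t φ → trans (cnt-map proj₂ φ (stage₅ (out ω) t)) (stage₅-count (out ω) r (outLoad ω) (inLoad ω) t (λ x → φ (proj₂ x))))
    where
    open Pipeline s {A}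
    k₁ = sendLists c k (2 + r) (λ ω → scatter (out ω)) (λ i ω ω' p → cong (λ xs → scatter (λ _ → xs) i) (det i ω ω' p))
           (λ ω → scatter-load (out ω) r (outLoad ω) (inLoad ω))
    k₂ = learn-inGroup c c' k₁ (λ ω i → spread s tgrp (stage₁ (out ω) i)) (λ i ω ω' p → cong (spread s tgrp) (proj₂ p))
           (3 + r) (λ ω → balance-load (out ω) r (outLoad ω) (inLoad ω) tgrp (stage₁ (out ω)) (2 + r) (stage₁-length (out ω) r (outLoad ω) (inLoad ω)))
    k₃ = sendLists c k₂ (3 + r) (λ ω → approach (stage₂ (out ω))) (λ i ω ω' p → cong (λ xs → approach (λ _ → xs) i) (proj₂ p))
           (λ ω → approach-load (out ω) r (outLoad ω) (inLoad ω))
    k₄ = learn-inGroup c c' k₃ (λ ω i → spread s tmem (stage₃ (out ω) i)) (λ i ω ω' p → cong (spread s tmem) (proj₂ p))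
           (4 + r) (λ ω → balance-load (out ω) r (outLoad ω) (inLoad ω) tmem (stage₃ (out ω)) (3 + r) (stage₃-length (out ω) r (outLoad ω) (inLoad ω)))
    k₅ = learn-inGroup c c' k₄ (λ ω → addressed (stage₄ (out ω))) (λ i ω ω' p → cong (λ xs → addressed (λ _ → xs) i) (proj₂ p))
           (suc r) (λ ω → final-load (out ω) r (outLoad ω) (inLoad ω))
    arith : ∀ T r → T + (2 + r) + suc (3 + r) + suc (3 + r) + (3 + r) + suc (4 + r) + suc (4 + r) + suc (suc r) + suc (suc r) ≡ T + (27 + 8 * r)
    arith = solve-∀

-- From knowledge to a concrete algorithm

fromBit : Fin 2 → Bool
fromBit zero = false
fromBit (suc _) = true

toBit : Bool → Fin 2
toBit false = zero
toBit true = suc zero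

fromBit-toBit : ∀ b → fromBit (toBit b) ≡ b
fromBit-toBit true = refl
fromBit-toBit false = refl

fromBit-injective : ∀ {x y} → fromBit x ≡ fromBit y → x ≡ y
fromBit-injective {zero} {zero} e = refl
fromBit-injective {suc zero} {suc zero} e = refl

bits : ∀ L → Fin (2 ^ L) → Vec Bool L
bits zero x = Vec.[]
bits (suc L) x = fromBit (quotient {2} (2 ^ L) x) Vec.∷ bits L (remainder {2} (2 ^ L) x)

bits-injective : ∀ L {x y} → bits L x ≡ bits L y → x ≡ y
bits-injective zero {zero} {zero} e = refl
bits-injective (suc L) {x} {y} e with Vec-∷-injective e
... | e₁ , e₂ = trans (sym (combine-remQuot {2} (2 ^ L) x))
  (trans (cong₂ combine (fromBit-injective e₁) (bits-injective L e₂)) (combine-remQuot {2} (2 ^ L) y))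

-- Local computation is unbounded: a node finds some graph consistent with what
-- it has received, by exhaustive search, and acts as it would on that graph.
module Extraction (n L : ℕ) where

  Row : Rel n (Graph n)
  Row i G G' = ∀ u → adj G i u ≡ adj G' i u

  open Clique (2 ^ L) Row

  Store : Set
  Store = (Fin n → Bool) × (ℕ → Fin n → Vec Bool L)

  -- Symmetrising and clearing the diagonal turns every bit matrix into a graph, so the search may
  -- range over all matrices; adjacency matrices are left unchanged.
  fromMatrix : (Fin n → Fin n → Bool) → Graph n
  fromMatrix a = record
    { adj = λ u v → (a u v ∧ a v u) ∧ not (u == v)
    ; sym = λ u v → cong₂ _∧_ (∧-comm (a u v) (a v u)) (cong not (true-ext (λ e → flip u v e) (λ e → flip v u e)))
    ; irrefl = λ v → trans (cong (λ b → (a v v ∧ a v v) ∧ not b) (==-refl v)) (∧-zeroʳ _)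
    }
    where
    flip : ∀ u v → (u == v) ≡ true → (v == u) ≡ true
    flip u v e with refl ← ==⇒≡ {i = u} {v} e = e

  coded : Fin ((2 ^ n) ^ n) → Graph n
  coded c = fromMatrix (λ u v → fromBit (finToFun (finToFun c u) v))

  code : Graph n → Fin ((2 ^ n) ^ n)
  code G = funToFin (λ u → funToFin (λ v → toBit (adj G u v)))

  coded-code : ∀ G u v → adj (coded (code G)) u v ≡ adj G u v
  coded-code G u v = trans (cong₂ (λ x y → (x ∧ y) ∧ not (u == v)) (entry u v) (entry v u)) clean
    where
    entry : ∀ u v → fromBit (finToFun (finToFun (code G) u) v) ≡ adj G u v
    entry u v = trans (cong (λ w → fromBit (finToFun w v)) (finToFun-funToFin (λ u → funToFin (λ v → toBit (adj G u v))) u))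
      (trans (cong fromBit (finToFun-funToFin (λ v → toBit (adj G u v)) v)) (fromBit-toBit (adj G u v)))
    clean : (adj G u v ∧ adj G v u) ∧ not (u == v) ≡ adj G u v
    clean with u ≟F v
    ... | yes refl = trans (∧-zeroʳ _) (sym (irrefl G u))
    ... | no _ = trans (∧-identityʳ _) (trans (cong (adj G u v ∧_) (Graph.sym G v u)) (∧-idem (adj G u v)))

  Consistent : ∀ {t E} → Reach t E → Store → Fin n → Graph n → Set
  Consistent start (row , h) i G = ∀ u → row u ≡ adj G i u
  Consistent (round {t} r m _) (row , h) i G =
    Consistent r (row , h) i G × (∀ j → h t j ≡ bits L (m G j i))

  consistent? : ∀ {t E} (r : Reach t E) st i G → Dec (Consistent r st i G)
  consistent? start (row , h) i G = all? (λ u → row u ≟B adj G i u)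
  consistent? (round {t} r m _) (row , h) i G =
    consistent? r (row , h) i G ×-dec all? (λ j → ≡-dec _≟B_ (h t j) (bits L (m G j i)))

  same-view : ∀ {t E} (r : Reach t E) {st i G G'} → Consistent r st i G → Consistent r st i G' → E i G G'
  same-view start c c' u = trans (sym (c u)) (c' u)
  same-view (round r m _) (c , e) (c' , e') =
    same-view r c c' , λ j → bits-injective L (trans (sym (e j)) (e' j))

  consistent-resp : ∀ {t E} (r : Reach t E) {st i G G'} → Consistent r st i G → E i G G' → Consistent r st i G'
  consistent-resp start c e u = trans (c u) (e u)
  consistent-resp (round r m _) (c , h) (e , q) =
    consistent-resp r c e , λ j → trans (h j) (cong (bits L) (q j))

  -- The search can offer `coded (code G)` in place of `G`, which agrees with it entrywise; this
  -- shows that no view tells them apart.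
  same-rows : ∀ {t E} (r : Reach t E) {G G'} → (∀ i → Row i G G') → ∀ i → E i G G'
  same-rows start e = e
  same-rows (round r m det) e i = same-rows r e i , λ j → det j _ _ (same-rows r e j) i

  guess : ∀ {t E} → Reach t E → Store → Fin n → Graph n
  guess r st i with any? (λ c → consistent? r st i (coded c))
  ... | yes (c , _) = coded c
  ... | no _ = fromMatrix (λ _ _ → false)

  -- The search cannot fail, because the encoding of the true graph is a candidate. Whatever it
  -- finds explains the same history, and equal histories mean equal views.
  guess-view : ∀ {t E} (r : Reach t E) {st i G} → Consistent r st i G → E i (guess r st i) G
  guess-view r {st} {i} {G} c with any? (λ c → consistent? r st i (coded c))
  ... | yes (_ , c') = same-view r c' c
  ... | no none = ⊥-elim (none (code G , consistent-resp r c (same-rows r (λ i u → sym (coded-code G i u)) i)))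

  sendAt : ∀ {t E} → Reach t E → ℕ → Fin n → Store → Fin n → Vec Bool L
  sendAt start ρ i st j = Vec.replicate L false
  sendAt (round {t} r m _) ρ i st j with ρ ≟ t
  ... | yes _ = bits L (m (guess r st i) i j)
  ... | no _  = sendAt r ρ i st j

  module _ {T E} (R : Reach T E) (out : Graph n → Fin n → List (Fin n × ℕ)) where

    algorithm : CCAlgorithm n L
    algorithm = record
      { State  = Store
      ; init   = λ i row → row , λ _ _ → Vec.replicate L false
      ; send   = sendAt R
      ; recv   = λ ρ i st ms → proj₁ st , λ ρ' → if ρ' ≡ᵇ ρ then ms else proj₂ st ρ'
      ; output = λ i st → out (guess R st i) i
      }

    -- Initial segments of the protocol `R`. Induction runs over these, while the algorithm is fixed
    -- and looks up its messages in the whole of `R`.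
    data _⊑R : ∀ {t E} → Reach t E → Set₁ where
      whole : R ⊑R
      part  : ∀ {t E} {r : Reach t E} {m det} → round r m det ⊑R → r ⊑R

    row-kept : ∀ G ρ i → proj₁ (run algorithm G ρ i) ≡ adj G i
    row-kept G zero i = refl
    row-kept G (suc ρ) i = row-kept G ρ i

    message-kept : ∀ G {t} ρ i j → t < ρ → proj₂ (run algorithm G ρ i) t j ≡ sendAt R t j (run algorithm G t j) i
    message-kept G {t} (suc ρ) i j (s≤s t≤ρ) with t ≡ᵇ ρ in eq
    ... | true with refl ← true-≡ᵇ {t} eq = refl
    ... | false = message-kept G ρ i j (≤∧≢⇒< t≤ρ λ { refl → case trans (sym eq) (≡ᵇ-refl t) of λ () })

    sendAt-stable : ∀ {t E} (r : Reach t E) {m det} → round r m det ⊑R → ∀ i st j →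
      sendAt R t i st j ≡ bits L (m (guess r st i) i j)
    sendAt-stable {t} r {m} {det} p i st j = trans (go p (s≤s ≤-refl)) last
      where
      go : ∀ {t' E'} {r' : Reach t' E'} → r' ⊑R → t < t' → sendAt R t i st j ≡ sendAt r' t i st j
      go whole _ = refl
      go {t'} (part {r = r'} {m'} {det'} q) lt = trans (go q (m≤n⇒m≤1+n lt)) skip
        where
        skip : sendAt (round r' m' det') t i st j ≡ sendAt r' t i st j
        skip with t ≟ t'
        ... | yes e = ⊥-elim (<-irrefl e lt)
        ... | no _ = refl
      last : sendAt (round r m det) t i st j ≡ bits L (m (guess r st i) i j)
      last with t ≟ t
      ... | yes _ = refl
      ... | no ne = ⊥-elim (ne refl)

    -- If the history before round `t` is that of `G`, every sender's guess shares its view of `G`;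
    -- its message, being constant on views, is then the one prescribed for `G`.
    run-consistent : ∀ {t E} (r : Reach t E) → r ⊑R → ∀ G ρ → t ≤ ρ → ∀ i → Consistent r (run algorithm G ρ i) i G
    run-consistent start p G ρ le i u = cong (λ f → f u) (row-kept G ρ i)
    run-consistent (round {t} r m det) p G ρ lt i =
      run-consistent r (part p) G ρ (<⇒≤ lt) i , λ j →
        trans (message-kept G ρ i j lt)
        (trans (sendAt-stable r p j (run algorithm G t j) i)
        (cong (bits L) (det j _ _ (guess-view r (run-consistent r (part p) G t ≤-refl j)) i)))

  extract : ∀ {T P} → Knows T P → (out : Graph n → Fin n → List (Fin n × ℕ)) →
    (∀ i G G' → P i G G' → out G i ≡ out G' i) →
    Σ (CCAlgorithm n L) λ A → Σ ℕ λ T' → T' ≤ T × (∀ G i → output A i (run A G T' i) ≡ out G i)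
  extract (knows t le E r imp) out det = algorithm r out , t , le , λ G i →
    det i _ _ (imp i _ _ (guess-view r (run-consistent r out r whole G t ≤-refl i)))

  solves : ∀ {T P} → Knows T P → (out : Graph n → Fin n → List (Fin n × ℕ)) →
    (∀ i G G' → P i G G' → out G i ≡ out G' i) → ∀ k d → (∀ G i → CorrectOutput G k d i (out G i)) →
    Σ (CCAlgorithm n L) λ A → Σ ℕ λ T' → T' ≤ T × SolvesNearest A k d T'
  solves κ out det k d correct with extract κ out det
  ... | A , T' , le , computes = A , T' , le , λ G i → subst (CorrectOutput G k d i) (sym (computes G i)) (correct G i)

-- Simulating a larger clique

module Simulation {Ω : Set} (n N c : ℕ) .{{_ : NonZero n}} (N≤cn : N ≤ c * n) (M : ℕ) (blank : Fin M)
  (F₀ : Rel n Ω) (E₀ : Rel N Ω) where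

  module Real = Clique M F₀
  module Virtual = Clique M E₀

  owner : Fin N → Fin n
  owner x = toℕ x mod n

  slot : Fin c → Fin n → Maybe (Fin N)
  slot a i with toℕ i + toℕ a * n <? N
  ... | yes p = just (fromℕ< p)
  ... | no _  = nothing

  slot-owner : ∀ a i {x} → slot a i ≡ just x → owner x ≡ i
  slot-owner a i e with toℕ i + toℕ a * n <? N | e
  ... | yes p | refl = toℕ-injective (trans (toℕ-mod _ n) (trans (cong (_% n) (toℕ-fromℕ< p))
    (trans ([m+kn]%n≡m%n (toℕ i) (toℕ a) n) (m<n⇒m%n≡m (toℕ<n i)))))

  owner-slot : ∀ x → ∃ λ a → slot a (owner x) ≡ just x
  owner-slot x = a , found
    where
    a : Fin c
    a = fromℕ< (m<n*o⇒m/o<n (≤-trans (toℕ<n x) N≤cn))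
    position : toℕ (owner x) + toℕ a * n ≡ toℕ x
    position = trans (cong₂ (λ u v → u + v * n) (toℕ-mod (toℕ x) n) (toℕ-fromℕ< (m<n*o⇒m/o<n (≤-trans (toℕ<n x) N≤cn)))) (sym (m≡m%n+[m/n]*n (toℕ x) n))
    found : slot a (owner x) ≡ just x
    found with toℕ (owner x) + toℕ a * n <? N
    ... | yes p = cong just (toℕ-injective (trans (toℕ-fromℕ< p) position))
    ... | no np = ⊥-elim (np (subst (_< N) (sym position) (toℕ<n x)))

  Owned : Rel N Ω → Rel n Ω
  Owned E i ω ω' = ∀ x → owner x ≡ i → E x ω ω'

  module _ (start-owned : ∀ i ω ω' → F₀ i ω ω' → Owned E₀ i ω ω') where

    -- A virtual round takes `c * c` real ones, one for each pair of a slot at the sender and a slot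
    -- at the receiver; pairs with an empty slot exchange `blank`.
    simulate : ∀ {t E} → Virtual.Reach t E → Real.Knows (t * (c * c)) (Owned E)
    simulate Virtual.start = Real.knows 0 z≤n F₀ Real.start start-owned
    simulate (Virtual.round {t} {E} r m det) =
      Real.weaken (≤-reflexive (+-comm (t * (c * c)) (c * c))) (λ j ω ω' p x own → proj₁ p x own , received j ω ω' (proj₂ p) x own)
        (Real.sends (record { enc = id ; enc-injective = id }) (c * c) (simulate r) message determined)
      where
      relay : Ω → Maybe (Fin N) → Maybe (Fin N) → Fin M
      relay ω (just x) (just y) = m ω x y
      relay ω _ _ = blank
      message : Fin (c * c) → Ω → Fin n → Fin n → Fin M
      message β ω i j = relay ω (slot (quotient {c} c β) i) (slot (remainder {c} c β) j)
      relay-det : ∀ ω ω' mx my → (∀ x → mx ≡ just x → E x ω ω') → relay ω mx my ≡ relay ω' mx my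
      relay-det ω ω' (just x) (just y) e = det x ω ω' (e x refl) y
      relay-det ω ω' (just x) nothing e = refl
      relay-det ω ω' nothing my e = refl
      determined : ∀ i ω ω' → Owned E i ω ω' → ∀ β j → message β ω i j ≡ message β ω' i j
      determined i ω ω' e β j = relay-det ω ω' (slot (quotient {c} c β) i) _ (λ x s → e x (slot-owner (quotient {c} c β) i s))
      received : ∀ j ω ω' → (∀ β i → message β ω i j ≡ message β ω' i j) → ∀ x → owner x ≡ j → ∀ y → m ω y x ≡ m ω' y x
      received j ω ω' e x refl y with owner-slot x | owner-slot y
      ... | b , eb | a , ea = trans (sym (at ω)) (trans (e (combine a b) (owner y)) (at ω'))
        where
        at : ∀ ω → message (combine a b) ω (owner y) (owner x) ≡ m ω y x
        at ω = cong₂ (relay ω)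
          (trans (cong (λ k → slot k (owner y)) (cong proj₁ (remQuot-combine {c} {c} a b))) ea)
          (trans (cong (λ k → slot k (owner x)) (cong proj₂ (remQuot-combine {c} {c} a b))) eb)

    simulate-knows : ∀ {T P} → Virtual.Knows T P → Real.Knows (T * (c * c)) (Owned P)
    simulate-knows (Virtual.knows t le E r imp) =
      Real.weaken (*-monoˡ-≤ (c * c) le) (λ i ω ω' e x own → imp x ω ω' (e x own)) (simulate r)

-- Intervals of bounded weight

prefix : ∀ {n} → (Fin n → ℕ) → Fin n → ℕ
prefix w u = sum (λ u' → 𝟙 (toℕ u' <ᵇ toℕ u) * w u')

prefix-cong : ∀ {n} {w w' : Fin n → ℕ} → (∀ u → w u ≡ w' u) → ∀ u → prefix w u ≡ prefix w' u
prefix-cong e u = sum-cong-≗ (λ u' → cong (𝟙 (toℕ u' <ᵇ toℕ u) *_) (e u'))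

opaque
  unfolding sum

  prefix-zero : ∀ {n} (w : Fin (suc n) → ℕ) → prefix w zero ≡ 0
  prefix-zero {n} w = sum-zero {n} (λ u → refl)

  prefix-suc : ∀ {n} (w : Fin (suc n) → ℕ) u → prefix w (suc u) ≡ w zero + prefix (w ∘ suc) u
  prefix-suc w u = cong (_+ prefix (w ∘ suc) u) (+-identityʳ (w zero))

prefix-≤-sum : ∀ {n} (w : Fin n → ℕ) u → prefix w u ≤ sum w
prefix-≤-sum w u = sum-mono (λ u' → ≤-trans (*-monoˡ-≤ (w u') (𝟙≤1 (toℕ u' <ᵇ toℕ u))) (≤-reflexive (*-identityˡ (w u'))))

prefix-mono : ∀ {n} (w : Fin n → ℕ) {u v} → toℕ u ≤ toℕ v → prefix w u ≤ prefix w v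
prefix-mono w le = sum-mono (λ u' → *-monoˡ-≤ (w u') (𝟙-mono (λ e → <ᵇ-true (≤-trans (true-<ᵇ e) le))))

opaque
  -- Cuts the line of cumulative weight at the multiples of `B`; an element belongs to the piece in
  -- which it starts. A total below `P * B` keeps the quotient below `P`, so that the reduction
  -- loses nothing.
  bucket : ∀ {n} P B .{{_ : NonZero P}} .{{_ : NonZero B}} → (Fin n → ℕ) → Fin n → Fin P
  bucket P B w u = (prefix w u / B) mod P

  bucket-cong : ∀ {n} P B .{{_ : NonZero P}} .{{_ : NonZero B}} {w w' : Fin n → ℕ} →
    (∀ u → w u ≡ w' u) → ∀ u → bucket P B w u ≡ bucket P B w' u
  bucket-cong P B e u = cong (λ k → (k / B) mod P) (prefix-cong e u)

module _ (B mx κ : ℕ) .{{_ : NonZero B}} where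

  bucketWeight : ∀ {n} → ℕ → (Fin n → ℕ) → ℕ
  bucketWeight a w = sum (λ u → 𝟙 ((a + prefix w u) / B ≡ᵇ κ) * w u)

  opaque
    unfolding sum

    bucketWeight-suc : ∀ {n} a (w : Fin (suc n) → ℕ) →
      bucketWeight a w ≡ 𝟙 (a / B ≡ᵇ κ) * w zero + bucketWeight (a + w zero) (w ∘ suc)
    bucketWeight-suc a w = cong₂ _+_
      (cong (λ z → 𝟙 (z / B ≡ᵇ κ) * w zero) (trans (cong (a +_) (prefix-zero w)) (+-identityʳ a)))
      (sum-cong-≗ (λ u → cong (λ z → 𝟙 (z / B ≡ᵇ κ) * w (suc u))
        (trans (cong (a +_) (prefix-suc w u)) (sym (+-assoc a (w zero) _)))))

    bucketWeight-zero : ∀ a (w : Fin 0 → ℕ) → bucketWeight a w ≡ 0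
    bucketWeight-zero a w = refl

  -- The elements that start in piece `κ` are consecutive, and the last one overshoots `suc κ * B`
  -- by at most `mx`. Here `a` is the weight already passed: the bound with `a` carries the
  -- induction, and it yields the bound with `κ * B` at an element of the piece, where `κ * B ≤ a`.
  bucketWeight-≤ : ∀ {n} a (w : Fin n → ℕ) → (∀ u → w u ≤ mx) →
    bucketWeight a w ≡ 0 ⊎ (bucketWeight a w + a ≤ suc κ * B + mx × bucketWeight a w + κ * B ≤ suc κ * B + mx)
  bucketWeight-≤ {zero} a w le = inj₁ (bucketWeight-zero a w)
  bucketWeight-≤ {suc n} a w le rewrite bucketWeight-suc a w with a / B ≡ᵇ κ in eq | bucketWeight-≤ (a + w zero) (w ∘ suc) (le ∘ suc)
  ... | false | inj₁ z = inj₁ z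
  ... | false | inj₂ (p , q) = inj₂ (≤-trans (+-monoʳ-≤ _ (m≤m+n a (w zero))) p , q)
  ... | true | rest = inj₂ (with-a rest , ≤-trans (+-monoʳ-≤ _ lower) (with-a rest))
    where
    F = bucketWeight (a + w zero) (w ∘ suc)
    quotient≡ : a / B ≡ κ
    quotient≡ = true-≡ᵇ eq
    lower : κ * B ≤ a
    lower = subst (λ k → k * B ≤ a) quotient≡ (m/n*n≤m a B)
    upper : a ≤ suc κ * B
    upper = subst (λ k → a ≤ suc k * B) quotient≡ (≤-trans (≤-reflexive (m≡m%n+[m/n]*n a B)) (+-monoˡ-≤ (a / B * B) (<⇒≤ (m%n<n a B))))
    arith : ∀ w F a → 1 * w + F + a ≡ F + (a + w)
    arith = solve-∀
    with-a : F ≡ 0 ⊎ (F + (a + w zero) ≤ suc κ * B + mx × F + κ * B ≤ suc κ * B + mx) →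
      1 * w zero + F + a ≤ suc κ * B + mx
    with-a (inj₁ z) = ≤-trans (≤-reflexive (trans (arith (w zero) F a) (cong (_+ (a + w zero)) z))) (+-mono-≤ upper (le zero))
    with-a (inj₂ (p , _)) = ≤-trans (≤-reflexive (arith (w zero) F a)) p

module _ {n} (P B : ℕ) .{{_ : NonZero P}} .{{_ : NonZero B}} (w : Fin n → ℕ) (total : sum w < P * B) where

  opaque
    unfolding bucket

    toℕ-bucket : ∀ u → toℕ (bucket P B w u) ≡ prefix w u / B
    toℕ-bucket u = trans (toℕ-mod _ P) (m<n⇒m%n≡m (m<n*o⇒m/o<n (≤-<-trans (prefix-≤-sum w u) total)))

  bucket-mono : ∀ {u v} → toℕ u ≤ toℕ v → toℕ (bucket P B w u) ≤ toℕ (bucket P B w v)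
  bucket-mono {u} {v} le = subst₂ _≤_ (sym (toℕ-bucket u)) (sym (toℕ-bucket v)) (/-monoˡ-≤ B (prefix-mono w le))

  bucket-load : ∀ mx → (∀ u → w u ≤ mx) → ∀ κ → sum (λ u → 𝟙 (bucket P B w u == κ) * w u) ≤ B + mx
  bucket-load mx le κ = begin
    sum (λ u → 𝟙 (bucket P B w u == κ) * w u) ≤⟨ sum-mono (λ u → *-monoˡ-≤ (w u) (𝟙-mono (λ e → same u (==⇒≡ e)))) ⟩
    F                                         ≤⟨ small (bucketWeight-≤ B mx (toℕ κ) 0 w le) ⟩
    B + mx                                    ∎
    where
    open ≤-Reasoning
    F = bucketWeight B mx (toℕ κ) 0 w
    same : ∀ u → bucket P B w u ≡ κ → (prefix w u / B ≡ᵇ toℕ κ) ≡ true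
    same u refl = trans (cong (prefix w u / B ≡ᵇ_) (toℕ-bucket u)) (≡ᵇ-refl (prefix w u / B))
    arith : ∀ κ B mx → suc κ * B + mx ≡ (B + mx) + κ * B
    arith = solve-∀
    small : F ≡ 0 ⊎ (F + 0 ≤ suc (toℕ κ) * B + mx × F + toℕ κ * B ≤ suc (toℕ κ) * B + mx) → F ≤ B + mx
    small (inj₁ z) = ≤-trans (≤-reflexive z) z≤n
    small (inj₂ (_ , q)) = +-cancelʳ-≤ (toℕ κ * B) F (B + mx) (≤-trans q (≤-reflexive (arith (toℕ κ) B mx)))

-- Minima and selection of the smallest values

mins : ∀ {n} → ℕ → (Fin n → ℕ) → ℕ
mins {zero}  c f = c
mins {suc n} c f = f zero ⊓ mins c (f ∘ suc)

mins-cong : ∀ {n} c {f g : Fin n → ℕ} → (∀ i → f i ≡ g i) → mins c f ≡ mins c g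
mins-cong {zero} c e = refl
mins-cong {suc n} c e = cong₂ _⊓_ (e zero) (mins-cong c (e ∘ suc))

mins-≤-cap : ∀ {n} c (f : Fin n → ℕ) → mins c f ≤ c
mins-≤-cap {zero} c f = ≤-refl
mins-≤-cap {suc n} c f = ≤-trans (m⊓n≤n (f zero) _) (mins-≤-cap c (f ∘ suc))

mins-≤ : ∀ {n} c (f : Fin n → ℕ) i → mins c f ≤ f i
mins-≤ c f zero = m⊓n≤m (f zero) _
mins-≤ c f (suc i) = ≤-trans (m⊓n≤n (f zero) _) (mins-≤ c (f ∘ suc) i)

mins-attained : ∀ {n} c (f : Fin n → ℕ) {x} → mins c f ≤ x → x < c → ∃ λ i → f i ≤ x
mins-attained {zero} c f le lt = ⊥-elim (<-irrefl refl (<-≤-trans lt le))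
mins-attained {suc n} c f {x} le lt with f zero ≤? x
... | yes p = zero , p
... | no np with ⊓-sel (f zero) (mins c (f ∘ suc))
... | inj₁ e = ⊥-elim (np (subst (_≤ x) e le))
... | inj₂ e with mins-attained c (f ∘ suc) (subst (_≤ x) e le) lt
... | i , q = suc i , q

rank : ∀ {n} → (Fin n → Bool) → Fin n → ℕ
rank p u = # (λ u' → (toℕ u' <ᵇ toℕ u) ∧ p u')

opaque
  unfolding sum

  rank-zero : ∀ {n} (p : Fin (suc n) → Bool) → rank p zero ≡ 0
  rank-zero {n} p = sum-zero {n} (λ u → refl)

  rank-suc : ∀ {n} (p : Fin (suc n) → Bool) u → rank p (suc u) ≡ 𝟙 (p zero) + rank (p ∘ suc) u
  rank-suc p u = refl

  #-suc : ∀ {n} (p : Fin (suc n) → Bool) → # p ≡ 𝟙 (p zero) + # (p ∘ suc)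
  #-suc p = refl

  #-nil : (p : Fin 0 → Bool) → # p ≡ 0
  #-nil p = refl

first-count : ∀ {n} (p : Fin n → Bool) K c → c ≤ K →
  c + # (λ u → p u ∧ (c + rank p u <ᵇ K)) ≡ (c + # p) ⊓ K
first-count {zero} p K c le = trans (cong (c +_) (#-nil _)) (trans (+-identityʳ c)
  (trans (sym (m≤n⇒m⊓n≡m le)) (cong (_⊓ K) (sym (trans (cong (c +_) (#-nil p)) (+-identityʳ c))))))
first-count {suc n} p K c le with p zero in eq
... | false = trans (cong (c +_) shift) (trans (first-count (p ∘ suc) K c le) (cong (λ z → (c + z) ⊓ K) (sym (trans (#-suc p) (cong (λ b → 𝟙 b + # (p ∘ suc)) eq)))))
  where
  shift : # (λ u → p u ∧ (c + rank p u <ᵇ K)) ≡ # (λ u → p (suc u) ∧ (c + rank (p ∘ suc) u <ᵇ K))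
  shift = trans (#-suc _) (cong₂ _+_ (cong (λ b → 𝟙 (b ∧ (c + rank p zero <ᵇ K))) eq)
    (#-cong (λ u → cong (λ r → p (suc u) ∧ (c + r <ᵇ K)) (trans (rank-suc p u) (cong (λ b → 𝟙 b + rank (p ∘ suc) u) eq)))))
... | true with m≤n⇒m<n∨m≡n le
... | inj₁ c<K = trans (cong (c +_) shift) (trans (+-suc c _) (trans (first-count (p ∘ suc) K (suc c) c<K)
      (cong (_⊓ K) (trans (sym (+-suc c _)) (cong (c +_) (sym (trans (#-suc p) (cong (λ b → 𝟙 b + # (p ∘ suc)) eq))))))))
  where
  shift : # (λ u → p u ∧ (c + rank p u <ᵇ K)) ≡ 1 + # (λ u → p (suc u) ∧ (suc c + rank (p ∘ suc) u <ᵇ K))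
  shift = trans (#-suc _) (cong₂ _+_
    (cong 𝟙 (∧-join eq (<ᵇ-true (subst (_< K) (sym (trans (cong (c +_) (rank-zero p)) (+-identityʳ c))) c<K))))
    (#-cong (λ u → cong (λ r → p (suc u) ∧ (r <ᵇ K)) (trans (cong (c +_) (trans (rank-suc p u) (cong (λ b → 𝟙 b + rank (p ∘ suc) u) eq))) (+-suc c _)))))
... | inj₂ refl = trans (cong (c +_) (#-zero (λ u → trans (cong (p u ∧_) (<ᵇ-false (m≤m+n c _))) (∧-zeroʳ (p u)))))
      (trans (+-identityʳ c) (sym (m≥n⇒m⊓n≡n (m≤m+n c _))))

-- The k smallest values below 2 ^ H of a function, found by bitwise binary
-- search for the cutoff; ties at the cutoff are broken by index.
module Selection (K H : ℕ) where

  ∞ : ℕ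
  ∞ = 2 ^ H

  below : ∀ {n} → (Fin n → ℕ) → ℕ → ℕ
  below f x = # (λ u → f u <ᵇ x)

  cutoffFrom : ∀ {n} → (Fin n → ℕ) → ℕ → ℕ → ℕ
  cutoffFrom f zero    lo = lo
  cutoffFrom f (suc b) lo = cutoffFrom f b (if below f (lo + 2 ^ b) <ᵇ K then lo + 2 ^ b else lo)

  cutoff : ∀ {n} → (Fin n → ℕ) → ℕ
  cutoff f = cutoffFrom f H 0

  chosen : ∀ {n} → (Fin n → ℕ) → Fin n → Bool
  chosen f u = (f u <ᵇ cutoff f) ∨ ((f u ≡ᵇ cutoff f) ∧ (below f (cutoff f) + rank (λ u' → f u' ≡ᵇ cutoff f) u <ᵇ K))

  trim : ∀ {n} → (Fin n → ℕ) → Fin n → ℕ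
  trim f u = if chosen f u then f u else ∞

  IsCutoff : ∀ {n} → (Fin n → ℕ) → ℕ → Set
  IsCutoff f θ = below f θ < K × (K ≤ below f (suc θ) ⊎ suc θ ≡ ∞)

  -- The invariant of the search: fewer than `K` values lie below `lo`, while at `lo + 2 ^ b` this
  -- fails or the cap `∞` is reached.
  cutoffFrom-spec : ∀ {n} (f : Fin n → ℕ) b lo → below f lo < K →
    (K ≤ below f (lo + 2 ^ b) ⊎ lo + 2 ^ b ≡ ∞) → IsCutoff f (cutoffFrom f b lo)
  cutoffFrom-spec f zero lo p q = p , subst (λ z → K ≤ below f z ⊎ z ≡ ∞) (+-comm lo 1) q
  cutoffFrom-spec f (suc b) lo p q with below f (lo + 2 ^ b) <ᵇ K in eq
  ... | true = cutoffFrom-spec f b (lo + 2 ^ b) (true-<ᵇ eq) (subst (λ z → K ≤ below f z ⊎ z ≡ ∞) (arith lo (2 ^ b)) q)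
    where
    arith : ∀ a b → a + 2 * b ≡ a + b + b
    arith = solve-∀
  ... | false = cutoffFrom-spec f b lo p (inj₁ (≮⇒≥ (λ lt → case trans (sym eq) (<ᵇ-true lt) of λ ())))

  module _ (1≤K : 1 ≤ K) {n} (f : Fin n → ℕ) where

    cutoff-spec : IsCutoff f (cutoff f)
    cutoff-spec = cutoffFrom-spec f H 0 (≤-trans (s≤s (≤-reflexive (#-zero {p = λ u → f u <ᵇ 0} (λ u → refl)))) 1≤K) (inj₂ refl)

    cutoff<∞ : ∀ b lo → lo + 2 ^ b ≤ ∞ → cutoffFrom f b lo < ∞
    cutoff<∞ zero lo le = ≤-trans (≤-reflexive (+-comm 1 lo)) le
    cutoff<∞ (suc b) lo le with below f (lo + 2 ^ b) <ᵇ K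
    ... | true = cutoff<∞ b (lo + 2 ^ b) (≤-trans (≤-reflexive (arith lo (2 ^ b))) le)
      where
      arith : ∀ a b → a + b + b ≡ a + 2 * b
      arith = solve-∀
    ... | false = cutoff<∞ b lo (≤-trans (+-monoʳ-≤ lo (m≤m+n (2 ^ b) _)) le)

    private
      θ = cutoff f
      tie : Fin n → Bool
      tie u = f u ≡ᵇ θ

    below-suc : below f (suc θ) ≡ below f θ + # tie
    below-suc = trans (sum-cong-≗ (λ u → split (f u) θ)) (∑-distrib-+ (λ u → 𝟙 (f u <ᵇ θ)) (λ u → 𝟙 (tie u)))
      where
      split : ∀ a b → 𝟙 (a <ᵇ suc b) ≡ 𝟙 (a <ᵇ b) + 𝟙 (a ≡ᵇ b)
      split zero zero = refl
      split zero (suc b) = refl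
      split (suc a) zero = refl
      split (suc a) (suc b) = split a b

    #-chosen : # (chosen f) ≡ below f (suc θ) ⊓ K
    #-chosen = trans (sum-cong-≗ (λ u → disjoint (f u) θ _))
      (trans (∑-distrib-+ (λ u → 𝟙 (f u <ᵇ θ)) (λ u → 𝟙 (tie u ∧ (below f θ + rank tie u <ᵇ K))))
      (trans (first-count tie K (below f θ) (<⇒≤ (proj₁ cutoff-spec))) (cong (_⊓ K) (sym below-suc))))
      where
      disjoint : ∀ a b c → 𝟙 ((a <ᵇ b) ∨ ((a ≡ᵇ b) ∧ c)) ≡ 𝟙 (a <ᵇ b) + 𝟙 ((a ≡ᵇ b) ∧ c)
      disjoint zero zero c = refl
      disjoint zero (suc b) c = refl
      disjoint (suc a) zero c = refl
      disjoint (suc a) (suc b) c = disjoint a b c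

    #-chosen-≤ : # (chosen f) ≤ K
    #-chosen-≤ = ≤-trans (≤-reflexive #-chosen) (m⊓n≤n _ K)

    chosen⇒≤θ : ∀ u → chosen f u ≡ true → f u ≤ θ
    chosen⇒≤θ u e with f u <ᵇ θ in lt
    ... | true = <⇒≤ (true-<ᵇ lt)
    ... | false = ≤-reflexive (true-≡ᵇ (proj₁ (∧-split e)))

    chosen⇒<∞ : ∀ u → chosen f u ≡ true → f u < ∞
    chosen⇒<∞ u e = ≤-<-trans (chosen⇒≤θ u e) (cutoff<∞ H 0 ≤-refl)

    trim-chosen : ∀ u → chosen f u ≡ true → trim f u ≡ f u
    trim-chosen u e = cong (λ b → if b then f u else ∞) e

    trim<∞⇒chosen : ∀ u → trim f u < ∞ → chosen f u ≡ true
    trim<∞⇒chosen u lt with chosen f u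
    ... | true = refl
    ... | false = ⊥-elim (<-irrefl refl lt)

    trim-sound : ∀ u {x} → trim f u ≤ x → x < ∞ → f u ≤ x
    trim-sound u le lt = subst (_≤ _) (trim-chosen u (trim<∞⇒chosen u (≤-<-trans le lt))) le

    -- Values below the cutoff are all kept. At levels from the cutoff on, either `K` values have
    -- been chosen, or the cutoff is the last finite value and every finite value has been chosen.
    trim-complete : ∀ x → x < ∞ → (∀ u → f u ≤ x → trim f u ≤ x) ⊎ K ≤ # (λ u → trim f u ≤ᵇ x)
    trim-complete x x<∞ with suc x ≤? θ
    ... | yes x<θ = inj₁ λ u le → subst (_≤ x) (sym (trim-chosen u (∨-true (<ᵇ-true (≤-<-trans le x<θ))))) le
    ... | no x≮θ with K ≤? below f (suc θ)
    ... | yes full = inj₂ (≤-trans (≤-reflexive (trans (sym (m≥n⇒m⊓n≡n full)) (sym #-chosen)))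
            (#-mono (λ u e → ≤ᵇ-true (subst (_≤ x) (sym (trim-chosen u e)) (≤-trans (chosen⇒≤θ u e) (≮⇒≥ x≮θ))))))
      where
      ≤ᵇ-true : ∀ {a b} → a ≤ b → (a ≤ᵇ b) ≡ true
      ≤ᵇ-true {zero} _ = refl
      ≤ᵇ-true {suc a} {suc b} p = <ᵇ-true p
    ... | no notFull with proj₂ cutoff-spec
    ... | inj₁ full = ⊥-elim (notFull full)
    ... | inj₂ top = inj₁ λ u le → subst (_≤ x) (sym (trim-chosen u (all-chosen u (s≤s⁻¹ (≤-trans (s≤s le) (≤-trans x<∞ (≤-reflexive (sym top)))))))) le
      where
      all-chosen : ∀ u → f u ≤ θ → chosen f u ≡ true
      all-chosen u le with m≤n⇒m<n∨m≡n le
      ... | inj₁ lt = ∨-true (<ᵇ-true lt)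
      ... | inj₂ e rewrite e | ≡ᵇ-refl θ = trans (cong ((θ <ᵇ θ) ∨_) room) (∨-zeroʳ (θ <ᵇ θ))
        where
        room : (below f θ + rank tie u <ᵇ K) ≡ true
        room = <ᵇ-true (≤-<-trans (+-monoʳ-≤ (below f θ) (#-mono (λ v e → proj₂ (∧-split {toℕ v <ᵇ toℕ u} e))))
          (subst (_< K) below-suc (≰⇒> notFull)))

≤ᵇ-true : ∀ {m n} → m ≤ n → (m ≤ᵇ n) ≡ true
≤ᵇ-true {zero} _ = refl
≤ᵇ-true {suc m} p = <ᵇ-true p

true-≤ᵇ : ∀ {m n} → (m ≤ᵇ n) ≡ true → m ≤ n
true-≤ᵇ {zero} _ = z≤n
true-≤ᵇ {suc m} e = true-<ᵇ e

∀⊎∃ : ∀ {n} {A B : Fin n → Set} → (∀ i → A i ⊎ B i) → (∀ i → A i) ⊎ ∃ B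
∀⊎∃ {zero} c = inj₁ λ ()
∀⊎∃ {suc n} c with c zero | ∀⊎∃ (c ∘ suc)
... | inj₂ b | _ = inj₂ (zero , b)
... | inj₁ a | inj₁ as = inj₁ λ { zero → a ; (suc i) → as i }
... | inj₁ a | inj₂ (i , b) = inj₂ (suc i , b)

-- Walks, truncated distance tables and doubling

module _ {n} (G : Graph n) where

  Within-mono : ∀ {s t u v} → s ≤ t → Within G s u v → Within G t u v
  Within-mono {s} {zero} z≤n p = p
  Within-mono {s} {suc t} le p with m≤n⇒m<n∨m≡n le
  ... | inj₁ (s≤s lt) = inj₁ (Within-mono lt p)
  ... | inj₂ refl = p

  Within-trans : ∀ s t {u w v} → Within G s u w → Within G t w v → Within G (s + t) u v
  Within-trans s zero p refl = subst (λ k → Within G k _ _) (sym (+-identityʳ s)) p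
  Within-trans s (suc t) p q rewrite +-suc s t with q
  ... | inj₁ q' = inj₁ (Within-trans s t p q')
  ... | inj₂ (x , q' , a) = inj₂ (x , Within-trans s t p q' , a)

  Within-split : ∀ s t {u v} → Within G (s + t) u v → ∃ λ w → Within G s u w × Within G t w v
  Within-split s zero {u} {v} p = v , subst (λ k → Within G k _ _) (+-identityʳ s) p , refl
  Within-split s (suc t) p rewrite +-suc s t with p
  ... | inj₁ p' with Within-split s t p'
  ...   | w , a , b = w , a , inj₁ b
  Within-split s (suc t) p | inj₂ (x , p' , e) with Within-split s t p'
  ...   | w , a , b = w , a , inj₂ (x , b , e)

-- A function is a sufficient approximation when each of its level sets is
-- either complete or already has K elements; this notion composes.
Covers : ∀ {n} → ℕ → (Fin n → Set) → (Fin n → ℕ) → ℕ → Set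
Covers K A f x = (∀ u → A u → f u ≤ x) ⊎ K ≤ # (λ u → f u ≤ᵇ x)

-- If the first approximation has `K` values up to `x`, completeness of the second preserves them.
-- Truncations can thus be chained without an account of what each one drops.
Covers-trans : ∀ {n K x} {A : Fin n → Set} {f g : Fin n → ℕ} →
  Covers K A f x → Covers K (λ u → f u ≤ x) g x → Covers K A g x
Covers-trans _ (inj₂ q) = inj₂ q
Covers-trans (inj₁ p) (inj₁ q) = inj₁ (λ u a → q u (p u a))
Covers-trans (inj₂ p) (inj₁ q) = inj₂ (≤-trans p (#-mono (λ u e → ≤ᵇ-true (q u (true-≤ᵇ e)))))

module Product (K H : ℕ) {n P : ℕ} (J : Fin n → Fin n → Fin P) (h : Fin n → Fin n → ℕ) where
  open Selection K H

  through : Fin n → Fin P → Fin n → ℕ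
  through v j u = mins ∞ (λ w → if J v w == j then h v w + h w u else ∞)

  -- Trimming precedes merging, so this may exceed the true minimum; but a finite value dropped by a
  -- trimming leaves `K` values behind that are no larger.
  merged : Fin n → Fin n → ℕ
  merged v u = mins ∞ (λ j → trim (through v j) u)

  next : Fin n → Fin n → ℕ
  next v = trim (merged v)

module Doubling {n} (G : Graph n) (K H : ℕ) (1≤K : 1 ≤ K) where
  open Selection K H

  -- An entry may overestimate a distance, so soundness promises only a walk of that length. `few`
  -- bounds the packets a row can produce, and `capped` lets `∞` stand for every missing entry.
  record Approximates (D : ℕ) (h : Fin n → Fin n → ℕ) : Set where
    field
      sound    : ∀ v u x → x < ∞ → h v u ≤ x → Within G x v u
      complete : ∀ v x → x ≤ D → Covers K (Within G x v) (h v) x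
      few      : ∀ v → # (λ u → h v u <ᵇ ∞) ≤ K
      capped   : ∀ v u → h v u ≤ ∞
  open Approximates public

  trim-few : ∀ (f : Fin n → ℕ) → # (λ u → trim f u <ᵇ ∞) ≤ K
  trim-few f = ≤-trans (#-mono (λ u e → trim<∞⇒chosen 1≤K f u (true-<ᵇ e))) (#-chosen-≤ 1≤K f)

  trim-capped : ∀ (f : Fin n → ℕ) u → trim f u ≤ ∞
  trim-capped f u with chosen f u in e
  ... | true = <⇒≤ (chosen⇒<∞ 1≤K f u e)
  ... | false = ≤-refl

  edgeLength : Fin n → Fin n → ℕ
  edgeLength v u = if v == u then 0 else (if adj G v u then 1 else ∞)

  initial : Fin n → Fin n → ℕ
  initial v = trim (edgeLength v)

  initial-approximates : 1 < ∞ → Approximates 1 initial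
  initial-approximates 1<∞ = record
    { sound = λ v u x lt le → edge-sound v u x lt (trim-sound 1≤K (edgeLength v) u le lt)
    ; complete = λ v x le → Covers-trans (inj₁ (λ u → edge-complete v u x le)) (trim-complete 1≤K (edgeLength v) x (≤-<-trans le 1<∞))
    ; few = λ v → trim-few (edgeLength v)
    ; capped = λ v → trim-capped (edgeLength v)
    }
    where
    edge-sound : ∀ v u x → x < ∞ → edgeLength v u ≤ x → Within G x v u
    edge-sound v u x lt le with v == u in eq
    ... | true = Within-mono G z≤n (==⇒≡ eq)
    ... | false with adj G v u in a
    ... | true = Within-mono G le (inj₂ (v , refl , a))
    ... | false = ⊥-elim (<-irrefl refl (≤-<-trans le lt))
    edge-complete : ∀ v u x → x ≤ 1 → Within G x v u → edgeLength v u ≤ x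
    edge-complete v u zero _ refl rewrite ==-refl v = z≤n
    edge-complete v u (suc zero) _ p with v == u in eq
    ... | true = z≤n
    ... | false with p
    ... | inj₁ refl = case trans (sym eq) (==-refl v) of λ ()
    ... | inj₂ (w , refl , a) rewrite a = ≤-refl
    edge-complete v u (suc (suc x)) (s≤s ()) _

  module Step {P : ℕ} (J : Fin n → Fin n → Fin P) (h : Fin n → Fin n → ℕ) where
    open Product K H J h

    module _ {D : ℕ} (small : D + D < ∞) (ap : Approximates D h) where

      shortest : Fin n → Fin n → ℕ
      shortest v u = mins ∞ (λ w → h v w + h w u)

      -- The ball of radius 0 is `u` alone. If its level set counts as full instead of complete,
      -- some entry of the row is 0, and soundness identifies its column with `u`.
      self-zero : ∀ u → h u u ≤ 0
      self-zero u with complete ap u 0 z≤n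
      ... | inj₁ f = f u refl
      ... | inj₂ q with #-exists (λ w → h u w ≤ᵇ 0) (≤-trans 1≤K q)
      ... | w , e with refl ← sound ap u w 0 (≤-<-trans z≤n small) (true-≤ᵇ e) = true-≤ᵇ e

      -- Let `a` and `b` be the halves of `x`. If row `v` has `K` entries up to `a`, they persist
      -- with the target itself as middle vertex. If some `w` among the entries up to `a` has `K`
      -- entries up to `b`, these are `K` targets through `w`. Otherwise all the level sets involved
      -- are complete, and a walk of length `x` splits at its midpoint.
      shortest-complete : ∀ v x → x ≤ D + D → Covers K (Within G x v) (shortest v) x
      shortest-complete v x le with complete ap v ⌊ x /2⌋ half₁
        where
        half₁ : ⌊ x /2⌋ ≤ D
        half₁ = ≤-trans (⌊n/2⌋-mono le) (≤-reflexive (sym (n≡⌊n+n/2⌋ D)))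
      ... | inj₂ q = inj₂ (≤-trans q (#-mono (λ u e → ≤ᵇ-true (≤-trans (mins-≤ ∞ _ u)
              (≤-trans (+-mono-≤ (true-≤ᵇ {h v u} e) (self-zero u)) (≤-trans (≤-reflexive (+-identityʳ _)) (⌊n/2⌋≤n x)))))))
      ... | inj₁ fa = finish (∀⊎∃ decide)
        where
        a = ⌊ x /2⌋
        b = ⌈ x /2⌉
        half₂ : b ≤ D
        half₂ = ≤-trans (⌈n/2⌉-mono le) (≤-reflexive (sym (n≡⌈n+n/2⌉ D)))
        A B : Fin n → Set
        A w = h v w ≤ a → ∀ u → Within G b w u → h w u ≤ b
        B w = h v w ≤ a × K ≤ # (λ u → h w u ≤ᵇ b)
        decide : ∀ w → A w ⊎ B w
        decide w with h v w ≤? a | complete ap w b half₂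
        ... | no np | _ = inj₁ (λ p → ⊥-elim (np p))
        ... | yes p | inj₁ f = inj₁ (λ _ → f)
        ... | yes p | inj₂ q = inj₂ (p , q)
        combined : ∀ w u → h v w ≤ a → h w u ≤ b → shortest v u ≤ x
        combined w u p q = ≤-trans (mins-≤ ∞ _ w) (≤-trans (+-mono-≤ p q) (≤-reflexive (⌊n/2⌋+⌈n/2⌉≡n x)))
        finish : (∀ w → A w) ⊎ ∃ B → Covers K (Within G x v) (shortest v) x
        finish (inj₂ (w , p , q)) = inj₂ (≤-trans q (#-mono (λ u e → ≤ᵇ-true (combined w u p (true-≤ᵇ e)))))
        finish (inj₁ all) = inj₁ λ u p → case Within-split G a b (subst (λ k → Within G k v u) (sym (⌊n/2⌋+⌈n/2⌉≡n x)) p) of λ where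
          (w , p₁ , p₂) → combined w u (fa w p₁) (all w (fa w p₁) u p₂)

      merged-complete : ∀ v x → x < ∞ → Covers K (λ u → shortest v u ≤ x) (merged v) x
      merged-complete v x lt with ∀⊎∃ (λ j → trim-complete 1≤K (through v j) x lt)
      ... | inj₂ (j , q) = inj₂ (≤-trans q (#-mono (λ u e → ≤ᵇ-true (≤-trans (mins-≤ ∞ _ j) (true-≤ᵇ {trim (through v j) u} e)))))
      ... | inj₁ all = inj₁ λ u le → case mins-attained ∞ (λ w → h v w + h w u) le lt of λ where
        (w , p) → ≤-trans (mins-≤ ∞ _ (J v w)) (all (J v w) u (≤-trans (mins-≤ ∞ _ w)
          (≤-trans (≤-reflexive (cong (λ b → if b then h v w + h w u else ∞) (==-refl (J v w)))) p)))

      through-sound : ∀ v j u x → x < ∞ → through v j u ≤ x → Within G x v u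
      through-sound v j u x lt le with mins-attained ∞ _ le lt
      ... | w , p with J v w == j
      ... | false = ⊥-elim (<-irrefl refl (≤-<-trans p lt))
      ... | true = Within-mono G p (Within-trans G (h v w) (h w u)
              (sound ap v w _ (≤-<-trans (≤-trans (m≤m+n _ _) p) lt) ≤-refl)
              (sound ap w u _ (≤-<-trans (≤-trans (m≤n+m _ (h v w)) p) lt) ≤-refl))

      next-approximates : Approximates (D + D) next
      next-approximates = record
        { sound = λ v u x lt le → case mins-attained ∞ _ (trim-sound 1≤K (merged v) u le lt) lt of λ where
            (j , p) → through-sound v j u x lt (trim-sound 1≤K (through v j) u p lt)
        ; complete = λ v x le → Covers-trans (shortest-complete v x le)
            (Covers-trans (merged-complete v x (≤-<-trans le small)) (trim-complete 1≤K (merged v) x (≤-<-trans le small)))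
        ; few = λ v → trim-few (merged v)
        ; capped = λ v → trim-capped (merged v)
        }

𝟙-zero : ∀ {b} → ¬ (b ≡ true) → 𝟙 b ≡ 0
𝟙-zero {true} f = ⊥-elim (f refl)
𝟙-zero {false} f = refl

𝟙-injective : ∀ {a b} → 𝟙 a ≡ 𝟙 b → a ≡ b
𝟙-injective {true} {true} e = refl
𝟙-injective {false} {false} e = refl

sum-single : ∀ {n} (f : Fin n → ℕ) j → (∀ i → i ≢ j → f i ≡ 0) → sum f ≡ f j
sum-single f j z = trans (sum-cong-≗ lem) (sum-indicator j f)
  where
  lem : ∀ i → f i ≡ 𝟙 (i == j) * f i
  lem i with i ≟F j
  ... | yes refl = sym (+-identityʳ _)
  ... | no ne = z i ne

sum-indicator-≤ : ∀ {n} (f : Fin n → ℕ) j c → (∀ i → f i ≤ 𝟙 (i == j) * c) → sum f ≤ c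
sum-indicator-≤ f j c le = ≤-trans (sum-mono le) (≤-reflexive (sum-indicator j (λ _ → c)))

==-true : ∀ {n} {i j : Fin n} → i ≡ j → (i == j) ≡ true
==-true {i = i} refl = ==-refl i

-- Nodes as triples of coordinates

module Cube (P : ℕ) .{{_ : NonZero P}} where

  N : ℕ
  N = P * (P * P)

  V : Set
  V = Fin N

  opaque
    c₀ c₁ c₂ : V → Fin P
    c₀ v = quotient {P} (P * P) v
    c₁ v = quotient {P} P (remainder {P} (P * P) v)
    c₂ v = remainder {P} P (remainder {P} (P * P) v)

    cube : Fin P → Fin P → Fin P → V
    cube a b c = combine a (combine b c)

    c₀-cube : ∀ a b c → c₀ (cube a b c) ≡ a
    c₀-cube a b c = cong proj₁ (remQuot-combine {P} {P * P} a (combine b c))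

    c₁-cube : ∀ a b c → c₁ (cube a b c) ≡ b
    c₁-cube a b c = trans (cong (λ p → quotient {P} P (proj₂ p)) (remQuot-combine {P} {P * P} a (combine b c))) (cong proj₁ (remQuot-combine {P} {P} b c))

    c₂-cube : ∀ a b c → c₂ (cube a b c) ≡ c
    c₂-cube a b c = trans (cong (λ p → remainder {P} P (proj₂ p)) (remQuot-combine {P} {P * P} a (combine b c))) (cong proj₂ (remQuot-combine {P} {P} b c))

    cube-c : ∀ v → cube (c₀ v) (c₁ v) (c₂ v) ≡ v
    cube-c v = trans (cong (combine (c₀ v)) (combine-remQuot {P} P (remainder {P} (P * P) v))) (combine-remQuot {P} (P * P) v)

    sum-cube : ∀ (f : V → ℕ) → sum f ≡ sum (λ a → sum (λ b → sum (λ c → f (cube a b c))))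
    sum-cube f = trans (sum-combine P f) (sum-cong-≗ (λ a → sum-combine P {P} (λ k → f (combine a k))))

  cube-== : ∀ a b c v → (cube a b c == v) ≡ (a == c₀ v) ∧ ((b == c₁ v) ∧ (c == c₂ v))
  cube-== a b c v = true-ext to from
    where
    to : (cube a b c == v) ≡ true → (a == c₀ v) ∧ ((b == c₁ v) ∧ (c == c₂ v)) ≡ true
    to e with refl ← ==⇒≡ {i = cube a b c} e =
      ∧-join (==-true (sym (c₀-cube a b c))) (∧-join (==-true (sym (c₁-cube a b c))) (==-true (sym (c₂-cube a b c))))
    from : (a == c₀ v) ∧ ((b == c₁ v) ∧ (c == c₂ v)) ≡ true → (cube a b c == v) ≡ true
    from e with ∧-split {a == c₀ v} e
    ... | e₀ , e' with ∧-split {b == c₁ v} e'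
    ... | e₁ , e₂ with refl ← ==⇒≡ {i = a} e₀ | refl ← ==⇒≡ {i = b} e₁ | refl ← ==⇒≡ {i = c} e₂ = ==-true (cube-c v)

  block-size : ∀ I → # (λ v → c₀ v == I) ≡ P * P
  block-size I = trans (sum-cube (λ v → 𝟙 (c₀ v == I))) (trans (sum-single _ I other)
      (trans (sum-cong-≗ (λ b → trans (sum-cong-≗ (λ c → cong 𝟙 (==-true (c₀-cube I b c)))) (trans (sum-const P 1) (*-identityʳ P)))) (sum-const P P)))
    where
    other : ∀ a → a ≢ I → sum (λ b → sum (λ c → 𝟙 (c₀ (cube a b c) == I))) ≡ 0
    other a ne = sum-zero (λ b → sum-zero (λ c → 𝟙-zero (λ e → ne (trans (sym (c₀-cube a b c)) (==⇒≡ e)))))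

  sum-group : ∀ I j (f : V → ℕ) → sum (λ i → 𝟙 ((c₀ i == I) ∧ (c₁ i == j)) * f i) ≡ sum (λ κ → f (cube I j κ))
  sum-group I j f = trans (sum-cube _) (trans (sum-single _ I other₀) (trans (sum-single _ j other₁)
      (sum-cong-≗ (λ c → trans (cong (λ b → 𝟙 b * f (cube I j c)) (∧-join (==-true (c₀-cube I j c)) (==-true (c₁-cube I j c)))) (+-identityʳ _)))))
    where
    vanish : ∀ b x → ¬ (b ≡ true) → 𝟙 b * x ≡ 0
    vanish b x n = cong (_* x) (𝟙-zero n)
    other₀ : ∀ a → a ≢ I → sum (λ b → sum (λ c → 𝟙 ((c₀ (cube a b c) == I) ∧ (c₁ (cube a b c) == j)) * f (cube a b c))) ≡ 0
    other₀ a ne = sum-zero (λ b → sum-zero (λ c → vanish _ _ (λ e → ne (trans (sym (c₀-cube a b c)) (==⇒≡ (proj₁ (∧-split e)))))))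
    other₁ : ∀ b → b ≢ j → sum (λ c → 𝟙 ((c₀ (cube I b c) == I) ∧ (c₁ (cube I b c) == j)) * f (cube I b c)) ≡ 0
    other₁ b ne = sum-zero (λ c → vanish _ _ (λ e → ne (trans (sym (c₁-cube I b c)) (==⇒≡ (proj₂ (∧-split {c₀ (cube I b c) == I} e))))))

-- Distributing the two factors of the product

module Entries (P H : ℕ) .{{_ : NonZero P}} where
  open Cube P

  ∞ : ℕ
  ∞ = 2 ^ H

  Entry : Set
  Entry = V × (V × Fin (suc ∞))

  clamp : ℕ → Fin (suc ∞)
  clamp x = fromℕ< (s≤s (m⊓n≤n x ∞))

  clamp-injective : ∀ {x y} → x ≤ ∞ → y ≤ ∞ → clamp x ≡ clamp y → x ≡ y
  clamp-injective {x} {y} p q e = trans (sym (toℕ-clamp x p)) (trans (cong toℕ e) (toℕ-clamp y q))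
    where
    toℕ-clamp : ∀ x → x ≤ ∞ → toℕ (clamp x) ≡ x
    toℕ-clamp x p = trans (toℕ-fromℕ< (s≤s (m⊓n≤n x ∞))) (m≤n⇒m⊓n≡m p)

  match : V → V → Fin (suc ∞) → Entry → Bool
  match v w x e = (proj₁ e == v) ∧ ((proj₁ (proj₂ e) == w) ∧ (proj₂ (proj₂ e) == x))

  holds : ℕ → Fin (suc ∞) → Bool
  holds d x = (d <ᵇ ∞) ∧ (clamp d == x)

  -- Entries equal to `∞` are never sent, so silence has to be informative: an entry for which no
  -- value is reported is `∞`.
  holds-determines : ∀ {d d'} → d ≤ ∞ → d' ≤ ∞ → (∀ x → holds d x ≡ holds d' x) → d ≡ d'
  holds-determines {d} {d'} p p' e with m≤n⇒m<n∨m≡n p | m≤n⇒m<n∨m≡n p'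
  ... | inj₁ lt | _ = sym (clamp-injective p' p (==⇒≡ (proj₂ (∧-split {d' <ᵇ ∞} (trans (sym (e (clamp d))) (∧-join (<ᵇ-true lt) (==-refl (clamp d))))))))
  ... | inj₂ _ | inj₁ lt = clamp-injective p p' (==⇒≡ (proj₂ (∧-split {d <ᵇ ∞} (trans (e (clamp d')) (∧-join (<ᵇ-true lt) (==-refl (clamp d')))))))
  ... | inj₂ a | inj₂ b = trans a (sym b)

  holds-if : ∀ b {d} x → (b ≡ true → d < ∞) → b ∧ (clamp d == x) ≡ holds (if b then d else ∞) x
  holds-if true  {d} x f = sym (cong (_∧ (clamp d == x)) (<ᵇ-true (f refl)))
  holds-if false x _ = sym (cong (_∧ (clamp ∞ == x)) (<ᵇ-false (≤-refl {∞})))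

-- Node (I , j , κ) multiplies the rows of block I with the j-th bucket of
-- middle vertices, for the κ-th bucket of columns.  The middle buckets depend
-- on I and the column buckets on (I , j); both balance weights by prefix sums.
module Tables (P q H : ℕ) .{{_ : NonZero P}} .{{_ : NonZero q}} where
  open Cube P
  open Entries P H

  K : ℕ
  K = q * (P * P)

  instance
    N-nonZero : NonZero N
    N-nonZero = m*n≢0 P (P * P) {{it}} {{m*n≢0 P P}}
    qN-nonZero : NonZero (q * N)
    qN-nonZero = m*n≢0 q N

  1≤q : 1 ≤ q
  1≤q = >-nonZero⁻¹ q

  N≤qN : N ≤ q * N
  N≤qN = ≤-trans (≤-reflexive (sym (*-identityˡ N))) (*-monoˡ-≤ N 1≤q)

  P≤N : P ≤ N
  P≤N = m≤m*n P (P * P) {{m*n≢0 P P}}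

  PK≡qN : P * K ≡ q * N
  PK≡qN = arith P q
    where
    arith : ∀ P q → P * (q * (P * P)) ≡ q * (P * (P * P))
    arith = solve-∀

  module _ (h : V → V → ℕ) where

    present : V → V → Bool
    present v w = h v w <ᵇ ∞

    entry : V → V → Entry
    entry v w = v , (w , clamp (h v w))

    inDegree : Fin P → V → ℕ
    inDegree I w = # (λ v → (c₀ v == I) ∧ present v w)

    -- The weight `inDegree I w` balances the entries of the left factor. The constant `q * P`
    -- limits how many vertices share a bucket, and thereby the rows of the right factor sent there.
    -- Each part totals at most `P * (q * N)`, so pieces of length `3 * (q * N)` leave the total
    -- strictly below capacity.
    middle : Fin P → V → Fin P
    middle I = bucket P (3 * (q * N)) {{it}} {{m*n≢0 3 (q * N)}} (λ w → inDegree I w + q * P)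

    leftOut : V → List (V × Entry)
    leftOut v = ⨁ λ w → ⨁ λ κ → when (present v w) (cube (c₀ v) (middle (c₀ v) w) κ , entry v w)

    neighbours : V → List V
    neighbours w = ⨁ λ u → when (present w u) u

    shares : V → List (Fin P × V)
    shares w = spread P (λ _ → zero {0}) (neighbours w)

    -- The column buckets depend on which entries reach the `P` nodes with coordinates `I` and
    -- `middle I w`. Hence the row is first dealt evenly over these nodes, by `shares`, and sorted
    -- by column later.
    rightOut : V → List (V × Entry)
    rightOut w = ⨁ λ I → map (λ p → cube I (middle I w) (proj₁ p) , entry w (proj₂ p)) (shares w)

    cnt-neighbours : ∀ w φ → cnt φ (neighbours w) ≡ # (λ u → present w u ∧ φ u)
    cnt-neighbours w φ = trans (cnt-⨁ φ _) (sum-cong-≗ (λ u → cnt-when φ (present w u) u))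

    module _ (few : ∀ v → # (present v) ≤ K) where

      length-neighbours : ∀ w → length (neighbours w) ≤ K
      length-neighbours w = ≤-trans (≤-reflexive (trans (sym (cnt-true (neighbours w))) (trans (cnt-neighbours w (λ _ → true))
        (#-cong (λ u → ∧-identityʳ (present w u)))))) (few w)

      inDegree-total : ∀ I → sum (inDegree I) ≤ P * (q * N)
      inDegree-total I = begin
        sum (λ w → # (λ v → (c₀ v == I) ∧ present v w))      ≡⟨ ∑-comm _ ⟩
        sum (λ v → # (λ w → (c₀ v == I) ∧ present v w))      ≤⟨ sum-mono (λ v → row v) ⟩
        sum (λ v → K * 𝟙 (c₀ v == I))                        ≡⟨ sum-* K _ ⟩
        K * # (λ v → c₀ v == I)                              ≡⟨ cong (K *_) (block-size I) ⟩
        K * (P * P)                                          ≡⟨ arith P q ⟩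
        P * (q * N)                                          ∎
        where
        open ≤-Reasoning
        arith : ∀ P q → q * (P * P) * (P * P) ≡ P * (q * (P * (P * P)))
        arith = solve-∀
        row : ∀ v → # (λ w → (c₀ v == I) ∧ present v w) ≤ K * 𝟙 (c₀ v == I)
        row v with c₀ v == I
        ... | true = ≤-trans (few v) (≤-reflexive (sym (*-identityʳ K)))
        ... | false = ≤-trans (≤-reflexive (#-zero {n = N} (λ _ → refl))) z≤n

      middle-weight : Fin P → V → ℕ
      middle-weight I w = inDegree I w + q * P

      middle-total : ∀ I → sum (middle-weight I) < P * (3 * (q * N))
      middle-total I = begin-strict
        sum (middle-weight I)                    ≡⟨ ∑-distrib-+ (inDegree I) (λ _ → q * P) ⟩
        sum (inDegree I) + sum {N} (λ _ → q * P) ≤⟨ +-mono-≤ (inDegree-total I) (≤-reflexive (sum-const N (q * P))) ⟩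
        P * (q * N) + N * (q * P)                ≡⟨ arith P q N ⟩
        2 * (P * (q * N))                        <⟨ *-monoˡ-< (P * (q * N)) {{m*n≢0 P (q * N)}} (n<1+n 2) ⟩
        3 * (P * (q * N))                        ≡⟨ arith' P (q * N) ⟩
        P * (3 * (q * N))                        ∎
        where
        open ≤-Reasoning
        arith : ∀ P q N → P * (q * N) + N * (q * P) ≡ 2 * (P * (q * N))
        arith = solve-∀
        arith' : ∀ P Q → 3 * (P * Q) ≡ P * (3 * Q)
        arith' = solve-∀

      -- One piece of length `3 * (q * N)` plus the largest single weight, to which each summand
      -- contributes at most `q * N`.
      middle-load : ∀ I j → sum (λ w → 𝟙 (middle I w == j) * middle-weight I w) ≤ 5 * (q * N)
      middle-load I j = ≤-trans (bucket-load P (3 * (q * N)) {{it}} {{m*n≢0 3 (q * N)}} (middle-weight I) (middle-total I) (q * N + q * N)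
          (λ w → +-mono-≤ (≤-trans (#-≤ _) N≤qN) (*-monoʳ-≤ q P≤N)) j)
        (≤-reflexive (arith (q * N)))
        where
        arith : ∀ x → 3 * x + (x + x) ≡ 5 * x
        arith = solve-∀

      middle-size : ∀ I j → # (λ w → middle I w == j) ≤ 5 * (P * P)
      middle-size I j = *-cancelˡ-≤ (q * P) {{m*n≢0 q P}} (begin
        q * P * # (λ w → middle I w == j)              ≡⟨ sum-* (q * P) _ ⟨
        sum (λ w → q * P * 𝟙 (middle I w == j))        ≤⟨ sum-mono (λ w → ≤-trans (≤-reflexive (*-comm (q * P) _)) (*-monoʳ-≤ (𝟙 (middle I w == j)) (m≤n+m (q * P) (inDegree I w)))) ⟩
        sum (λ w → 𝟙 (middle I w == j) * middle-weight I w) ≤⟨ middle-load I j ⟩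
        5 * (q * N)                                    ≡⟨ arith P q ⟩
        q * P * (5 * (P * P)) ∎)
        where
        open ≤-Reasoning
        arith : ∀ P q → 5 * (q * (P * (P * P))) ≡ q * P * (5 * (P * P))
        arith = solve-∀

      leftOut-length : ∀ v → length (leftOut v) ≤ q * N
      leftOut-length v = begin
        length (leftOut v)                     ≡⟨ cnt-true (leftOut v) ⟨
        cnt (λ _ → true) (leftOut v)           ≡⟨ trans (cnt-⨁ _ _) (sum-cong-≗ (λ w → trans (cnt-⨁ _ _) (trans (sum-cong-≗ (λ κ → trans (cnt-when _ (present v w) _) (cong 𝟙 (∧-identityʳ _)))) (sum-const P _)))) ⟩
        sum (λ w → P * 𝟙 (present v w))        ≡⟨ sum-* P _ ⟩
        P * # (present v)                      ≤⟨ *-monoʳ-≤ P (few v) ⟩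
        P * K                                  ≡⟨ PK≡qN ⟩
        q * N                                  ∎
        where open ≤-Reasoning

      leftOut-load : ∀ i → sum (λ v → cnt (λ p → proj₁ p == i) (leftOut v)) ≤ 5 * (q * N)
      leftOut-load i = begin
        sum (λ v → cnt (λ p → proj₁ p == i) (leftOut v)) ≡⟨ sum-cong-≗ (λ v → trans (cnt-⨁ _ _) (sum-cong-≗ (λ w → trans (cnt-⨁ _ _) (sum-cong-≗ (λ κ → cnt-when _ (present v w) _))))) ⟩
        sum (λ v → sum (λ w → sum (λ κ → 𝟙 (present v w ∧ (cube (c₀ v) (middle (c₀ v) w) κ == i))))) ≤⟨ sum-mono (λ v → sum-mono (λ w → sum-indicator-≤ _ (c₂ i) _ (λ κ → one v w κ))) ⟩
        sum (λ v → sum (λ w → 𝟙 (middle (c₀ i) w == c₁ i) * 𝟙 ((c₀ v == c₀ i) ∧ present v w))) ≡⟨ ∑-comm _ ⟩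
        sum (λ w → sum (λ v → 𝟙 (middle (c₀ i) w == c₁ i) * 𝟙 ((c₀ v == c₀ i) ∧ present v w))) ≡⟨ sum-cong-≗ (λ w → sum-* (𝟙 (middle (c₀ i) w == c₁ i)) _) ⟩
        sum (λ w → 𝟙 (middle (c₀ i) w == c₁ i) * inDegree (c₀ i) w) ≤⟨ sum-mono (λ w → *-monoʳ-≤ (𝟙 (middle (c₀ i) w == c₁ i)) (m≤m+n (inDegree (c₀ i) w) (q * P))) ⟩
        sum (λ w → 𝟙 (middle (c₀ i) w == c₁ i) * middle-weight (c₀ i) w) ≤⟨ middle-load (c₀ i) (c₁ i) ⟩
        5 * (q * N) ∎
        where
        open ≤-Reasoning
        one : ∀ v w κ → 𝟙 (present v w ∧ (cube (c₀ v) (middle (c₀ v) w) κ == i)) ≤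
          𝟙 (κ == c₂ i) * (𝟙 (middle (c₀ i) w == c₁ i) * 𝟙 ((c₀ v == c₀ i) ∧ present v w))
        one v w κ = ≤-trans (𝟙-mono step) (≤-reflexive (trans (𝟙-∧ (κ == c₂ i) _) (cong (𝟙 (κ == c₂ i) *_) (𝟙-∧ (middle (c₀ i) w == c₁ i) _))))
          where
          step : present v w ∧ (cube (c₀ v) (middle (c₀ v) w) κ == i) ≡ true →
            (κ == c₂ i) ∧ ((middle (c₀ i) w == c₁ i) ∧ ((c₀ v == c₀ i) ∧ present v w)) ≡ true
          step e with ∧-split {present v w} e
          ... | e₀ , e' with ∧-split {c₀ v == c₀ i} (trans (sym (cube-== (c₀ v) (middle (c₀ v) w) κ i)) e')
          ... | e₁ , e″ with ∧-split {middle (c₀ v) w == c₁ i} e″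
          ... | e₂ , e₃ = ∧-join e₃ (∧-join (subst (λ I → (middle I w == c₁ i) ≡ true) (==⇒≡ {i = c₀ v} e₁) e₂) (∧-join e₁ e₀))

      rightOut-length : ∀ w → length (rightOut w) ≤ q * N
      rightOut-length w = begin
        length (rightOut w)                ≡⟨ cnt-true (rightOut w) ⟨
        cnt (λ _ → true) (rightOut w)      ≡⟨ trans (cnt-⨁ _ _) (sum-cong-≗ (λ I → trans (cnt-map _ _ (shares w)) (trans (cnt-spread (λ _ → zero {0}) (λ _ → true) (neighbours w)) (cnt-true (neighbours w))))) ⟩
        sum {P} (λ I → length (neighbours w)) ≡⟨ sum-const P _ ⟩
        P * length (neighbours w)          ≤⟨ *-monoʳ-≤ P (length-neighbours w) ⟩
        P * K                              ≡⟨ PK≡qN ⟩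
        q * N                              ∎
        where open ≤-Reasoning

      share-≤ : ∀ w κ → cnt (λ p → proj₁ p == κ) (shares w) ≤ 2 * (q * P)
      share-≤ w κ = *-cancelˡ-≤ P (begin
        P * cnt (λ p → proj₁ p == κ) (shares w) ≤⟨ spread-label-≤ (λ _ → zero {0}) κ (neighbours w) ⟩
        length (neighbours w) + 1 * P           ≤⟨ +-mono-≤ (length-neighbours w) (≤-trans (*-monoˡ-≤ P 1≤q) (*-monoʳ-≤ q (m≤m*n P P))) ⟩
        K + q * (P * P)                         ≡⟨ arith P q ⟩
        P * (2 * (q * P)) ∎)
        where
        open ≤-Reasoning
        arith : ∀ P q → q * (P * P) + q * (P * P) ≡ P * (2 * (q * P))
        arith = solve-∀

      -- A node receives one share, of at most `2 * (q * P)` entries, from each of the at most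
      -- `5 * (P * P)` rows of its middle bucket.
      rightOut-load : ∀ i → sum (λ w → cnt (λ p → proj₁ p == i) (rightOut w)) ≤ 10 * (q * N)
      rightOut-load i = begin
        sum (λ w → cnt (λ p → proj₁ p == i) (rightOut w)) ≡⟨ sum-cong-≗ (λ w → trans (cnt-⨁ _ _) (sum-cong-≗ (λ I → cnt-map _ _ (shares w)))) ⟩
        sum (λ w → sum (λ I → cnt (λ p → cube I (middle I w) (proj₁ p) == i) (shares w))) ≤⟨ sum-mono (λ w → sum-indicator-≤ _ (c₀ i) _ (one w)) ⟩
        sum (λ w → 2 * (q * P) * 𝟙 (middle (c₀ i) w == c₁ i)) ≡⟨ sum-* (2 * (q * P)) _ ⟩
        2 * (q * P) * # (λ w → middle (c₀ i) w == c₁ i) ≤⟨ *-monoʳ-≤ (2 * (q * P)) (middle-size (c₀ i) (c₁ i)) ⟩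
        2 * (q * P) * (5 * (P * P)) ≡⟨ arith P q ⟩
        10 * (q * N) ∎
        where
        open ≤-Reasoning
        arith : ∀ P q → 2 * (q * P) * (5 * (P * P)) ≡ 10 * (q * (P * (P * P)))
        arith = solve-∀
        one : ∀ w I → cnt (λ p → cube I (middle I w) (proj₁ p) == i) (shares w) ≤
          𝟙 (I == c₀ i) * (2 * (q * P) * 𝟙 (middle (c₀ i) w == c₁ i))
        one w I = begin
          cnt (λ p → cube I (middle I w) (proj₁ p) == i) (shares w) ≡⟨ cnt-cong (λ p → cube-== I (middle I w) (proj₁ p) i) (shares w) ⟩
          cnt (λ p → (I == c₀ i) ∧ ((middle I w == c₁ i) ∧ (proj₁ p == c₂ i))) (shares w) ≡⟨ trans (cnt-∧ˡ (I == c₀ i) _ (shares w)) (cong (𝟙 (I == c₀ i) *_) (cnt-∧ˡ (middle I w == c₁ i) _ (shares w))) ⟩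
          𝟙 (I == c₀ i) * (𝟙 (middle I w == c₁ i) * cnt (λ p → proj₁ p == c₂ i) (shares w)) ≤⟨ last (I ≟F c₀ i) ⟩
          𝟙 (I == c₀ i) * (2 * (q * P) * 𝟙 (middle (c₀ i) w == c₁ i)) ∎
          where
          last : Dec (I ≡ c₀ i) → 𝟙 (I == c₀ i) * (𝟙 (middle I w == c₁ i) * cnt (λ p → proj₁ p == c₂ i) (shares w)) ≤ 𝟙 (I == c₀ i) * (2 * (q * P) * 𝟙 (middle (c₀ i) w == c₁ i))
          last (yes refl) = *-monoʳ-≤ (𝟙 (I == c₀ i)) (≤-trans (*-monoʳ-≤ (𝟙 (middle I w == c₁ i)) (share-≤ w (c₂ i))) (≤-reflexive (*-comm (𝟙 (middle I w == c₁ i)) _)))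
          last (no ne) rewrite ≢⇒== ne = z≤n

    -- This makes the inbox readable: a given finite entry arrives once or not at all, as decided by
    -- the block and the middle bucket.
    leftOut-count : ∀ i v w x →
      sum (λ v' → cnt (λ p → (proj₁ p == i) ∧ match v w x (proj₂ p)) (leftOut v')) ≡
      𝟙 ((c₀ v == c₀ i) ∧ ((middle (c₀ v) w == c₁ i) ∧ holds (h v w) x))
    leftOut-count i v w x = trans (sum-cong-≗ (λ v' → trans (cnt-⨁ _ _) (sum-cong-≗ (λ w' → trans (cnt-⨁ _ _) (sum-cong-≗ (λ κ → cnt-when _ (present v' w') _))))))
      (trans (sum-single _ v other-v) (trans (sum-single _ w other-w) (trans (sum-single _ (c₂ i) other-κ) (cong 𝟙 final))))
      where
      term : V → V → Fin P → Bool
      term v' w' κ = present v' w' ∧ ((cube (c₀ v') (middle (c₀ v') w') κ == i) ∧ match v w x (entry v' w'))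
      parts : ∀ v' w' κ → term v' w' κ ≡ true → v' ≡ v × w' ≡ w × κ ≡ c₂ i
      parts v' w' κ e with ∧-split {present v' w'} e
      ... | _ , e' with ∧-split {cube (c₀ v') (middle (c₀ v') w') κ == i} e'
      ... | a , b with ∧-split {v' == v} b
      ... | b₁ , b₂ = ==⇒≡ b₁ , ==⇒≡ (proj₁ (∧-split {w' == w} b₂)) ,
          trans (sym (c₂-cube _ _ κ)) (cong c₂ (==⇒≡ a))
      other-v : ∀ v' → v' ≢ v → sum (λ w' → sum (λ κ → 𝟙 (term v' w' κ))) ≡ 0
      other-v v' ne = sum-zero (λ w' → sum-zero (λ κ → 𝟙-zero (λ e → ne (proj₁ (parts v' w' κ e)))))
      other-w : ∀ w' → w' ≢ w → sum (λ κ → 𝟙 (term v w' κ)) ≡ 0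
      other-w w' ne = sum-zero (λ κ → 𝟙-zero (λ e → ne (proj₁ (proj₂ (parts v w' κ e)))))
      other-κ : ∀ κ → κ ≢ c₂ i → 𝟙 (term v w κ) ≡ 0
      other-κ κ ne = 𝟙-zero (λ e → ne (proj₂ (proj₂ (parts v w κ e))))
      shuffle : ∀ p a b c → p ∧ ((a ∧ (b ∧ true)) ∧ c) ≡ a ∧ (b ∧ (p ∧ c))
      shuffle true true true c = refl
      shuffle true true false c = refl
      shuffle true false b c = refl
      shuffle false true true c = refl
      shuffle false true false c = refl
      shuffle false false b c = refl
      final : term v w (c₂ i) ≡ (c₀ v == c₀ i) ∧ ((middle (c₀ v) w == c₁ i) ∧ holds (h v w) x)
      final rewrite cube-== (c₀ v) (middle (c₀ v) w) (c₂ i) i | ==-refl v | ==-refl w | ==-refl (c₂ i) =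
        shuffle (present v w) (c₀ v == c₀ i) (middle (c₀ v) w == c₁ i) (clamp (h v w) == x)

    rightOut-count : ∀ I j (φ : Entry → Bool) →
      sum (λ κ → sum (λ w → cnt (λ p → (proj₁ p == cube I j κ) ∧ φ (proj₂ p)) (rightOut w))) ≡
      sum (λ w → 𝟙 (middle I w == j) * # (λ u → present w u ∧ φ (entry w u)))
    rightOut-count I j φ = trans (∑-comm _) (sum-cong-≗ each)
      where
      expand : ∀ w κ I' → cnt (λ p → (proj₁ p == cube I j κ) ∧ φ (proj₂ p)) (map (λ p → cube I' (middle I' w) (proj₁ p) , entry w (proj₂ p)) (shares w)) ≡
        cnt (λ p → (proj₁ p == κ) ∧ (((I' == I) ∧ (middle I' w == j)) ∧ φ (entry w (proj₂ p)))) (shares w)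
      expand w κ I' = trans (cnt-map _ _ (shares w)) (cnt-cong (λ p → reshape (proj₁ p) (φ (entry w (proj₂ p)))) (shares w))
        where
        shuffle : ∀ a b c d → (a ∧ (b ∧ c)) ∧ d ≡ c ∧ ((a ∧ b) ∧ d)
        shuffle true true true d = refl
        shuffle true true false d = refl
        shuffle true false true d = refl
        shuffle true false false d = refl
        shuffle false b true d = refl
        shuffle false b false d = refl
        reshape : ∀ y z → (cube I' (middle I' w) y == cube I j κ) ∧ z ≡ (y == κ) ∧ (((I' == I) ∧ (middle I' w == j)) ∧ z)
        reshape y z rewrite cube-== I' (middle I' w) y (cube I j κ) | c₀-cube I j κ | c₁-cube I j κ | c₂-cube I j κ =
          shuffle (I' == I) (middle I' w == j) (y == κ) z
      each : ∀ w → sum (λ κ → cnt (λ p → (proj₁ p == cube I j κ) ∧ φ (proj₂ p)) (rightOut w)) ≡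
        𝟙 (middle I w == j) * # (λ u → present w u ∧ φ (entry w u))
      each w = trans (sum-cong-≗ (λ κ → trans (cnt-⨁ _ _) (sum-cong-≗ (expand w κ))))
        (trans (∑-comm _) (trans (sum-cong-≗ (λ I' → sym (cnt-fibres proj₁ (λ p → ((I' == I) ∧ (middle I' w == j)) ∧ φ (entry w (proj₂ p))) (shares w))))
        (trans (sum-single _ I (λ I' ne → cnt-false (λ p → cong (λ b → (b ∧ (middle I' w == j)) ∧ φ (entry w (proj₂ p))) (≢⇒== ne)) (shares w)))
        (trans (cnt-spread (λ _ → zero {0}) (λ u → ((I == I) ∧ (middle I w == j)) ∧ φ (entry w u)) (neighbours w))
        (trans (cnt-∧ˡ ((I == I) ∧ (middle I w == j)) (λ u → φ (entry w u)) (neighbours w))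
          (cong₂ (λ b n → 𝟙 (b ∧ (middle I w == j)) * n) (==-refl I) (cnt-neighbours w (λ u → φ (entry w u)))))))))

-- Column buckets and the return of partial results

module Columns (P q H : ℕ) .{{_ : NonZero P}} .{{_ : NonZero q}} (h : Fin (Cube.N P) → Fin (Cube.N P) → ℕ) where
  open Cube P
  open Entries P H
  open Tables P q H
  open Selection K H hiding (∞)
  open Product K H (λ v → middle h (c₀ v)) h public using (through)

  column : Entry → V
  column e = proj₁ (proj₂ e)

  usage : Fin P → Fin P → V → ℕ
  usage I j u = # (λ v → (c₀ v == I) ∧ chosen (through v j) u)

  usage-≤ : ∀ I j u → usage I j u ≤ N
  usage-≤ I j u = #-≤ (λ v → (c₀ v == I) ∧ chosen (through v j) u)

  1≤K : 1 ≤ K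
  1≤K = *-mono-≤ 1≤q (*-mono-≤ (>-nonZero⁻¹ P) (>-nonZero⁻¹ P))

  usage-total : ∀ I j → sum (usage I j) ≤ P * (q * N)
  usage-total I j = begin
    sum (λ u → # (λ v → (c₀ v == I) ∧ chosen (through v j) u)) ≡⟨ ∑-comm _ ⟩
    sum (λ v → # (λ u → (c₀ v == I) ∧ chosen (through v j) u)) ≤⟨ sum-mono row ⟩
    sum (λ v → K * 𝟙 (c₀ v == I))                              ≡⟨ sum-* K _ ⟩
    K * # (λ v → c₀ v == I)                                    ≡⟨ cong (K *_) (block-size I) ⟩
    K * (P * P)                                                ≡⟨ arith P q ⟩
    P * (q * N)                                                ∎
    where
    open ≤-Reasoning
    arith : ∀ P q → q * (P * P) * (P * P) ≡ P * (q * (P * (P * P)))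
    arith = solve-∀
    row : ∀ v → # (λ u → (c₀ v == I) ∧ chosen (through v j) u) ≤ K * 𝟙 (c₀ v == I)
    row v with c₀ v == I
    ... | true = ≤-trans (#-chosen-≤ 1≤K (through v j)) (≤-reflexive (sym (*-identityʳ K)))
    ... | false = ≤-trans (≤-reflexive (#-zero {n = N} (λ _ → refl))) z≤n

  module _ (right : V → List Entry) where

    part : V → V → ℕ
    part i u = cnt (λ e → column e == u) (right i)

    degree : Fin P → Fin P → V → ℕ
    degree I j u = sum (λ κ → part (cube I j κ) u)

  -- `deg` weighs the entries to be received and `o` the results to be returned: zero in the first
  -- distribution, `usage` in the second. In units of `P * (q * N)` their totals are at most 10 and
  -- 1, so 12 is a strict bound; a largest weight of `q * N + q * N` then makes each bucket's load
  -- at most `14 * (q * N)`.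
  columnBucket : (Fin P → Fin P → V → ℕ) → (Fin P → Fin P → V → ℕ) → Fin P → Fin P → V → Fin P
  columnBucket deg o I j = bucket P (12 * (q * N)) {{it}} {{m*n≢0 12 (q * N)}} (λ u → deg I j u + o I j u)

  columnOut : (V → List Entry) → (Fin P → Fin P → V → Fin P) → V → List (V × Entry)
  columnOut right cb i = map (λ e → cube (c₀ i) (c₁ i) (cb (c₀ i) (c₁ i) (column e)) , e) (right i)

  columnOut-count : ∀ right cb i (φ : Entry → Bool) →
    sum (λ i' → cnt (λ p → (proj₁ p == i) ∧ φ (proj₂ p)) (columnOut right cb i')) ≡
    sum (λ κ → cnt (λ e → (cb (c₀ i) (c₁ i) (column e) == c₂ i) ∧ φ e) (right (cube (c₀ i) (c₁ i) κ)))
  columnOut-count right cb i φ = trans (sum-cong-≗ each) (trans (sum-group (c₀ i) (c₁ i) f) (sum-cong-≗ relabel))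
    where
    f : V → ℕ
    f i' = cnt (λ e → (cb (c₀ i') (c₁ i') (column e) == c₂ i) ∧ φ e) (right i')
    shuffle : ∀ a b c d → (a ∧ (b ∧ c)) ∧ d ≡ (a ∧ b) ∧ (c ∧ d)
    shuffle true true c d = refl
    shuffle true false c d = refl
    shuffle false b c d = refl
    each : ∀ i' → cnt (λ p → (proj₁ p == i) ∧ φ (proj₂ p)) (columnOut right cb i') ≡ 𝟙 ((c₀ i' == c₀ i) ∧ (c₁ i' == c₁ i)) * f i'
    each i' = trans (cnt-map _ _ (right i')) (trans (cnt-cong (λ e → trans (cong (_∧ φ e) (cube-== (c₀ i') (c₁ i') _ i)) (shuffle (c₀ i' == c₀ i) _ _ _)) (right i'))
      (cnt-∧ˡ ((c₀ i' == c₀ i) ∧ (c₁ i' == c₁ i)) _ (right i')))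
    relabel : ∀ κ → f (cube (c₀ i) (c₁ i) κ) ≡ cnt (λ e → (cb (c₀ i) (c₁ i) (column e) == c₂ i) ∧ φ e) (right (cube (c₀ i) (c₁ i) κ))
    relabel κ rewrite c₀-cube (c₀ i) (c₁ i) κ | c₁-cube (c₀ i) (c₁ i) κ = refl

  module _ (few : ∀ v → # (present h v) ≤ K) (right : V → List Entry)
    (right-spec : ∀ t φ → cnt φ (right t) ≡ sum (λ w → cnt (λ p → (proj₁ p == t) ∧ φ (proj₂ p)) (rightOut h w))) where

    right-length : ∀ i → length (right i) ≤ 10 * (q * N)
    right-length i = ≤-trans (≤-reflexive (trans (sym (cnt-true (right i))) (trans (right-spec i (λ _ → true))
      (sum-cong-≗ (λ w → cnt-cong (λ p → ∧-identityʳ (proj₁ p == i)) (rightOut h w)))))) (rightOut-load h few i)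

    right-total : ∀ I j φ → sum (λ κ → cnt φ (right (cube I j κ))) ≡ sum (λ w → 𝟙 (middle h I w == j) * # (λ u → present h w u ∧ φ (entry h w u)))
    right-total I j φ = trans (sum-cong-≗ (λ κ → right-spec (cube I j κ) φ)) (rightOut-count h I j φ)

    degree-≤ : ∀ I j u → degree right I j u ≤ N
    degree-≤ I j u = ≤-trans (≤-reflexive (right-total I j (λ e → column e == u))) (≤-trans (sum-≤-const 1 one) (≤-reflexive (*-identityʳ N)))
      where
      one : ∀ w → 𝟙 (middle h I w == j) * # (λ u' → present h w u' ∧ (u' == u)) ≤ 1
      one w = *-mono-≤ (𝟙≤1 (middle h I w == j)) (≤-trans (#-mono (λ u' e → proj₂ (∧-split {present h w u'} e)))
        (≤-reflexive (trans (sum-cong-≗ (λ u' → sym (*-identityʳ (𝟙 (u' == u))))) (sum-indicator u (λ _ → 1)))))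

    part-≤ : ∀ i u → part right i u ≤ N
    part-≤ i u = ≤-trans (≤-reflexive (cong (λ k → part right k u) (sym (cube-c i))))
      (≤-trans (term≤sum (λ κ → part right (cube (c₀ i) (c₁ i) κ) u) (c₂ i)) (degree-≤ (c₀ i) (c₁ i) u))

    degree-total : ∀ I j → sum (degree right I j) ≤ P * (10 * (q * N))
    degree-total I j = begin
      sum (λ u → sum (λ κ → part right (cube I j κ) u)) ≡⟨ ∑-comm _ ⟩
      sum (λ κ → sum (λ u → part right (cube I j κ) u)) ≡⟨ sum-cong-≗ (λ κ → trans (sum-cong-≗ (λ u → cnt-cong (λ e → sym (∧-identityʳ (column e == u))) (right (cube I j κ)))) (trans (sym (cnt-fibres column (λ _ → true) (right (cube I j κ)))) (cnt-true (right (cube I j κ))))) ⟩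
      sum (λ κ → length (right (cube I j κ)))           ≤⟨ sum-≤-const (10 * (q * N)) (λ κ → right-length (cube I j κ)) ⟩
      P * (10 * (q * N))                                ∎
      where open ≤-Reasoning

    module _ (o : Fin P → Fin P → V → ℕ) (o-≤ : ∀ I j u → o I j u ≤ N) (o-total : ∀ I j → sum (o I j) ≤ P * (q * N)) where

      cb : Fin P → Fin P → V → Fin P
      cb = columnBucket (degree right) o

      column-weight : Fin P → Fin P → V → ℕ
      column-weight I j u = degree right I j u + o I j u

      column-total : ∀ I j → sum (column-weight I j) < P * (12 * (q * N))
      column-total I j = begin-strict
        sum (column-weight I j)                   ≡⟨ ∑-distrib-+ (degree right I j) (o I j) ⟩
        sum (degree right I j) + sum (o I j)      ≤⟨ +-mono-≤ (degree-total I j) (o-total I j) ⟩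
        P * (10 * (q * N)) + P * (q * N)          ≡⟨ arith P (q * N) ⟩
        11 * (P * (q * N))                        <⟨ *-monoˡ-< (P * (q * N)) {{m*n≢0 P (q * N)}} (n<1+n 11) ⟩
        12 * (P * (q * N))                        ≡⟨ arith' P (q * N) ⟩
        P * (12 * (q * N))                        ∎
        where
        open ≤-Reasoning
        arith : ∀ P Q → P * (10 * Q) + P * Q ≡ 11 * (P * Q)
        arith = solve-∀
        arith' : ∀ P Q → 12 * (P * Q) ≡ P * (12 * Q)
        arith' = solve-∀

      cb-mono : ∀ I j {u v} → toℕ u ≤ toℕ v → toℕ (cb I j u) ≤ toℕ (cb I j v)
      cb-mono I j = bucket-mono P (12 * (q * N)) {{it}} {{m*n≢0 12 (q * N)}} (column-weight I j) (column-total I j)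

      column-load : ∀ I j κ → sum (λ u → 𝟙 (cb I j u == κ) * column-weight I j u) ≤ 14 * (q * N)
      column-load I j κ = ≤-trans (bucket-load P (12 * (q * N)) {{it}} {{m*n≢0 12 (q * N)}} (column-weight I j) (column-total I j) (q * N + q * N)
          (λ u → +-mono-≤ (≤-trans (degree-≤ I j u) N≤qN) (≤-trans (o-≤ I j u) N≤qN)) κ)
        (≤-reflexive (arith (q * N)))
        where
        arith : ∀ x → 12 * x + (x + x) ≡ 14 * x
        arith = solve-∀

      columnOut-length : ∀ i → length (columnOut right cb i) ≤ 14 * (q * N)
      columnOut-length i = ≤-trans (≤-reflexive (length-map _ (right i))) (≤-trans (right-length i) (*-monoˡ-≤ (q * N) {10} {14} (m≤m+n 10 4)))

      columnOut-load : ∀ i → sum (λ i' → cnt (λ p → proj₁ p == i) (columnOut right cb i')) ≤ 14 * (q * N)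
      columnOut-load i = begin
        sum (λ i' → cnt (λ p → proj₁ p == i) (columnOut right cb i')) ≡⟨ sum-cong-≗ (λ i' → cnt-cong (λ p → sym (∧-identityʳ (proj₁ p == i))) (columnOut right cb i')) ⟩
        sum (λ i' → cnt (λ p → (proj₁ p == i) ∧ true) (columnOut right cb i')) ≡⟨ columnOut-count right cb i (λ _ → true) ⟩
        sum (λ κ → cnt (λ e → (cb I j (column e) == c₂ i) ∧ true) (right (cube I j κ))) ≡⟨ sum-cong-≗ (λ κ → fibre (right (cube I j κ))) ⟩
        sum (λ κ → sum (λ u → 𝟙 (cb I j u == c₂ i) * part right (cube I j κ) u)) ≡⟨ ∑-comm _ ⟩
        sum (λ u → sum (λ κ → 𝟙 (cb I j u == c₂ i) * part right (cube I j κ) u)) ≡⟨ sum-cong-≗ (λ u → sum-* (𝟙 (cb I j u == c₂ i)) _) ⟩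
        sum (λ u → 𝟙 (cb I j u == c₂ i) * degree right I j u) ≤⟨ sum-mono (λ u → *-monoʳ-≤ (𝟙 (cb I j u == c₂ i)) (m≤m+n _ (o I j u))) ⟩
        sum (λ u → 𝟙 (cb I j u == c₂ i) * column-weight I j u) ≤⟨ column-load I j (c₂ i) ⟩
        14 * (q * N) ∎
        where
        open ≤-Reasoning
        I = c₀ i
        j = c₁ i
        fibre : ∀ xs → cnt (λ e → (cb I j (column e) == c₂ i) ∧ true) xs ≡ sum (λ u → 𝟙 (cb I j u == c₂ i) * cnt (λ e → column e == u) xs)
        fibre xs = trans (cnt-fibres column _ xs) (sum-cong-≗ (λ u → trans (cnt-cong (λ e → at u e) xs) (cnt-∧ˡ (cb I j u == c₂ i) _ xs)))
          where
          at : ∀ u e → (column e == u) ∧ ((cb I j (column e) == c₂ i) ∧ true) ≡ (cb I j u == c₂ i) ∧ (column e == u)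
          at u e with column e ≟F u
          ... | yes refl = refl
          ... | no _ = sym (∧-zeroʳ _)

      columnOut-match : ∀ i w u x →
        sum (λ i' → cnt (λ p → (proj₁ p == i) ∧ match w u x (proj₂ p)) (columnOut right cb i')) ≡
        𝟙 (cb (c₀ i) (c₁ i) u == c₂ i) * (𝟙 (middle h (c₀ i) w == c₁ i) * 𝟙 (holds (h w u) x))
      columnOut-match i w u x = trans (columnOut-count right cb i (match w u x))
        (trans (sum-cong-≗ (λ κ → trans (cnt-cong at (right (cube (c₀ i) (c₁ i) κ))) (cnt-∧ˡ (cb (c₀ i) (c₁ i) u == c₂ i) _ (right (cube (c₀ i) (c₁ i) κ)))))
        (trans (sum-* (𝟙 (cb (c₀ i) (c₁ i) u == c₂ i)) (λ κ → cnt (match w u x) (right (cube (c₀ i) (c₁ i) κ))))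
        (cong (𝟙 (cb (c₀ i) (c₁ i) u == c₂ i) *_) (trans (right-total (c₀ i) (c₁ i) (match w u x))
        (trans (sum-single _ w (λ w' ne → trans (cong (𝟙 (middle h (c₀ i) w' == c₁ i) *_) (#-zero (λ u' → off w' u' ne))) (*-zeroʳ (𝟙 (middle h (c₀ i) w' == c₁ i)))))
        (cong (𝟙 (middle h (c₀ i) w == c₁ i) *_) (trans (sum-single _ u (λ u' ne → 𝟙-zero (λ e → ne (==⇒≡ (proj₁ (∧-split {u' == u} (proj₂ (∧-split {w == w} (proj₂ (∧-split {present h w u'} e))))))))))
          (cong 𝟙 on))))))))
        where
        at : ∀ e → (cb (c₀ i) (c₁ i) (column e) == c₂ i) ∧ match w u x e ≡ (cb (c₀ i) (c₁ i) u == c₂ i) ∧ match w u x e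
        at e with column e ≟F u
        ... | yes refl = refl
        ... | no _ = trans (trans (cong ((cb (c₀ i) (c₁ i) (column e) == c₂ i) ∧_) (∧-zeroʳ (proj₁ e == w))) (∧-zeroʳ _))
                           (sym (trans (cong ((cb (c₀ i) (c₁ i) u == c₂ i) ∧_) (∧-zeroʳ (proj₁ e == w))) (∧-zeroʳ _)))
        off : ∀ w' u' → w' ≢ w → present h w' u' ∧ match w u x (entry h w' u') ≡ false
        off w' u' ne = trans (cong (λ b → present h w' u' ∧ (b ∧ ((u' == u) ∧ (clamp (h w' u') == x)))) (≢⇒== ne)) (∧-zeroʳ _)
        on : present h w u ∧ match w u x (entry h w u) ≡ holds (h w u) x
        on rewrite ==-refl w | ==-refl u = refl

  -- Encodes a middle bucket as a vertex, so that results travel in the packet type of table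
  -- entries, with the tag in place of the row.
  tag : Fin P → V
  tag j = cube j j j

  module _ (cb : Fin P → Fin P → V → Fin P) where

    selected : V → V → V → Bool
    selected i v u = (c₀ v == c₀ i) ∧ ((cb (c₀ i) (c₁ i) u == c₂ i) ∧ chosen (through v (c₁ i)) u)

    resultOut : V → List (V × Entry)
    resultOut i = ⨁ λ v → ⨁ λ u → when (selected i v u) (v , (tag (c₁ i) , (u , clamp (through v (c₁ i) u))))

    cnt-resultOut : ∀ i φ → cnt φ (resultOut i) ≡ sum (λ v → sum (λ u → 𝟙 (selected i v u ∧ φ (v , (tag (c₁ i) , (u , clamp (through v (c₁ i) u)))))))
    cnt-resultOut i φ = trans (cnt-⨁ _ _) (sum-cong-≗ (λ v → trans (cnt-⨁ _ _) (sum-cong-≗ (λ u → cnt-when _ (selected i v u) _))))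

    -- For a row `v`, a column `u` and a middle bucket `j` exactly one node is responsible: its
    -- coordinates are the block of `v`, `j`, and the column bucket of `u`.
    sum-handlers : ∀ v u (ψ : Fin P → Bool) →
      sum (λ i → 𝟙 ((c₀ v == c₀ i) ∧ ((cb (c₀ i) (c₁ i) u == c₂ i) ∧ ψ (c₁ i)))) ≡ sum (λ j → 𝟙 (ψ j))
    sum-handlers v u ψ = trans (sum-cube _) (trans (sum-single _ (c₀ v) (λ a ne → sum-zero (λ b → sum-zero (λ c → 𝟙-zero (λ e → ne (sym (trans (==⇒≡ (proj₁ (∧-split e))) (c₀-cube a b c))))))))
      (sum-cong-≗ (λ b → trans (sum-cong-≗ (λ c → at b c)) (trans (sum-cong-≗ (λ c → 𝟙-∧ (cb (c₀ v) b u == c) (ψ b)))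
        (trans (sum-cong-≗ (λ c → *-comm (𝟙 (cb (c₀ v) b u == c)) (𝟙 (ψ b)))) (trans (sum-* (𝟙 (ψ b)) _)
        (trans (cong (𝟙 (ψ b) *_) (sum-indicator-one (cb (c₀ v) b u))) (*-identityʳ _))))))))
      where
      at : ∀ b c → 𝟙 ((c₀ v == c₀ (cube (c₀ v) b c)) ∧ ((cb (c₀ (cube (c₀ v) b c)) (c₁ (cube (c₀ v) b c)) u == c₂ (cube (c₀ v) b c)) ∧ ψ (c₁ (cube (c₀ v) b c))))
                   ≡ 𝟙 ((cb (c₀ v) b u == c) ∧ ψ b)
      at b c rewrite c₀-cube (c₀ v) b c | c₁-cube (c₀ v) b c | c₂-cube (c₀ v) b c | ==-refl (c₀ v) = refl

    resultOut-load : ∀ v → sum (λ i → cnt (λ p → proj₁ p == v) (resultOut i)) ≤ q * N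
    resultOut-load v = begin
      sum (λ i → cnt (λ p → proj₁ p == v) (resultOut i)) ≡⟨ sum-cong-≗ (λ i → trans (cnt-resultOut i _) (sum-single _ v (λ v' ne → sum-zero (λ u → 𝟙-zero (λ e → ne (==⇒≡ (proj₂ (∧-split {selected i v' u} e)))))))) ⟩
      sum (λ i → sum (λ u → 𝟙 (selected i v u ∧ (v == v)))) ≡⟨ sum-cong-≗ (λ i → sum-cong-≗ (λ u → cong 𝟙 (trans (cong (selected i v u ∧_) (==-refl v)) (∧-identityʳ _)))) ⟩
      sum (λ i → sum (λ u → 𝟙 (selected i v u))) ≡⟨ ∑-comm _ ⟩
      sum (λ u → sum (λ i → 𝟙 (selected i v u))) ≡⟨ sum-cong-≗ (λ u → sum-handlers v u (λ j → chosen (through v j) u)) ⟩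
      sum (λ u → sum (λ j → 𝟙 (chosen (through v j) u))) ≡⟨ ∑-comm _ ⟩
      sum (λ j → # (chosen (through v j))) ≤⟨ sum-≤-const K (λ j → #-chosen-≤ 1≤K (through v j)) ⟩
      P * K ≡⟨ PK≡qN ⟩
      q * N ∎
      where open ≤-Reasoning

    resultOut-length : ∀ i → length (resultOut i) ≡ sum (λ u → 𝟙 (cb (c₀ i) (c₁ i) u == c₂ i) * usage (c₀ i) (c₁ i) u)
    resultOut-length i = trans (sym (cnt-true (resultOut i))) (trans (cnt-resultOut i (λ _ → true)) (trans (∑-comm _)
      (sum-cong-≗ (λ u → trans (sum-cong-≗ (λ v → trans (cong 𝟙 (shuffle (c₀ v == c₀ i) (cb (c₀ i) (c₁ i) u == c₂ i) _)) (𝟙-∧ (cb (c₀ i) (c₁ i) u == c₂ i) _)))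
        (sum-* (𝟙 (cb (c₀ i) (c₁ i) u == c₂ i)) _)))))
      where
      shuffle : ∀ a b c → (a ∧ (b ∧ c)) ∧ true ≡ b ∧ (a ∧ c)
      shuffle true true true = refl
      shuffle true true false = refl
      shuffle true false c = refl
      shuffle false true c = refl
      shuffle false false c = refl

    resultOut-match : ∀ v j u x →
      sum (λ i → cnt (λ p → (proj₁ p == v) ∧ match (tag j) u x (proj₂ p)) (resultOut i)) ≡
      𝟙 (chosen (through v j) u ∧ (clamp (through v j u) == x))
    resultOut-match v j u x = trans (sum-cong-≗ each) (trans (sum-handlers v u ψ) (trans (sum-single _ j off) (cong 𝟙 on)))
      where
      ψ : Fin P → Bool
      ψ b = chosen (through v b) u ∧ ((tag b == tag j) ∧ (clamp (through v b u) == x))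
      tag-injective : ∀ {b} → tag b ≡ tag j → b ≡ j
      tag-injective {b} e = trans (sym (c₀-cube b b b)) (trans (cong c₀ e) (c₀-cube j j j))
      off : ∀ b → b ≢ j → 𝟙 (ψ b) ≡ 0
      off b ne = 𝟙-zero (λ e → ne (tag-injective (==⇒≡ (proj₁ (∧-split {tag b == tag j} (proj₂ (∧-split {chosen (through v b) u} e)))))))
      on : ψ j ≡ chosen (through v j) u ∧ (clamp (through v j u) == x)
      on = cong (λ b → chosen (through v j) u ∧ (b ∧ (clamp (through v j u) == x))) (==-refl (tag j))
      shuffle : ∀ a b c d e → (a ∧ (b ∧ c)) ∧ (true ∧ (d ∧ (true ∧ e))) ≡ a ∧ (b ∧ (c ∧ (d ∧ e)))
      shuffle true true true d e = refl
      shuffle true true false d e = refl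
      shuffle true false c d e = refl
      shuffle false b c d e = refl
      each : ∀ i → cnt (λ p → (proj₁ p == v) ∧ match (tag j) u x (proj₂ p)) (resultOut i) ≡
        𝟙 ((c₀ v == c₀ i) ∧ ((cb (c₀ i) (c₁ i) u == c₂ i) ∧ ψ (c₁ i)))
      each i = trans (cnt-resultOut i _) (trans (sum-single _ v (λ v' ne → sum-zero (λ u' → 𝟙-zero (λ e → ne (==⇒≡ (proj₁ (∧-split {v' == v} (proj₂ (∧-split {selected i v' u'} e)))))))))
        (trans (sum-single _ u (λ u' ne → 𝟙-zero (λ e → ne (==⇒≡ (proj₁ (∧-split {u' == u} (proj₂ (∧-split {tag (c₁ i) == tag j} (proj₂ (∧-split {v == v} (proj₂ (∧-split {selected i v u'} e)))))))))))) (cong 𝟙 here-term)))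
        where
        here-term : selected i v u ∧ ((v == v) ∧ match (tag j) u x (tag (c₁ i) , (u , clamp (through v (c₁ i) u)))) ≡
          (c₀ v == c₀ i) ∧ ((cb (c₀ i) (c₁ i) u == c₂ i) ∧ ψ (c₁ i))
        here-term rewrite ==-refl v | ==-refl u =
          shuffle (c₀ v == c₀ i) (cb (c₀ i) (c₁ i) u == c₂ i) (chosen (through v (c₁ i)) u) (tag (c₁ i) == tag j) (clamp (through v (c₁ i) u) == x)

-- One doubling as a protocol

when-cong : ∀ {A : Set} {b b'} {a a' : A} → b ≡ b' → (b ≡ true → a ≡ a') → when b a ≡ when b' a'
when-cong {b = true} refl e = cong (λ a → a ∷ []) (e refl)
when-cong {b = false} refl e = refl

∧-congʳ : ∀ {a a' b b'} → a ≡ a' → (a ≡ true → b ≡ b') → a ∧ b ≡ a' ∧ b'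
∧-congʳ {true} refl e = e refl
∧-congʳ {false} refl e = refl

-- Monotone buckets are intervals, so whatever precedes `u` lies in an earlier bucket or in its own.
-- Ties can therefore be ranked from bucket totals and a local count.
rank-split : ∀ {n m} (key : Fin n → Fin m) → (∀ {u v} → toℕ u ≤ toℕ v → toℕ (key u) ≤ toℕ (key v)) →
  ∀ (p : Fin n → Bool) u → rank p u ≡
    sum (λ κ → 𝟙 (toℕ κ <ᵇ toℕ (key u)) * # (λ u' → (key u' == κ) ∧ p u'))
    + # (λ u' → (key u' == key u) ∧ ((toℕ u' <ᵇ toℕ u) ∧ p u'))
rank-split key mono p u = trans (#-fibres key _) (trans (sum-cong-≗ split)
  (trans (∑-distrib-+ (λ κ → 𝟙 (toℕ κ <ᵇ toℕ (key u)) * A κ) (λ κ → 𝟙 (κ == key u) * B κ))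
    (cong (sum (λ κ → 𝟙 (toℕ κ <ᵇ toℕ (key u)) * A κ) +_) (sum-indicator (key u) B))))
  where
  A B : _ → ℕ
  A κ = # (λ u' → (key u' == κ) ∧ p u')
  B κ = # (λ u' → (key u' == κ) ∧ ((toℕ u' <ᵇ toℕ u) ∧ p u'))
  earlier : ∀ κ → toℕ κ < toℕ (key u) → B κ ≡ A κ
  earlier κ lt = #-cong (λ u' → ∧-congʳ {key u' == κ} refl (λ e → cong (_∧ p u')
    (<ᵇ-true (≰⇒> (λ le → <⇒≱ lt (≤-trans (mono le) (≤-reflexive (cong toℕ (==⇒≡ e)))))))))
  later : ∀ κ → toℕ (key u) < toℕ κ → B κ ≡ 0
  later κ lt = #-zero (λ u' → not-true (λ e → case ∧-split {key u' == κ} e of λ where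
    (e₁ , e₂) → <⇒≱ lt (≤-trans (≤-reflexive (cong toℕ (sym (==⇒≡ e₁)))) (mono (<⇒≤ (true-<ᵇ (proj₁ (∧-split {toℕ u' <ᵇ toℕ u} e₂))))))))
    where
    not-true : ∀ {b} → ¬ (b ≡ true) → b ≡ false
    not-true {true} f = ⊥-elim (f refl)
    not-true {false} f = refl
  split : ∀ κ → B κ ≡ 𝟙 (toℕ κ <ᵇ toℕ (key u)) * A κ + 𝟙 (κ == key u) * B κ
  split κ with <-cmp (toℕ κ) (toℕ (key u))
  ... | tri< lt ne _ rewrite <ᵇ-true lt | ≢⇒== (λ e → ne (cong toℕ e)) = trans (earlier κ lt) (trans (sym (+-identityʳ (A κ))) (sym (+-identityʳ _)))
  ... | tri≈ _ e _ with refl ← toℕ-injective e rewrite <ᵇ-false (≤-refl {toℕ κ}) | ==-refl κ = sym (+-identityʳ (B κ))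
  ... | tri> _ ne lt rewrite <ᵇ-false (<⇒≤ lt) | ≢⇒== (λ e → ne (cong toℕ e)) = later κ lt

module SelectionCong (K H : ℕ) where
  open Selection K H

  module _ {n} {f g : Fin n → ℕ} (e : ∀ u → f u ≡ g u) where

    below-cong : ∀ x → below f x ≡ below g x
    below-cong x = #-cong (λ u → cong (_<ᵇ x) (e u))

    cutoffFrom-cong : ∀ b lo → cutoffFrom f b lo ≡ cutoffFrom g b lo
    cutoffFrom-cong zero lo = refl
    cutoffFrom-cong (suc b) lo rewrite below-cong (lo + 2 ^ b) = cutoffFrom-cong b _

    trim-cong : ∀ u → trim f u ≡ trim g u
    trim-cong u = cong₂ (λ b d → if b then d else ∞) (cong₂ _∨_ (cong₂ _<ᵇ_ (e u) θ≡) (cong₂ _∧_ (cong₂ _≡ᵇ_ (e u) θ≡)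
        (cong (_<ᵇ K) (cong₂ _+_ (trans (below-cong (cutoff f)) (cong (below g) θ≡)) (#-cong (λ u' → cong ((toℕ u' <ᵇ toℕ u) ∧_) (cong₂ _≡ᵇ_ (e u') θ≡))))))) (e u)
      where
      θ≡ : cutoff f ≡ cutoff g
      θ≡ = cutoffFrom-cong H 0

routeOn : ∀ {N} s .{{_ : NonZero s}} → N ≡ s * s → ∀ {Ω : Set} M (E₀ : Rel N Ω) (let open Clique M E₀) {T P} {A : Set} →
  Enc (Maybe (Fin N × A)) M → Enc (Maybe (Fin N × (Fin N × A))) M → Knows T P →
  (out : Ω → Fin N → List (Fin N × A)) → (∀ i ω ω' → P i ω ω' → out ω i ≡ out ω' i) →
  ∀ r → (∀ ω i → length (out ω i) ≤ r * N) → (∀ ω t → sum (λ i → cnt (λ x → proj₁ x == t) (out ω i)) ≤ r * N) →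
  Σ (Ω → Fin N → List A) λ inbox →
    Knows (T + (27 + 8 * r)) (λ j ω ω' → P j ω ω' × inbox ω j ≡ inbox ω' j)
    × (∀ ω t φ → cnt φ (inbox ω t) ≡ sum (λ i → cnt (λ x → (proj₁ x == t) ∧ φ (proj₂ x)) (out ω i)))
routeOn s refl M E₀ = Routing.route s M E₀

if-==-cong : ∀ {n} {X : Set} {j a a' : Fin n} {x x' y : X} → a ≡ a' → (a ≡ j → x ≡ x') →
  (if a == j then x else y) ≡ (if a' == j then x' else y)
if-==-cong {j = j} {a} refl f with a ≟F j
... | no _ = refl
... | yes e = f e

if-≤ : ∀ b {x y z} → (b ≡ true → x ≤ z) → y ≤ z → (if b then x else y) ≤ z
if-≤ true  f _ = f refl
if-≤ false _ p = p

module Phase (P q H s : ℕ) .{{_ : NonZero P}} .{{_ : NonZero q}} .{{_ : NonZero s}}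
  (square : Cube.N P ≡ s * s) {Ω : Set} (M : ℕ) (E₀ : Rel (Cube.N P) Ω)
  (enc₁ : Enc (Maybe (Fin (Cube.N P) × Entries.Entry P H)) M)
  (enc₂ : Enc (Maybe (Fin (Cube.N P) × (Fin (Cube.N P) × Entries.Entry P H))) M)
  (N+N<M : Cube.N P + Cube.N P < M) (∞<M : 2 ^ H < M)
  (h : Ω → Fin (Cube.N P) → Fin (Cube.N P) → ℕ)
  where

  open Cube P
  open Entries P H
  open Tables P q H
  open Selection K H hiding (∞)
  open SelectionCong K H
  open Clique M E₀
  module C (ω : Ω) = Columns P q H (h ω)

  N<M : ∀ {x} → x ≤ N → x < M
  N<M le = ≤-<-trans (≤-trans le (m≤m+n N N)) N+N<M

  1≤N : 1 ≤ N
  1≤N = >-nonZero⁻¹ N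

  OwnRow : Rel N Ω
  OwnRow i ω ω' = ∀ u → h ω i u ≡ h ω' i u

  KnowsMiddle : Rel N Ω
  KnowsMiddle i ω ω' = (∀ w → middle (h ω) (c₀ i) w ≡ middle (h ω') (c₀ i) w) × (∀ I → middle (h ω) I i ≡ middle (h ω') I i)

  -- Row `v` tells `w` whether their entry is present, `w` answers with its in-degree from the block
  -- of `v`, and `v` returns the bucket this gives. Any vertex of block `I` could report for it;
  -- `cube I I I` is the one consulted.
  learn-middle : ∀ {T} → Knows T OwnRow → Knows (3 + T) (λ i ω ω' → OwnRow i ω ω' × KnowsMiddle i ω ω')
  learn-middle k = weaken ≤-refl
      (λ i ω ω' p → proj₁ (proj₁ (proj₁ p)) , (block i ω ω' (proj₁ p) , λ I →
        toℕ-injective (subst (λ J → toℕ (middle (h ω) J i) ≡ toℕ (middle (h ω') J i)) (c₀-cube I I I) (proj₂ p (cube I I I)))))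
      (sendℕ k₂ (λ ω v w → toℕ (middle (h ω) (c₀ v) w)) (λ ω v w → N<M (≤-trans (<⇒≤ (toℕ<n _)) P≤N))
        (λ i ω ω' p w → cong toℕ (block i ω ω' p w)))
    where
    k₁ = sendℕ k (λ ω v w → 𝟙 (present (h ω) v w)) (λ ω v w → N<M (≤-trans (𝟙≤1 _) 1≤N))
      (λ v ω ω' p w → cong (λ d → 𝟙 (d <ᵇ ∞)) (p w))
    k₂ = sendℕ k₁ (λ ω w v → inDegree (h ω) (c₀ v) w) (λ ω w v → N<M (#-≤ _))
      (λ w ω ω' p v → #-cong (λ u → cong ((c₀ u == c₀ v) ∧_) (𝟙-injective (proj₂ p u))))
    block : ∀ i ω ω' → (_ × (∀ w → inDegree (h ω) (c₀ i) w ≡ inDegree (h ω') (c₀ i) w)) →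
      ∀ w → middle (h ω) (c₀ i) w ≡ middle (h ω') (c₀ i) w
    block i ω ω' p = bucket-cong P (3 * (q * N)) {{it}} {{m*n≢0 3 (q * N)}} (λ w → cong (_+ q * P) (proj₂ p w))

  KnowsBuckets : (Ω → Fin P → Fin P → V → Fin P) → Rel N Ω
  KnowsBuckets cb i ω ω' = ∀ u → cb ω (c₀ i) (c₁ i) u ≡ cb ω' (c₀ i) (c₁ i) u

  -- What node i can say about pairs (v , u) with v in its block and u in its
  -- column bucket.
  OnShare : {X : Set} → (Ω → Fin P → Fin P → V → Fin P) → (Ω → V → Fin P → V → X) → Rel N Ω
  OnShare cb φ i ω ω' = ∀ v u → c₀ v ≡ c₀ i → cb ω (c₀ i) (c₁ i) u ≡ c₂ i → φ ω v (c₁ i) u ≡ φ ω' v (c₁ i) u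

  -- One round suffices, since node `i` owes each row `v` of its block a single count, for the pair
  -- of `c₁ i` and `c₂ i`. Summing over `κ` lets the row count along all columns of a partial
  -- product.
  query : ∀ {T Q} → Knows T Q → (cb : Ω → Fin P → Fin P → V → Fin P) → (∀ i ω ω' → Q i ω ω' → KnowsBuckets cb i ω ω') →
    (φ : Ω → V → Fin P → V → Bool) → (∀ i ω ω' → Q i ω ω' → OnShare cb φ i ω ω') →
    Knows (suc T) (λ v ω ω' → Q v ω ω' × (∀ j κ →
      # (λ u → (cb ω (c₀ v) j u == κ) ∧ φ ω v j u) ≡ # (λ u → (cb ω' (c₀ v) j u == κ) ∧ φ ω' v j u)))
  query k cb kcb φ kφ = weaken ≤-refl (λ v ω ω' p → proj₁ p , λ j κ →
      trans (sym (at ω v j κ)) (trans (proj₂ p (cube (c₀ v) j κ)) (at ω' v j κ)))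
    (sendℕ k m (λ ω i v → N<M (bound ω i v)) det)
    where
    count : Ω → V → V → ℕ
    count ω i v = # (λ u → (cb ω (c₀ i) (c₁ i) u == c₂ i) ∧ φ ω v (c₁ i) u)
    m : Ω → V → V → ℕ
    m ω i v = if c₀ v == c₀ i then count ω i v else 0
    bound : ∀ ω i v → m ω i v ≤ N
    bound ω i v with c₀ v == c₀ i
    ... | true = #-≤ (λ u → (cb ω (c₀ i) (c₁ i) u == c₂ i) ∧ φ ω v (c₁ i) u)
    ... | false = z≤n
    det : ∀ i ω ω' → _ → ∀ v → m ω i v ≡ m ω' i v
    det i ω ω' p v with c₀ v ≟F c₀ i
    ... | no _ = refl
    ... | yes e = #-cong (λ u → ∧-congʳ (cong (_== c₂ i) (kcb i ω ω' p u)) (λ t → kφ i ω ω' p v u e (==⇒≡ t)))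
    at : ∀ ω v j κ → m ω (cube (c₀ v) j κ) v ≡ # (λ u → (cb ω (c₀ v) j u == κ) ∧ φ ω v j u)
    at ω v j κ rewrite c₀-cube (c₀ v) j κ | c₁-cube (c₀ v) j κ | c₂-cube (c₀ v) j κ | ==-refl (c₀ v) = refl

  through : Ω → V → Fin P → V → ℕ
  through ω = C.through ω

  θ : Ω → V → Fin P → ℕ
  θ ω v j = cutoff (through ω v j)

  -- Two rounds per bit: rows announce their current lower bounds and nodes return counts. The `P`
  -- searches of all rows run in parallel, because each node hears only about its own middle bucket.
  search : ∀ {T Q} b → Knows T Q → (cb : Ω → Fin P → Fin P → V → Fin P) →
    (∀ i ω ω' → Q i ω ω' → KnowsBuckets cb i ω ω' × OnShare cb through i ω ω') →
    (lo : Ω → V → Fin P → ℕ) → (∀ ω v j → lo ω v j + 2 ^ b ≤ ∞) → (∀ i ω ω' → Q i ω ω' → ∀ j → lo ω i j ≡ lo ω' i j) →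
    Knows (2 * b + T) (λ i ω ω' → Q i ω ω' × (∀ j → cutoffFrom (through ω i j) b (lo ω i j) ≡ cutoffFrom (through ω' i j) b (lo ω' i j)))
  search zero k cb kc lo bound klo = weaken ≤-refl (λ i ω ω' p → p , klo i ω ω' p) k
  search {T} {Q} (suc b) k cb kc lo bound klo = weaken (≤-reflexive (arith b T))
      (λ i ω ω' p → proj₁ (proj₁ (proj₁ p)) , proj₂ p)
      (search b k₂ cb (λ i ω ω' p → kc i ω ω' (proj₁ (proj₁ p))) lo' bound' klo')
    where
    arith : ∀ b T → 2 * b + (2 + T) ≡ 2 * suc b + T
    arith = solve-∀
    φ : Ω → V → Fin P → V → Bool
    φ ω v j u = through ω v j u <ᵇ lo ω v j + 2 ^ b
    lo<∞ : ∀ ω v j → lo ω v j < ∞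
    lo<∞ ω v j = <-≤-trans (m<m+n (lo ω v j) (m^n>0 2 (suc b))) (bound ω v j)
    k₁ = sendℕ k (λ ω v i → lo ω v (c₁ i)) (λ ω v i → <-trans (lo<∞ ω v (c₁ i)) ∞<M) (λ v ω ω' p i → klo v ω ω' p (c₁ i))
    k₂ = query k₁ cb (λ i ω ω' p → proj₁ (kc i ω ω' (proj₁ p))) φ
      (λ i ω ω' p v u e e' → cong₂ (λ d l → d <ᵇ l + 2 ^ b) (proj₂ (kc i ω ω' (proj₁ p)) v u e e') (proj₂ p v))
    lo' : Ω → V → Fin P → ℕ
    lo' ω v j = if below (through ω v j) (lo ω v j + 2 ^ b) <ᵇ K then lo ω v j + 2 ^ b else lo ω v j
    bound' : ∀ ω v j → lo' ω v j + 2 ^ b ≤ ∞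
    bound' ω v j with below (through ω v j) (lo ω v j + 2 ^ b) <ᵇ K
    ... | true = ≤-trans (≤-reflexive (double (lo ω v j) (2 ^ b))) (bound ω v j)
      where
      double : ∀ a c → a + c + c ≡ a + 2 * c
      double = solve-∀
    ... | false = ≤-trans (+-monoʳ-≤ (lo ω v j) (m≤m+n (2 ^ b) _)) (bound ω v j)
    klo' : ∀ i ω ω' → _ → ∀ j → lo' ω i j ≡ lo' ω' i j
    klo' i ω ω' p j = cong₂ (λ c l → if c <ᵇ K then l + 2 ^ b else l)
      (trans (#-fibres (cb ω (c₀ i) j) (φ ω i j)) (trans (sum-cong-≗ (proj₂ p j)) (sym (#-fibres (cb ω' (c₀ i) j) (φ ω' i j)))))
      (klo i ω ω' (proj₁ (proj₁ p)) j)

  KnowsCutoffs : Rel N Ω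
  KnowsCutoffs i ω ω' = ∀ v → θ ω v (c₁ i) ≡ θ ω' v (c₁ i)

  learn-cutoffs : ∀ {T Q} → Knows T Q → (cb : Ω → Fin P → Fin P → V → Fin P) →
    (∀ i ω ω' → Q i ω ω' → KnowsBuckets cb i ω ω' × OnShare cb through i ω ω') →
    Knows (suc (2 * H + T)) (λ i ω ω' → Q i ω ω' × KnowsCutoffs i ω ω')
  learn-cutoffs k cb kc = weaken ≤-refl (λ i ω ω' p → proj₁ (proj₁ p) , proj₂ p)
    (sendℕ (search H k cb kc (λ _ _ _ → 0) (λ ω v j → ≤-refl) (λ i ω ω' p j → refl))
      (λ ω v i → θ ω v (c₁ i)) (λ ω v i → <-trans (cutoff<∞ (C.1≤K ω) (through ω v (c₁ i)) H 0 ≤-refl) ∞<M) (λ v ω ω' p i → proj₂ p (c₁ i)))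

  isChosen : Ω → V → Fin P → V → Bool
  isChosen ω v j = chosen (through ω v j)

  -- A row sends back the number of values below its cutoff plus the ties in earlier buckets.
  -- Together with its own ties this gives a node the position of each of its columns in the order
  -- by value and index. The offset may reach `N + N`, which messages must accommodate.
  learn-chosen : ∀ {T Q} → Knows T Q → (cb : Ω → Fin P → Fin P → V → Fin P) →
    (∀ ω I j {u v} → toℕ u ≤ toℕ v → toℕ (cb ω I j u) ≤ toℕ (cb ω I j v)) →
    (∀ i ω ω' → Q i ω ω' → (KnowsBuckets cb i ω ω' × OnShare cb through i ω ω') × KnowsCutoffs i ω ω') →
    Knows (3 + T) (λ i ω ω' → Q i ω ω' × OnShare cb isChosen i ω ω')
  learn-chosen {T} {Q} k cb mono kc = weaken ≤-refl (λ i ω ω' p → proj₁ (proj₁ (proj₁ p)) , conclude i ω ω' (proj₁ (proj₁ (proj₁ p))) (proj₂ p)) k₃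
    where
    low tie : Ω → V → Fin P → V → Bool
    low ω v j u = through ω v j u <ᵇ θ ω v j
    tie ω v j u = through ω v j u ≡ᵇ θ ω v j
    k₁ = query k cb (λ i ω ω' p → proj₁ (proj₁ (kc i ω ω' p))) low
      (λ i ω ω' p v u e e' → cong₂ _<ᵇ_ (proj₂ (proj₁ (kc i ω ω' p)) v u e e') (proj₂ (kc i ω ω' p) v))
    k₂ = query k₁ cb (λ i ω ω' p → proj₁ (proj₁ (kc i ω ω' (proj₁ p)))) tie
      (λ i ω ω' p v u e e' → cong₂ _≡ᵇ_ (proj₂ (proj₁ (kc i ω ω' (proj₁ p))) v u e e') (proj₂ (kc i ω ω' (proj₁ p)) v))
    tiesIn : Ω → V → Fin P → Fin P → ℕ
    tiesIn ω v j κ = # (λ u → (cb ω (c₀ v) j u == κ) ∧ tie ω v j u)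
    offset : Ω → V → Fin P → Fin P → ℕ
    offset ω v j κ = # (low ω v j) + sum (λ κ' → 𝟙 (toℕ κ' <ᵇ toℕ κ) * tiesIn ω v j κ')
    offset-≤ : ∀ ω v j κ → offset ω v j κ ≤ N + N
    offset-≤ ω v j κ = +-mono-≤ (#-≤ _) (≤-trans (sum-mono (λ κ' → ≤-trans (*-monoˡ-≤ (tiesIn ω v j κ') (𝟙≤1 (toℕ κ' <ᵇ toℕ κ))) (≤-reflexive (*-identityˡ (tiesIn ω v j κ')))))
      (≤-trans (≤-reflexive (sym (#-fibres (cb ω (c₀ v) j) (tie ω v j)))) (#-≤ (tie ω v j))))
    k₃ = sendℕ k₂ (λ ω v i → offset ω v (c₁ i) (c₂ i)) (λ ω v i → ≤-<-trans (offset-≤ ω v (c₁ i) (c₂ i)) N+N<M)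
      (λ v ω ω' p i → cong₂ _+_
        (trans (#-fibres (cb ω (c₀ v) (c₁ i)) (low ω v (c₁ i))) (trans (sum-cong-≗ (proj₂ (proj₁ p) (c₁ i))) (sym (#-fibres (cb ω' (c₀ v) (c₁ i)) (low ω' v (c₁ i))))))
        (sum-cong-≗ (λ κ' → cong (𝟙 (toℕ κ' <ᵇ toℕ (c₂ i)) *_) (proj₂ p (c₁ i) κ'))))
    nearby : Ω → V → Fin P → V → ℕ
    nearby ω v j u = # (λ u' → (cb ω (c₀ v) j u' == cb ω (c₀ v) j u) ∧ ((toℕ u' <ᵇ toℕ u) ∧ tie ω v j u'))
    position : ∀ ω v j u → below (through ω v j) (θ ω v j) + rank (tie ω v j) u ≡ offset ω v j (cb ω (c₀ v) j u) + nearby ω v j u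
    position ω v j u = trans (cong (# (low ω v j) +_) (rank-split (cb ω (c₀ v) j) (mono ω (c₀ v) j) (tie ω v j) u)) (sym (+-assoc (# (low ω v j)) _ _))
    conclude : ∀ i ω ω' → Q i ω ω' → (∀ v → offset ω v (c₁ i) (c₂ i) ≡ offset ω' v (c₁ i) (c₂ i)) → OnShare cb isChosen i ω ω'
    conclude i ω ω' p e v u eI eκ =
      cong₂ _∨_ (cong₂ _<ᵇ_ th (cut v)) (cong₂ _∧_ (cong₂ _≡ᵇ_ th (cut v))
        (cong (_<ᵇ K) (trans (position ω v (c₁ i) u) (trans (cong₂ _+_
          (trans (cong (offset ω v (c₁ i)) κ≡) (trans (e v) (sym (cong (offset ω' v (c₁ i)) κ'≡)))) near) (sym (position ω' v (c₁ i) u))))))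
      where
      cbs = proj₁ (proj₁ (kc i ω ω' p))
      share = proj₂ (proj₁ (kc i ω ω' p))
      cut = proj₂ (kc i ω ω' p)
      th : through ω v (c₁ i) u ≡ through ω' v (c₁ i) u
      th = share v u eI eκ
      κ≡ : cb ω (c₀ v) (c₁ i) u ≡ c₂ i
      κ≡ = trans (cong (λ I → cb ω I (c₁ i) u) eI) eκ
      κ'≡ : cb ω' (c₀ v) (c₁ i) u ≡ c₂ i
      κ'≡ = trans (cong (λ I → cb ω' I (c₁ i) u) eI) (trans (sym (cbs u)) eκ)
      near : nearby ω v (c₁ i) u ≡ nearby ω' v (c₁ i) u
      near = #-cong (λ u' → ∧-congʳ
        (cong₂ _==_ (subst (λ I → cb ω I (c₁ i) u' ≡ cb ω' I (c₁ i) u') (sym eI) (cbs u')) (trans κ≡ (sym κ'≡)))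
        (λ t → cong ((toℕ u' <ᵇ toℕ u) ∧_) (cong₂ _≡ᵇ_ (share v u' eI (trans (cong (λ I → cb ω I (c₁ i) u') (sym eI)) (trans (==⇒≡ t) κ≡))) (cut v))))

  module _ (few : ∀ ω v → # (present (h ω) v) ≤ K) (capped : ∀ ω v u → h ω v u ≤ ∞) where

    module _ (left right : Ω → V → List Entry)
      (left-spec : ∀ ω t φ → cnt φ (left ω t) ≡ sum (λ v → cnt (λ p → (proj₁ p == t) ∧ φ (proj₂ p)) (leftOut (h ω) v)))
      (right-spec : ∀ ω t φ → cnt φ (right ω t) ≡ sum (λ v → cnt (λ p → (proj₁ p == t) ∧ φ (proj₂ p)) (rightOut (h ω) v))) where

      degree : Ω → Fin P → Fin P → V → ℕ
      degree ω = C.degree ω (right ω)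

      Inputs : Rel N Ω
      Inputs i ω ω' = (KnowsMiddle i ω ω' × left ω i ≡ left ω' i) ×
        (right ω i ≡ right ω' i × (∀ u → degree ω (c₀ i) (c₁ i) u ≡ degree ω' (c₀ i) (c₁ i) u))

      learn-degree : ∀ {T} → Knows T (λ i ω ω' → (KnowsMiddle i ω ω' × left ω i ≡ left ω' i) × right ω i ≡ right ω' i) →
        Knows (2 + T) Inputs
      learn-degree k = weaken ≤-refl (λ i ω ω' p → proj₁ (proj₁ (proj₁ p)) , (proj₂ (proj₁ (proj₁ p)) , proj₂ p))
        (sendℕ (sendℕ k (λ ω i u → C.part ω (right ω) i u) (λ ω i u → N<M (C.part-≤ ω (few ω) (right ω) (right-spec ω) i u))
            (λ i ω ω' p u → cong (cnt (λ e → C.column ω e == u)) (proj₂ p)))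
          (λ ω u i → degree ω (c₀ i) (c₁ i) u) (λ ω u i → N<M (C.degree-≤ ω (few ω) (right ω) (right-spec ω) (c₀ i) (c₁ i) u))
          (λ u ω ω' p i → sum-cong-≗ (λ κ → proj₂ p (cube (c₀ i) (c₁ i) κ))))

      left-known : ∀ i ω ω' → Inputs i ω ω' → ∀ v w → c₀ v ≡ c₀ i → middle (h ω) (c₀ i) w ≡ c₁ i → h ω v w ≡ h ω' v w
      left-known i ω ω' (((mid , _) , le) , _) v w eI ej = holds-determines (capped ω v w) (capped ω' v w) (λ x →
          𝟙-injective (trans (sym (at ω ej x)) (trans (cong (cnt (match v w x)) le) (at ω' (trans (sym (mid w)) ej) x))))
        where
        at : ∀ ω → middle (h ω) (c₀ i) w ≡ c₁ i → ∀ x → cnt (match v w x) (left ω i) ≡ 𝟙 (holds (h ω v w) x)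
        at ω e x = trans (left-spec ω i (match v w x)) (trans (leftOut-count (h ω) i v w x)
          (cong₂ (λ a b → 𝟙 (a ∧ (b ∧ holds (h ω v w) x))) (==-true eI) (==-true (trans (cong (λ I → middle (h ω) I w) eI) e))))

      module _ (o : Ω → Fin P → Fin P → V → ℕ) (o-≤ : ∀ ω I j u → o ω I j u ≤ N) (o-total : ∀ ω I j → sum (o ω I j) ≤ P * (q * N)) where

        buckets : Ω → Fin P → Fin P → V → Fin P
        buckets ω = C.columnBucket ω (degree ω) (o ω)

        buckets-mono : ∀ ω I j {u v} → toℕ u ≤ toℕ v → toℕ (buckets ω I j u) ≤ toℕ (buckets ω I j v)
        buckets-mono ω = C.cb-mono ω (few ω) (right ω) (right-spec ω) (o ω) (o-≤ ω) (o-total ω)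

        -- On its share a node knows both terms for every middle vertex in its bucket, one from
        -- `left` and one from the new inbox. Any other middle vertex contributes `∞` whatever the
        -- table says.
        learn-products : ∀ {T Q} → Knows T Q → (∀ i ω ω' → Q i ω ω' → Inputs i ω ω') →
          (∀ i ω ω' → Q i ω ω' → ∀ u → o ω (c₀ i) (c₁ i) u ≡ o ω' (c₀ i) (c₁ i) u) →
          Knows (T + (27 + 8 * (14 * q))) (λ i ω ω' → Q i ω ω' × (KnowsBuckets buckets i ω ω' × OnShare buckets through i ω ω'))
        learn-products {T} {Q} k inputs ko = weaken ≤-refl
            (λ i ω ω' p → proj₁ p , (known i ω ω' (proj₁ p) , product-known i ω ω' (proj₁ p) (proj₂ p)))
            (proj₁ (proj₂ routed))
          where
          known : ∀ i ω ω' → Q i ω ω' → KnowsBuckets buckets i ω ω'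
          known i ω ω' p = bucket-cong P (12 * (q * N)) {{it}} {{m*n≢0 12 (q * N)}} (λ u → cong₂ _+_ (proj₂ (proj₂ (inputs i ω ω' p)) u) (ko i ω ω' p u))
          out : Ω → V → List (V × Entry)
          out ω = C.columnOut ω (right ω) (buckets ω)
          routed = routeOn s square M E₀ enc₁ enc₂ k out
            (λ i ω ω' p → trans (map-cong (λ e → cong (λ κ → cube (c₀ i) (c₁ i) κ , e) (known i ω ω' p (C.column ω e))) (right ω i))
              (cong (map (λ e → cube (c₀ i) (c₁ i) (buckets ω' (c₀ i) (c₁ i) (C.column ω e)) , e)) (proj₁ (proj₂ (inputs i ω ω' p)))))
            (14 * q)
            (λ ω i → ≤-trans (C.columnOut-length ω (few ω) (right ω) (right-spec ω) (o ω) (o-≤ ω) (o-total ω) i) (≤-reflexive (sym (*-assoc 14 q N))))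
            (λ ω i → ≤-trans (C.columnOut-load ω (few ω) (right ω) (right-spec ω) (o ω) (o-≤ ω) (o-total ω) i) (≤-reflexive (sym (*-assoc 14 q N))))
          inbox = proj₁ routed
          product-known : ∀ i ω ω' → Q i ω ω' → inbox ω i ≡ inbox ω' i → OnShare buckets through i ω ω'
          product-known i ω ω' p eq v u eI eκ = mins-cong ∞ each
            where
            inp = inputs i ω ω' p
            mid : ∀ w → middle (h ω) (c₀ v) w ≡ middle (h ω') (c₀ v) w
            mid w = subst (λ I → middle (h ω) I w ≡ middle (h ω') I w) (sym eI) (proj₁ (proj₁ (proj₁ inp)) w)
            right-known : ∀ w → middle (h ω) (c₀ i) w ≡ c₁ i → h ω w u ≡ h ω' w u
            right-known w ej = holds-determines (capped ω w u) (capped ω' w u) (λ x →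
                𝟙-injective (trans (sym (at ω eκ ej x)) (trans (cong (cnt (match w u x)) eq)
                  (at ω' (trans (sym (known i ω ω' p u)) eκ) (trans (sym (proj₁ (proj₁ (proj₁ inp)) w)) ej) x))))
              where
              at : ∀ ω → buckets ω (c₀ i) (c₁ i) u ≡ c₂ i → middle (h ω) (c₀ i) w ≡ c₁ i → ∀ x → cnt (match w u x) (inbox ω i) ≡ 𝟙 (holds (h ω w u) x)
              at ω a b x = trans (proj₂ (proj₂ routed) ω i (match w u x))
                (trans (C.columnOut-match ω (few ω) (right ω) (right-spec ω) (o ω) (o-≤ ω) (o-total ω) i w u x)
                (trans (cong₂ (λ y z → 𝟙 y * (𝟙 z * 𝟙 (holds (h ω w u) x))) (==-true a) (==-true b)) (trans (+-identityʳ _) (+-identityʳ _))))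
            each : ∀ w → (if middle (h ω) (c₀ v) w == c₁ i then h ω v w + h ω w u else ∞) ≡ (if middle (h ω') (c₀ v) w == c₁ i then h ω' v w + h ω' w u else ∞)
            each w = if-==-cong (mid w) (λ e → cong₂ _+_ (left-known i ω ω' inp v w eI (e' e)) (right-known w (e' e)))
              where
              e' : middle (h ω) (c₀ v) w ≡ c₁ i → middle (h ω) (c₀ i) w ≡ c₁ i
              e' e = trans (cong (λ I → middle (h ω) I w) (sym eI)) e

      usage : Ω → Fin P → Fin P → V → ℕ
      usage ω = C.usage ω

      -- Among the nodes with coordinates `I` and `j`, only the one whose column bucket contains `u`
      -- can count its survivors; it reports to vertex `u`, which passes the number on to all of
      -- them.
      learn-usage : ∀ {T Q} → Knows T Q → (cb : Ω → Fin P → Fin P → V → Fin P) →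
        (∀ i ω ω' → Q i ω ω' → KnowsBuckets cb i ω ω' × OnShare cb isChosen i ω ω') →
        Knows (2 + T) (λ i ω ω' → Q i ω ω' × (∀ u → usage ω (c₀ i) (c₁ i) u ≡ usage ω' (c₀ i) (c₁ i) u))
      learn-usage {T} {Q} k cb kc = weaken ≤-refl (λ i ω ω' p → proj₁ (proj₁ p) , proj₂ p)
          (sendℕ (sendℕ k m (λ ω i u → N<M (bound ω i u)) det)
            (λ ω u i → usage ω (c₀ i) (c₁ i) u) (λ ω u i → N<M (C.usage-≤ ω (c₀ i) (c₁ i) u))
            (λ u ω ω' p i → trans (gather ω (c₀ i) (c₁ i) u) (trans (sum-cong-≗ (λ κ → proj₂ p (cube (c₀ i) (c₁ i) κ))) (sym (gather ω' (c₀ i) (c₁ i) u)))))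
        where
        m : Ω → V → V → ℕ
        m ω i u = if cb ω (c₀ i) (c₁ i) u == c₂ i then usage ω (c₀ i) (c₁ i) u else 0
        bound : ∀ ω i u → m ω i u ≤ N
        bound ω i u with cb ω (c₀ i) (c₁ i) u == c₂ i
        ... | true = C.usage-≤ ω (c₀ i) (c₁ i) u
        ... | false = z≤n
        det : ∀ i ω ω' → Q i ω ω' → ∀ u → m ω i u ≡ m ω' i u
        det i ω ω' p u rewrite sym (proj₁ (kc i ω ω' p) u) with cb ω (c₀ i) (c₁ i) u ≟F c₂ i
        ... | no _ = refl
        ... | yes e = #-cong (λ v → ∧-congʳ {c₀ v == c₀ i} refl (λ t → proj₂ (kc i ω ω' p) v u (==⇒≡ t) e))
        gather : ∀ ω I j u → usage ω I j u ≡ sum (λ κ → m ω (cube I j κ) u)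
        gather ω I j u = sym (trans (sum-cong-≗ at) (trans (sum-single _ (cb ω I j u) (λ κ ne → cong (λ b → if b then usage ω I j u else 0) (≢⇒== (λ e → ne (sym e)))))
            (cong (λ b → if b then usage ω I j u else 0) (==-refl (cb ω I j u)))))
          where
          at : ∀ κ → m ω (cube I j κ) u ≡ (if cb ω I j u == κ then usage ω I j u else 0)
          at κ rewrite c₀-cube I j κ | c₁-cube I j κ | c₂-cube I j κ = refl

      shortlist : Ω → V → Fin P → V → ℕ
      shortlist ω v j = trim (through ω v j)

      learn-shortlists : ∀ {T} → Knows T Inputs →
        Knows ((T + (27 + 8 * (14 * q)) + (6 + 2 * H)) + (27 + 8 * (14 * q)) + 3 + (27 + 8 * (14 * q)))
          (λ v ω ω' → ∀ j u → shortlist ω v j u ≡ shortlist ω' v j u)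
      learn-shortlists {T} k = weaken ≤-refl (λ v ω ω' p → conclude v ω ω' (proj₂ p)) (proj₁ (proj₂ routed))
        where
        none : Ω → Fin P → Fin P → V → ℕ
        none _ _ _ _ = 0
        none-total : ∀ ω I j → sum (none ω I j) ≤ P * (q * N)
        none-total ω I j = ≤-trans (≤-reflexive (sum-zero (λ _ → refl))) z≤n
        cb₁ cb₂ : Ω → Fin P → Fin P → V → Fin P
        cb₁ = buckets none (λ _ _ _ _ → z≤n) none-total
        cb₂ = buckets usage C.usage-≤ C.usage-total
        k₁ = learn-products none (λ _ _ _ _ → z≤n) none-total k (λ i ω ω' p → p) (λ i ω ω' p u → refl)
        k₂ = learn-cutoffs k₁ cb₁ (λ i ω ω' → proj₂)
        k₃ = learn-chosen k₂ cb₁ (buckets-mono none (λ _ _ _ _ → z≤n) none-total) (λ i ω ω' p → proj₂ (proj₁ p) , proj₂ p)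
        k₄ = learn-usage k₃ cb₁ (λ i ω ω' p → proj₁ (proj₂ (proj₁ (proj₁ p))) , proj₂ p)
        k₄' : Knows (T + (27 + 8 * (14 * q)) + (6 + 2 * H)) (λ i ω ω' → (Inputs i ω ω' × KnowsCutoffs i ω ω') × (∀ u → usage ω (c₀ i) (c₁ i) u ≡ usage ω' (c₀ i) (c₁ i) u))
        k₄' = weaken (≤-reflexive (arith (T + (27 + 8 * (14 * q))) H)) (λ i ω ω' p → (proj₁ (proj₁ (proj₁ (proj₁ p))) , proj₂ (proj₁ (proj₁ p))) , proj₂ p) k₄
          where
          arith : ∀ T H → 2 + (3 + suc (2 * H + T)) ≡ T + (6 + 2 * H)
          arith = solve-∀
        k₅ = learn-products usage C.usage-≤ C.usage-total k₄' (λ i ω ω' p → proj₁ (proj₁ p)) (λ i ω ω' p → proj₂ p)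
        -- The columns have changed hands, so ties are ranked anew; the cutoffs found with `cb₁` are
        -- reused.
        k₆ = learn-chosen k₅ cb₂ (buckets-mono usage C.usage-≤ C.usage-total) (λ i ω ω' p → proj₂ p , proj₂ (proj₁ (proj₁ p)))
        results : Ω → V → List (V × Entry)
        results ω = C.resultOut ω (cb₂ ω)
        results-length : ∀ ω i → length (results ω i) ≤ 14 * q * N
        results-length ω i = ≤-trans (≤-reflexive (C.resultOut-length ω (cb₂ ω) i))
          (≤-trans (sum-mono (λ u → *-monoʳ-≤ (𝟙 (cb₂ ω (c₀ i) (c₁ i) u == c₂ i)) (m≤n+m (usage ω (c₀ i) (c₁ i) u) (degree ω (c₀ i) (c₁ i) u))))
          (≤-trans (C.column-load ω (few ω) (right ω) (right-spec ω) (usage ω) (C.usage-≤ ω) (C.usage-total ω) (c₀ i) (c₁ i) (c₂ i))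
            (≤-reflexive (sym (*-assoc 14 q N)))))
        routed = routeOn s square M E₀ enc₁ enc₂
          (weaken (≤-reflexive (+-comm 3 _)) (λ i ω ω' p → p) k₆) results
          (λ i ω ω' p → ⨁-cong (λ v → ⨁-cong (λ u → when-cong
            (∧-congʳ {c₀ v == c₀ i} refl (λ t → ∧-congʳ (cong (_== c₂ i) (proj₁ (proj₂ (proj₁ p)) u)) (λ t' → proj₂ p v u (==⇒≡ t) (==⇒≡ t'))))
            (λ t → cong (λ d → v , (C.tag ω (c₁ i) , (u , clamp d)))
              (proj₂ (proj₂ (proj₁ p)) v u (==⇒≡ (proj₁ (∧-split {c₀ v == c₀ i} t)))
                (==⇒≡ (proj₁ (∧-split {cb₂ ω (c₀ i) (c₁ i) u == c₂ i} (proj₂ (∧-split {c₀ v == c₀ i} t))))))))))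
          (14 * q) results-length
          (λ ω v → ≤-trans (C.resultOut-load ω (cb₂ ω) v) (*-monoˡ-≤ N (m≤n*m q 14)))
        inbox = proj₁ routed
        conclude : ∀ v ω ω' → inbox ω v ≡ inbox ω' v → ∀ j u → shortlist ω v j u ≡ shortlist ω' v j u
        conclude v ω ω' eq j u = holds-determines (cap ω) (cap ω') (λ x → 𝟙-injective (trans (sym (at ω x)) (trans (cong (cnt (match (C.tag ω j) u x)) eq) (at ω' x))))
          where
          cap : ∀ ω → shortlist ω v j u ≤ ∞
          cap ω = if-≤ (isChosen ω v j u) (λ e → <⇒≤ (chosen⇒<∞ (C.1≤K ω) (through ω v j) u e)) ≤-refl
          trimmed : ∀ ω x → isChosen ω v j u ∧ (clamp (through ω v j u) == x) ≡ holds (shortlist ω v j u) x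
          trimmed ω x = holds-if (isChosen ω v j u) x (chosen⇒<∞ (C.1≤K ω) (through ω v j) u)
          at : ∀ ω x → cnt (match (C.tag ω j) u x) (inbox ω v) ≡ 𝟙 (holds (shortlist ω v j u) x)
          at ω x = trans (proj₂ (proj₂ routed) ω v (match (C.tag ω j) u x)) (trans (C.resultOut-match ω (cb₂ ω) v j u x) (cong 𝟙 (trimmed ω x)))

    next : Ω → V → V → ℕ
    next ω = Product.next K H (λ v → middle (h ω) (c₀ v)) (h ω)

    -- The five routings give `456 = 8 * (5 + 10 + 14 + 14 + 14)`, the binary search gives `2 * H`,
    -- and `200` is a rounding of the exact constant 149.
    phaseTime : ℕ
    phaseTime = 200 + 456 * q + 2 * H

    learn-next : ∀ {T} → Knows T OwnRow → Knows (T + phaseTime) (λ i ω ω' → ∀ u → next ω i u ≡ next ω' i u)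
    learn-next {T} k = weaken (≤-trans (≤-reflexive (arith T q H)) (+-monoʳ-≤ T (+-monoˡ-≤ (2 * H) (+-monoˡ-≤ (456 * q) (m≤m+n 149 51)))))
        (λ v ω ω' p → trim-cong (λ u → mins-cong ∞ (λ j → p j u)))
        (learn-shortlists (proj₁ lefts) (proj₁ rights) (proj₂ (proj₂ lefts)) (proj₂ (proj₂ rights))
          (learn-degree (proj₁ lefts) (proj₁ rights) (proj₂ (proj₂ lefts)) (proj₂ (proj₂ rights))
            (weaken ≤-refl (λ i ω ω' p → (proj₂ (proj₁ (proj₁ p)) , proj₂ (proj₁ p)) , proj₂ p) (proj₁ (proj₂ rights)))))
      where
      arith : ∀ T q H → ((2 + (3 + T + (27 + 8 * (5 * q)) + (27 + 8 * (10 * q)))) + (27 + 8 * (14 * q)) + (6 + 2 * H)) + (27 + 8 * (14 * q)) + 3 + (27 + 8 * (14 * q))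
        ≡ T + (149 + 456 * q + 2 * H)
      arith = solve-∀
      lefts = routeOn s square M E₀ enc₁ enc₂ (learn-middle k) (λ ω → leftOut (h ω))
        (λ v ω ω' p → ⨁-cong (λ w → ⨁-cong (λ κ → cong₂ (λ d m → when (d <ᵇ ∞) (cube (c₀ v) m κ , (v , (w , clamp d)))) (proj₁ p w) (proj₁ (proj₂ p) w))))
        (5 * q)
        (λ ω v → ≤-trans (leftOut-length (h ω) (few ω) v) (*-monoˡ-≤ N (m≤n*m q 5)))
        (λ ω i → ≤-trans (leftOut-load (h ω) (few ω) i) (≤-reflexive (sym (*-assoc 5 q N))))
      rights = routeOn s square M E₀ enc₁ enc₂ (proj₁ (proj₂ lefts)) (λ ω → rightOut (h ω))
        (λ w ω ω' p → ⨁-cong (λ I → trans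
          (map-cong (λ x → cong₂ (λ m d → cube I m (proj₁ x) , (w , (proj₂ x , clamp d))) (proj₂ (proj₂ (proj₁ p)) I) (proj₁ (proj₁ p) (proj₂ x))) (shares (h ω) w))
          (cong (map (λ x → cube I (middle (h ω') I w) (proj₁ x) , (w , (proj₂ x , clamp (h ω' w (proj₂ x))))))
            (cong (spread P (λ _ → zero {0})) (⨁-cong (λ u → cong (λ d → when (d <ᵇ ∞) u) (proj₁ (proj₁ p) u)))))))
        (10 * q)
        (λ ω w → ≤-trans (rightOut-length (h ω) (few ω) w) (*-monoˡ-≤ N (m≤n*m q 10)))
        (λ ω i → ≤-trans (rightOut-load (h ω) (few ω) i) (≤-reflexive (sym (*-assoc 10 q N))))

-- From tables to the required output

module _ {n} (G : Graph n) {v : Fin n} where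

  dist-prefix : ∀ t {u} → Dist G v u t → ∀ s → s ≤ t → ∃ λ x → Dist G v x s
  dist-prefix t {u} d s le with m≤n⇒m<n∨m≡n le
  ... | inj₂ refl = u , d
  dist-prefix (suc t) (inj₁ p , short) s le | inj₁ _ = ⊥-elim (short t ≤-refl p)
  dist-prefix (suc t) (inj₂ (w , p , e) , short) s le | inj₁ (s≤s s≤t) =
    dist-prefix t (p , λ r lt q → short (suc r) (s≤s lt) (inj₂ (w , q , e))) s s≤t

  dist-unique : ∀ {u s t} → Dist G v u s → Dist G v u t → s ≡ t
  dist-unique {s = s} {t} (p , short) (p' , short') with <-cmp s t
  ... | tri< lt _ _ = ⊥-elim (short' s lt p)
  ... | tri≈ _ e _ = e
  ... | tri> _ _ gt = ⊥-elim (short t gt p')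

  -- A shortest walk meets a vertex at every distance from 0 to `t`, and different distances mean
  -- different vertices.
  dist<n : ∀ {u t} → Dist G v u t → t < n
  dist<n {u} {t} d = injective⇒≤ {f = at} injective
    where
    found : (i : Fin (suc t)) → ∃ λ x → Dist G v x (toℕ i)
    found i = dist-prefix t d (toℕ i) (s≤s⁻¹ (toℕ<n i))
    at : Fin (suc t) → Fin n
    at i = proj₁ (found i)
    injective : ∀ {i j} → at i ≡ at j → i ≡ j
    injective {i} {j} e = toℕ-injective (dist-unique (proj₂ (found i)) (subst (λ x → Dist G v x (toℕ j)) (sym e) (proj₂ (found j))))

listing : ∀ {n} → ℕ → (Fin n → ℕ) → List (Fin n × ℕ)
listing {n} ∞ g = filter (λ p → proj₂ p <? ∞) (map (λ u → u , g u) (allFin n))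

module _ {n} (∞ : ℕ) (g : Fin n → ℕ) where

  ∈-listing⁺ : ∀ {u} → g u < ∞ → (u , g u) ∈ listing ∞ g
  ∈-listing⁺ {u} lt = ∈-filter⁺ (λ p → proj₂ p <? ∞) (∈-map⁺ (λ u → u , g u) (∈-allFin u)) lt

  ∈-listing⁻ : ∀ {u t} → (u , t) ∈ listing ∞ g → t ≡ g u × t < ∞
  ∈-listing⁻ m with ∈-filter⁻ (λ p → proj₂ p <? ∞) {xs = map (λ u → u , g u) (allFin n)} m
  ... | m' , lt with ∈-map⁻ (λ u → u , g u) m'
  ... | _ , _ , refl = refl , lt

  listing-unique : Unique (map proj₁ (listing ∞ g))
  listing-unique = AllPairs.map⁺ (AllPairs.filter⁺ (λ p → proj₂ p <? ∞) (AllPairs.map⁺ (allFin⁺ n)))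

opaque
  unfolding sum

  length-filter-tabulate : ∀ {A : Set} ∞ n (f : Fin n → A × ℕ) →
    length (filter (λ p → proj₂ p <? ∞) (tabulate f)) ≡ # (λ u → proj₂ (f u) <ᵇ ∞)
  length-filter-tabulate ∞ zero f = refl
  length-filter-tabulate ∞ (suc n) f with proj₂ (f zero) <ᵇ ∞
  ... | true = cong suc (length-filter-tabulate ∞ n (f ∘ suc))
  ... | false = length-filter-tabulate ∞ n (f ∘ suc)

length-listing : ∀ {n} ∞ (g : Fin n → ℕ) → length (listing ∞ g) ≡ # (λ u → g u <ᵇ ∞)
length-listing {n} ∞ g = trans (cong (λ xs → length (filter (λ p → proj₂ p <? ∞) xs)) (map-tabulate id (λ u → u , g u)))
  (length-filter-tabulate ∞ n (λ u → u , g u))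

module _ {n} (G : Graph n) (k d D ∞ : ℕ) (v : Fin n) (g : Fin n → ℕ) (D<∞ : D < ∞) (D≤d : D ≤ d)
  (reach : ∀ u t → Dist G v u t → t ≤ d → t ≤ D)
  (bounded : ∀ u → g u < ∞ → g u ≤ D)
  (g-sound : ∀ u x → x < ∞ → g u ≤ x → Within G x v u)
  (g-covers : ∀ x → x ≤ D → Covers k (Within G x v) g x)
  (g-few : # (λ u → g u <ᵇ ∞) ≤ k) where

  private
    -- The `k` elements with value up to `x`, together with `u`, would exceed the `k` finite values
    -- allowed.
    not-full-below : ∀ u x → x < g u → g u < ∞ → k ≤ # (λ u → g u ≤ᵇ x) → ⊥
    not-full-below u x lt lt∞ full = <-irrefl refl (≤-trans (s≤s full) (≤-trans grow g-few))
      where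
      grow : suc (# (λ w → g w ≤ᵇ x)) ≤ # (λ w → g w <ᵇ ∞)
      grow = begin
        suc (# (λ w → g w ≤ᵇ x))                     ≡⟨ +-comm 1 (# (λ w → g w ≤ᵇ x)) ⟩
        # (λ w → g w ≤ᵇ x) + 1                       ≡⟨ cong (# (λ w → g w ≤ᵇ x) +_) (sym (trans (sum-cong-≗ (λ w → sym (*-identityʳ (𝟙 (w == u))))) (sum-indicator u (λ _ → 1)))) ⟩
        # (λ w → g w ≤ᵇ x) + # (λ w → w == u)        ≡⟨ ∑-distrib-+ (λ w → 𝟙 (g w ≤ᵇ x)) (λ w → 𝟙 (w == u)) ⟨
        sum (λ w → 𝟙 (g w ≤ᵇ x) + 𝟙 (w == u))        ≤⟨ sum-mono one ⟩
        # (λ w → g w <ᵇ ∞)                           ∎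
        where
        open ≤-Reasoning
        one : ∀ w → 𝟙 (g w ≤ᵇ x) + 𝟙 (w == u) ≤ 𝟙 (g w <ᵇ ∞)
        one w with w ≟F u
        ... | yes refl with g u ≤ᵇ x in e
        ...   | true = ⊥-elim (<⇒≱ lt (true-≤ᵇ e))
        ...   | false = ≤-reflexive (sym (cong 𝟙 (<ᵇ-true lt∞)))
        one w | no _ = ≤-trans (≤-reflexive (+-identityʳ _)) (𝟙-mono (λ e → <ᵇ-true (≤-<-trans (true-≤ᵇ {g w} e) (<-trans lt lt∞))))

    -- A walk of length `s` below `g u` is impossible: coverage at level `s` either forces `g u ≤ s`
    -- or supplies `k` smaller values, leaving no place for `u`.
    exact : ∀ u → g u < ∞ → Dist G v u (g u)
    exact u lt = g-sound u (g u) lt ≤-refl , λ s s<g p → case g-covers s (≤-trans (<⇒≤ s<g) (bounded u lt)) of λ where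
      (inj₁ all) → <⇒≱ s<g (all u p)
      (inj₂ full) → not-full-below u s s<g lt full

    listed : ∀ u t → Dist G v u t → g u ≤ t → t ≤ D → (u , t) ∈ listing ∞ g
    listed u t dist le t≤D = subst (λ s → (u , s) ∈ listing ∞ g) (dist-unique G (exact u lt) dist) (∈-listing⁺ ∞ g lt)
      where
      lt : g u < ∞
      lt = ≤-<-trans le (≤-<-trans t≤D D<∞)

  correct-output : CorrectOutput G k d v (listing ∞ g)
  correct-output = distances , listing-unique ∞ g , ≤-trans (≤-reflexive (length-listing ∞ g)) g-few , full-or-all , nearest
    where
    distances : ∀ u t → (u , t) ∈ listing ∞ g → Dist G v u t × t ≤ d
    distances u t m with refl , lt ← ∈-listing⁻ ∞ g m = exact u lt , ≤-trans (bounded u lt) D≤d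
    full-or-all : length (listing ∞ g) ≡ k ⊎ (∀ u t → Dist G v u t → t ≤ d → (u , t) ∈ listing ∞ g)
    full-or-all with m≤n⇒m<n∨m≡n g-few
    ... | inj₂ e = inj₁ (trans (length-listing ∞ g) e)
    ... | inj₁ lt = inj₂ λ u t dist t≤d → case g-covers t (reach u t dist t≤d) of λ where
      (inj₁ all) → listed u t dist (all u (proj₁ dist)) (reach u t dist t≤d)
      (inj₂ full) → ⊥-elim (<⇒≱ lt (≤-trans full (#-mono (λ w e → <ᵇ-true (≤-<-trans (true-≤ᵇ {g w} e) (≤-<-trans (reach u t dist t≤d) D<∞))))))
    nearest : ∀ u t → Dist G v u t → t ≤ d → ¬ ((u , t) ∈ listing ∞ g) → ∀ u' t' → (u' , t') ∈ listing ∞ g → t' ≤ t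
    nearest u t dist t≤d out u' t' m with refl , lt ← ∈-listing⁻ ∞ g m | g-covers t (reach u t dist t≤d)
    ... | inj₁ all = ⊥-elim (out (listed u t dist (all u (proj₁ dist)) (reach u t dist t≤d)))
    ... | inj₂ full = ≮⇒≥ (λ t<g → not-full-below u' t t<g lt full)

-- Padding with isolated vertices

module Padding {n N : ℕ} (n≤N : n ≤ N) where

  up : Fin n → Fin N
  up u = inject≤ u n≤N

  down : Fin N → Maybe (Fin n)
  down x with toℕ x <? n
  ... | yes p = just (fromℕ< p)
  ... | no _ = nothing

  down-up : ∀ u → down (up u) ≡ just u
  down-up u with toℕ (up u) <? n
  ... | yes p = cong just (toℕ-injective (trans (toℕ-fromℕ< p) (toℕ-inject≤ u n≤N)))
  ... | no np = ⊥-elim (np (subst (_< n) (sym (toℕ-inject≤ u n≤N)) (toℕ<n u)))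

  down-just : ∀ {x u} → down x ≡ just u → up u ≡ x
  down-just {x} e with toℕ x <? n | e
  ... | yes p | refl = toℕ-injective (trans (toℕ-inject≤ (fromℕ< p) n≤N) (toℕ-fromℕ< p))

  joined : (Fin n → Fin n → Bool) → Maybe (Fin n) → Maybe (Fin n) → Bool
  joined a (just u) (just w) = a u w
  joined a (just u) nothing  = false
  joined a nothing  _        = false

  pad : Graph n → Graph N
  pad G = record
    { adj = λ x y → joined (adj G) (down x) (down y)
    ; sym = λ x y → joined-sym (down x) (down y)
    ; irrefl = λ x → joined-irrefl (down x)
    }
    where
    joined-sym : ∀ a b → joined (adj G) a b ≡ joined (adj G) b a
    joined-sym (just u) (just w) = Graph.sym G u w
    joined-sym (just u) nothing = refl
    joined-sym nothing (just w) = refl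
    joined-sym nothing nothing = refl
    joined-irrefl : ∀ a → joined (adj G) a a ≡ false
    joined-irrefl (just u) = irrefl G u
    joined-irrefl nothing = refl

  module _ (G : Graph n) where

    Within-up : ∀ t {u w} → Within G t u w → Within (pad G) t (up u) (up w)
    Within-up zero refl = refl
    Within-up (suc t) (inj₁ p) = inj₁ (Within-up t p)
    Within-up (suc t) {w = w} (inj₂ (x , p , a)) = inj₂ (up x , Within-up t p , trans (cong₂ (joined (adj G)) (down-up x) (down-up w)) a)

    Within-down : ∀ t {u y} → Within (pad G) t (up u) y → ∃ λ w → up w ≡ y × Within G t u w
    Within-down zero {u} refl = u , refl , refl
    Within-down (suc t) (inj₁ p) with Within-down t p
    ... | w , e , q = w , e , inj₁ q
    Within-down (suc t) {y = y} (inj₂ (z , p , a)) with Within-down t p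
    ... | x , refl , q rewrite down-up x with down y in eq
    ...   | just w = w , down-just eq , inj₂ (x , q , a)

  up-injective : ∀ {u w} → up u ≡ up w → u ≡ w
  up-injective {u} {w} e = inject≤-injective n≤N n≤N u w e

  -- Brings full level sets back to the original graph: soundness makes their elements reachable
  -- from an original vertex, hence original themselves.
  #-up : ∀ (p : Fin N → Bool) → (∀ y → p y ≡ true → ∃ λ u → up u ≡ y) → # p ≤ # (λ u → p (up u))
  #-up p image = begin
    # p                                                   ≤⟨ sum-mono one ⟩
    sum (λ y → sum (λ u → 𝟙 (y == up u) * 𝟙 (p (up u))))  ≡⟨ ∑-comm _ ⟩
    sum (λ u → sum (λ y → 𝟙 (y == up u) * 𝟙 (p (up u))))  ≡⟨ sum-cong-≗ (λ u → sum-indicator (up u) (λ _ → 𝟙 (p (up u)))) ⟩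
    # (λ u → p (up u))                                    ∎
    where
    open ≤-Reasoning
    one : ∀ y → 𝟙 (p y) ≤ sum (λ u → 𝟙 (y == up u) * 𝟙 (p (up u)))
    one y with p y in eq
    ... | false = z≤n
    ... | true with image y eq
    ... | u , refl = ≤-trans (≤-reflexive (sym (cong₂ (λ a b → 𝟙 a * 𝟙 b) (==-refl (up u)) eq)))
                             (term≤sum (λ w → 𝟙 (up u == up w) * 𝟙 (p (up w))) u)

-- Clique size and message encodings

n≤2^⌈log₂n⌉ : ∀ n → n ≤ 2 ^ ⌈log₂ n ⌉
n≤2^⌈log₂n⌉ = <-rec (λ n → n ≤ 2 ^ ⌈log₂ n ⌉) step
  where
  step : ∀ n → (∀ {m} → m < n → m ≤ 2 ^ ⌈log₂ m ⌉) → n ≤ 2 ^ ⌈log₂ n ⌉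
  step zero _ = z≤n
  step (suc zero) _ = ≤-refl
  step (suc (suc n)) rec = begin
    suc (suc n)                        ≡⟨ sym (⌊n/2⌋+⌈n/2⌉≡n (suc (suc n))) ⟩
    ⌊ suc (suc n) /2⌋ + ⌈ suc (suc n) /2⌉ ≤⟨ +-monoˡ-≤ ⌈ suc (suc n) /2⌉ (⌊n/2⌋≤⌈n/2⌉ (suc (suc n))) ⟩
    ⌈ suc (suc n) /2⌉ + ⌈ suc (suc n) /2⌉ ≤⟨ +-mono-≤ half half ⟩
    2 ^ e + 2 ^ e                      ≡⟨ cong (2 ^ e +_) (sym (+-identityʳ (2 ^ e))) ⟩
    2 ^ suc e                          ≡⟨ cong (2 ^_) suc-e ⟩
    2 ^ ⌈log₂ suc (suc n) ⌉            ∎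
    where
    open ≤-Reasoning
    e = ⌈log₂ ⌈ suc (suc n) /2⌉ ⌉
    half : ⌈ suc (suc n) /2⌉ ≤ 2 ^ e
    half = rec (⌈n/2⌉<n n)
    suc-e : suc e ≡ ⌈log₂ suc (suc n) ⌉
    suc-e = trans (cong suc (⌈log₂⌈n/2⌉⌉≡⌈log₂n⌉∸1 (suc (suc n)))) (m+[n∸m]≡n {1} (⌈log₂⌉-mono-≤ {2} {suc (suc n)} (s≤s (s≤s z≤n))))

-- In the induction `p` grows only when `p ^ 6` misses the new number, and then `suc p ≤ p + p`
-- costs at most the factor `2 ^ 6`.
sixth-root : ∀ n → 1 ≤ n → ∃ λ p → 1 ≤ p × n ≤ p ^ 6 × p ^ 6 ≤ 64 * n
sixth-root (suc zero) _ = 1 , ≤-refl , ≤-refl , m≤m+n 1 63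
sixth-root (suc (suc n)) _ with sixth-root (suc n) (s≤s z≤n)
... | p , 1≤p , lower , upper with suc (suc n) ≤? p ^ 6
... | yes le = p , 1≤p , le , ≤-trans upper (*-monoʳ-≤ 64 (n≤1+n (suc n)))
... | no nle = suc p , s≤s z≤n , ≤-trans (s≤s lower) (^-monoˡ-< 6 (n<1+n p)) , (begin
    suc p ^ 6         ≤⟨ ^-monoˡ-≤ 6 (+-monoˡ-≤ p 1≤p) ⟩
    (p + p) ^ 6       ≡⟨ arith p ⟩
    64 * p ^ 6        ≤⟨ *-monoʳ-≤ 64 (≤-trans (s≤s⁻¹ (≰⇒> nle)) (n≤1+n (suc n))) ⟩
    64 * suc (suc n)  ∎)
  where
  open ≤-Reasoning
  arith : ∀ p → (p + p) * ((p + p) * ((p + p) * ((p + p) * ((p + p) * ((p + p) * 1))))) ≡ 64 * (p * (p * (p * (p * (p * (p * 1))))))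
  arith = solve-∀

Enc-Fin : ∀ {a} → Enc (Fin a) a
Enc-Fin = record { enc = id ; enc-injective = id }

Enc-≤ : ∀ {X a b} → a ≤ b → Enc X a → Enc X b
Enc-≤ le c = record
  { enc = λ x → inject≤ (enc c x) le
  ; enc-injective = λ e → enc-injective c (inject≤-injective le le _ _ e) }

Enc-× : ∀ {X Y a b} → Enc X a → Enc Y b → Enc (X × Y) (a * b)
Enc-× {X} {Y} c c' = record { enc = λ p → combine (enc c (proj₁ p)) (enc c' (proj₂ p)) ; enc-injective = injective }
  where
  injective : ∀ {p p' : X × Y} → combine (enc c (proj₁ p)) (enc c' (proj₂ p)) ≡ combine (enc c (proj₁ p')) (enc c' (proj₂ p')) → p ≡ p'
  injective {x , y} {x' , y'} e with combine-injective (enc c x) (enc c' y) (enc c x') (enc c' y') e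
  ... | e₁ , e₂ = cong₂ _,_ (enc-injective c e₁) (enc-injective c' e₂)

Enc-Maybe : ∀ {X a} → Enc X a → Enc (Maybe X) (suc a)
Enc-Maybe {X} {a} c = record { enc = code ; enc-injective = λ {x} {y} → injective {x} {y} }
  where
  code : Maybe X → Fin (suc a)
  code nothing = zero
  code (just x) = suc (enc c x)
  injective : ∀ {x y} → code x ≡ code y → x ≡ y
  injective {nothing} {nothing} e = refl
  injective {just x} {just y} e = cong just (enc-injective c (sucF-injective e))

-- Assembly of the phases

module Assembly (n k d L p : ℕ) .{{_ : NonZero n}} .{{_ : NonZero p}} (1≤k : 1 ≤ k) where

  P s Q : ℕ
  P = p * p
  s = p * P
  Q = P * P

  instance
    P-nonZero : NonZero P
    P-nonZero = m*n≢0 p p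
    s-nonZero : NonZero s
    s-nonZero = m*n≢0 p P
    Q-nonZero : NonZero Q
    Q-nonZero = m*n≢0 P P

  N q K D l H ∞ : ℕ
  N = Cube.N P
  -- The successor rounds up, so that `K` is at least `k`.
  q = suc (k / Q)
  K = q * Q
  -- Every finite distance is below `n`, so no answer is lost; table values then take O(log n) bits
  -- however large `d` is.
  D = d ⊓ n
  l = ⌈log₂ D ⌉
  -- This puts the cap strictly above `2 ^ l`, the radius reached by the last doubling.
  H = 2 + l
  ∞ = 2 ^ H

  square : N ≡ s * s
  square = arith p
    where
    arith : ∀ p → (p * p) * ((p * p) * (p * p)) ≡ (p * (p * p)) * (p * (p * p))
    arith = solve-∀

  k≤K : k ≤ K
  k≤K = ≤-trans (≤-reflexive (m≡m%n+[m/n]*n k Q)) (+-monoˡ-≤ (k / Q * Q) (<⇒≤ (m%n<n k Q)))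

  1≤K : 1 ≤ K
  1≤K = ≤-trans 1≤k k≤K

  small : ∀ i → i < l → 2 ^ i + 2 ^ i < ∞
  small i lt = ≤-<-trans (≤-reflexive (cong (2 ^ i +_) (sym (+-identityʳ (2 ^ i))))) (^-monoʳ-< 2 ≤-refl (s≤s (≤-trans lt (n≤1+n l))))

  D≤2^l : D ≤ 2 ^ l
  D≤2^l = n≤2^⌈log₂n⌉ D

  D<∞ : D < ∞
  D<∞ = ≤-<-trans D≤2^l (^-monoʳ-< 2 ≤-refl (s≤s (n≤1+n l)))

  phaseTime : ℕ
  phaseTime = 200 + 456 * q + 2 * H

  module _ (n≤N : n ≤ N) (N≤64n : N ≤ 64 * n)
    (room : suc (N * (N * (N * (N * suc ∞)))) ≤ 2 ^ L) (N+N<M : N + N < 2 ^ L) (∞<M : ∞ < 2 ^ L) where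

    open Padding n≤N
    open Extraction n L using (Row; solves)

    V : Set
    V = Fin N

    VirtualRow : Rel N (Graph n)
    VirtualRow x G G' = ∀ y → adj (pad G) x y ≡ adj (pad G') x y

    enc-entry : Enc (Entries.Entry P H) (N * (N * suc ∞))
    enc-entry = Enc-× Enc-Fin (Enc-× Enc-Fin Enc-Fin)

    N-nz : NonZero N
    N-nz = m*n≢0 P Q

    enc₁ : Enc (Maybe (V × Entries.Entry P H)) (2 ^ L)
    enc₁ = Enc-≤ (≤-trans (s≤s (m≤n*m (N * (N * (N * suc ∞))) N {{N-nz}})) room) (Enc-Maybe (Enc-× Enc-Fin enc-entry))

    enc₂ : Enc (Maybe (V × (V × Entries.Entry P H))) (2 ^ L)
    enc₂ = Enc-≤ room (Enc-Maybe (Enc-× Enc-Fin (Enc-× Enc-Fin enc-entry)))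

    double : (V → V → ℕ) → V → V → ℕ
    double h = Product.next K H (λ v → Tables.middle P q H h (Cube.c₀ P v)) h

    dists : ℕ → Graph n → V → V → ℕ
    dists zero G = Doubling.initial (pad G) K H 1≤K
    dists (suc i) G = double (dists i G)

    approximates : ∀ i → i ≤ l → ∀ G → Doubling.Approximates (pad G) K H 1≤K (2 ^ i) (dists i G)
    approximates zero le G = Doubling.initial-approximates (pad G) K H 1≤K (^-monoʳ-< 2 ≤-refl {0} {H} (s≤s z≤n))
    approximates (suc i) le G = subst (λ D → Doubling.Approximates (pad G) K H 1≤K D (dists (suc i) G)) (cong (2 ^ i +_) (sym (+-identityʳ (2 ^ i))))
      (Doubling.Step.next-approximates (pad G) K H 1≤K (λ v → Tables.middle P q H (dists i G) (Cube.c₀ P v)) (dists i G) (small i le)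
        (approximates i (<⇒≤ le) G))

    open Clique (2 ^ L) VirtualRow using (Knows; weaken; knows; start)

    known : ∀ i → i ≤ l → Knows (i * phaseTime) (λ x G G' → ∀ u → dists i G x u ≡ dists i G' x u)
    known zero le = knows 0 z≤n VirtualRow start (λ x G G' e → SelectionCong.trim-cong K H (λ u →
      cong (λ a → if x == u then 0 else (if a then 1 else ∞)) (e u)))
    known (suc i) le = weaken (≤-reflexive (+-comm (i * phaseTime) phaseTime)) (λ _ _ _ e → e)
      (Phase.learn-next P q H s square (2 ^ L) VirtualRow enc₁ enc₂ N+N<M ∞<M (dists i)
        (λ G → Doubling.Approximates.few (approximates i (<⇒≤ le) G))
        (λ G → Doubling.Approximates.capped (approximates i (<⇒≤ le) G))
        (known i (<⇒≤ le)))

    module Sim = Simulation n N 64 N≤64n (2 ^ L) (fromℕ< (m^n>0 2 L)) Row VirtualRow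

    owner-up : ∀ u → Sim.owner (up u) ≡ u
    owner-up u = toℕ-injective (trans (toℕ-mod (toℕ (up u)) n) (trans (cong (_% n) (toℕ-inject≤ u n≤N)) (m<n⇒m%n≡m (toℕ<n u))))

    rows-owned : ∀ i G G' → Row i G G' → Sim.Owned VirtualRow i G G'
    rows-owned i G G' e x own y with down x in eq
    ... | nothing = refl
    ... | just u with down y
    ...   | nothing = refl
    ...   | just w = subst (λ v → adj G v w ≡ adj G' v w) (trans (sym own) (trans (cong Sim.owner (sym (down-just eq))) (owner-up u))) (e w)

    -- The tables cover levels up to `2 ^ l`, which may exceed `D`; larger entries are discarded
    -- before the final selection of `k` out of up to `K`.
    near : Graph n → Fin n → Fin n → ℕ
    near G v u = if dists l G (up v) (up u) ≤ᵇ D then dists l G (up v) (up u) else ∞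

    open Selection k H using (trim; chosen; trim-sound; trim-complete; trim-chosen; trim<∞⇒chosen; chosen⇒<∞; #-chosen-≤)

    answer : Graph n → Fin n → List (Fin n × ℕ)
    answer G v = listing ∞ (trim (near G v))

    answer-determined : ∀ v G G' → Sim.Owned (λ x G G' → ∀ u → dists l G x u ≡ dists l G' x u) v G G' → answer G v ≡ answer G' v
    answer-determined v G G' e = cong (filter (λ p → proj₂ p <? ∞)) (map-cong (λ u → cong (u ,_)
      (SelectionCong.trim-cong k H {f = near G v} {g = near G' v} (λ u → cong (λ x → if x ≤ᵇ D then x else ∞) (e (up v) (owner-up v) (up u))) u)) (allFin n))

    near-≤ : ∀ G v u {x} → x < ∞ → near G v u ≤ x → dists l G (up v) (up u) ≤ x × near G v u ≤ D
    near-≤ G v u lt le with dists l G (up v) (up u) ≤ᵇ D in eq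
    ... | true = le , true-≤ᵇ {dists l G (up v) (up u)} eq
    ... | false = ⊥-elim (<-irrefl refl (≤-<-trans le lt))

    ≤-near : ∀ G v u {x} → x ≤ D → dists l G (up v) (up u) ≤ x → near G v u ≤ x
    ≤-near G v u x≤D le rewrite ≤ᵇ-true (≤-trans le x≤D) = le

    answer-correct : ∀ G v → CorrectOutput G k d v (answer G v)
    answer-correct G v = correct-output G k d D ∞ v (trim f) D<∞ (m⊓n≤m d n)
        (λ u t dist t≤d → ⊓-glb t≤d (<⇒≤ (dist<n G dist)))
        (λ u lt → case trim<∞⇒chosen 1≤k f u lt of λ c →
          ≤-trans (≤-reflexive (trim-chosen 1≤k f u c)) (proj₂ (near-≤ G v u (chosen⇒<∞ 1≤k f u c) ≤-refl)))
        (λ u x lt le → sound u x lt (proj₁ (near-≤ G v u lt (trim-sound 1≤k f u le lt))))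
        (λ x le → Covers-trans (near-covers x le) (trim-complete 1≤k f x (≤-<-trans le D<∞)))
        (≤-trans (#-mono (λ u e → trim<∞⇒chosen 1≤k f u (true-<ᵇ e))) (#-chosen-≤ 1≤k f))
      where
      f = near G v
      ap = approximates l ≤-refl G
      sound : ∀ u x → x < ∞ → dists l G (up v) (up u) ≤ x → Within G x v u
      sound u x lt le with Within-down G x (Doubling.Approximates.sound ap (up v) (up u) x lt le)
      ... | w , e , p = subst (Within G x v) (up-injective e) p
      near-covers : ∀ x → x ≤ D → Covers k (Within G x v) f x
      near-covers x le with Doubling.Approximates.complete ap (up v) x (≤-trans le D≤2^l)
      ... | inj₁ all = inj₁ (λ u p → ≤-near G v u le (all (up u) (Within-up G x p)))
      ... | inj₂ full = inj₂ (≤-trans k≤K (≤-trans full (≤-trans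
          (#-up (λ y → dists l G (up v) y ≤ᵇ x) (λ y e →
            case Within-down G x (Doubling.Approximates.sound ap (up v) y x (≤-<-trans le D<∞) (true-≤ᵇ {dists l G (up v) y} e)) of λ where
              (w , eq , _) → w , eq))
          (#-mono (λ u e → ≤ᵇ-true (≤-near G v u le (true-≤ᵇ {dists l G (up v) (up u)} e)))))))

    solve : Σ (CCAlgorithm n L) λ A → Σ ℕ λ T → T ≤ l * phaseTime * (64 * 64) × SolvesNearest A k d T
    solve = solves (Sim.simulate-knows rows-owned (known l ≤-refl)) answer answer-determined k d answer-correct

-- Degenerate cases, message width and round count

idle : ∀ {n L} → CCAlgorithm n L
idle {L = L} = record
  { State = ⊤ ; init = λ _ _ → tt ; send = λ _ _ _ _ → Vec.replicate L false ; recv = λ _ _ _ _ → tt ; output = λ _ _ → [] }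

idle-correct : ∀ {n} (G : Graph n) d v → CorrectOutput G 0 d v []
idle-correct G d v = (λ _ _ ()) , [] , z≤n , inj₁ refl , λ _ _ _ _ _ _ _ ()

-- k ≤ q n ^ (2/3), with everything cubed.
quotient-≤ : ∀ k q n P .{{_ : NonZero (P * P)}} → n ≤ P * (P * P) → k ^ 3 ≤ q ^ 3 * n ^ 2 → k / (P * P) ≤ q
quotient-≤ k q n P n≤N le = ≤-trans (/-monoˡ-≤ (P * P) k≤qQ) (≤-reflexive (m*n/n≡m q (P * P)))
  where
  arith : ∀ q P → (q * (q * (q * 1))) * ((P * (P * P)) * ((P * (P * P)) * 1)) ≡ (q * (P * P)) * ((q * (P * P)) * ((q * (P * P)) * 1))
  arith = solve-∀
  k≤qQ : k ≤ q * (P * P)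
  k≤qQ = ≮⇒≥ (λ lt → <⇒≱ (^-monoˡ-< 3 lt) (≤-trans le (≤-trans (*-monoʳ-≤ (q ^ 3) (^-monoˡ-≤ 2 n≤N)) (≤-reflexive (arith q P)))))

-- Opaque, lest the product of a literal with an open term be unfolded.
opaque
  factor : ℕ
  factor = 1200 * (64 * 64)

  factor-def : 1200 * (64 * 64) ≡ factor
  factor-def = refl

-- For `l = 0` no phase runs. Otherwise `1 ≤ ld` turns the constant `660 = 200 + 456 + 4` into
-- `660 * ld`; the padding by 744 and 538 brings both coefficients to 1200.
time-≤ : ∀ l ld κ q → l ≤ ld → κ ≤ q → ∀ {c f} → 1200 * c ≡ f →
  l * (200 + 456 * suc κ + 2 * (2 + l)) * c ≤ f * ((q + ld) * ld)
time-≤ zero ld κ q _ _ _ = z≤n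
time-≤ (suc l) ld κ q l≤ld κ≤q {c} refl = begin
  suc l * (200 + 456 * suc κ + 2 * (2 + suc l)) * c ≤⟨ *-monoˡ-≤ c (*-mono-≤ l≤ld (+-mono-≤ (+-monoʳ-≤ 200 (*-monoʳ-≤ 456 (s≤s κ≤q))) (*-monoʳ-≤ 2 (+-monoʳ-≤ 2 l≤ld)))) ⟩
  ld * (200 + 456 * suc q + 2 * (2 + ld)) * c        ≡⟨ cong (λ x → ld * x * c) (arith q ld) ⟩
  ld * (660 * 1 + (456 * q + 2 * ld)) * c            ≤⟨ *-monoˡ-≤ c (*-monoʳ-≤ ld (+-monoˡ-≤ (456 * q + 2 * ld) (*-monoʳ-≤ 660 (≤-trans (s≤s z≤n) l≤ld)))) ⟩
  ld * (660 * ld + (456 * q + 2 * ld)) * c           ≤⟨ *-monoˡ-≤ c (*-monoʳ-≤ ld (m≤m+n _ (744 * q + 538 * ld))) ⟩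
  ld * (660 * ld + (456 * q + 2 * ld) + (744 * q + 538 * ld)) * c ≡⟨ arith' q ld c ⟩
  (1200 * c) * ((q + ld) * ld)                       ∎
  where
  open ≤-Reasoning
  arith : ∀ q ld → 200 + 456 * suc q + 2 * (2 + ld) ≡ 660 * 1 + (456 * q + 2 * ld)
  arith = solve-∀
  arith' : ∀ q ld c → ld * (660 * ld + (456 * q + 2 * ld) + (744 * q + 538 * ld)) * c ≡ (1200 * c) * ((q + ld) * ld)
  arith' = solve-∀

-- Opaque, since the conversion checker would unfold 2 ^ 28 into a sum.
opaque
  pow₂ : ℕ → ℕ
  pow₂ a = 2 ^ a

  pow₂≡2^ : ∀ a → pow₂ a ≡ 2 ^ a
  pow₂≡2^ a = refl

pow₂-mono : ∀ {a b} → a ≤ b → pow₂ a ≤ pow₂ b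
pow₂-mono {a} {b} le = ≤-trans (≤-reflexive (pow₂≡2^ a)) (≤-trans (^-monoʳ-≤ 2 le) (≤-reflexive (sym (pow₂≡2^ b))))

pow₂-* : ∀ {x y a b} → x ≤ pow₂ a → y ≤ pow₂ b → x * y ≤ pow₂ (a + b)
pow₂-* {a = a} {b} p p' = ≤-trans (*-mono-≤ p p') (≤-reflexive
  (trans (cong₂ _*_ (pow₂≡2^ a) (pow₂≡2^ b)) (trans (sym (^-distribˡ-+-* 2 a b)) (sym (pow₂≡2^ (a + b))))))

pow₂-+ : ∀ {x y a} → x ≤ pow₂ a → y ≤ pow₂ a → x + y ≤ pow₂ (suc a)
pow₂-+ {a = a} p p' = ≤-trans (+-mono-≤ p p') (≤-reflexive (trans (cong (pow₂ a +_) (sym (+-identityʳ (pow₂ a))))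
  (trans (cong (2 *_) (pow₂≡2^ a)) (sym (pow₂≡2^ (suc a))))))

pow₂-suc : ∀ {x a} → x ≤ pow₂ a → suc x ≤ pow₂ (suc a)
pow₂-suc {a = a} p = pow₂-+ {a = a} (≤-trans (m^n>0 2 a) (≤-reflexive (sym (pow₂≡2^ a)))) p

module Sizes (e l N L : ℕ) (l≤e : l ≤ e) (N≤ : N ≤ pow₂ (6 + e)) (wide : 32 * suc e ≤ L) where

  fits : ∀ {x c} a b → x ≤ pow₂ c → c ≡ a + b * e → a ≤ 32 → b ≤ 32 → x ≤ 2 ^ L
  fits a b le refl a≤ b≤ = ≤-trans le (≤-trans (pow₂-mono (≤-trans (+-mono-≤ a≤ (*-monoˡ-≤ e b≤)) (≤-trans (≤-reflexive (sym (*-suc 32 e))) wide))) (≤-reflexive (pow₂≡2^ L)))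

  ∞-≤ : suc (2 ^ (2 + l)) ≤ pow₂ (3 + e)
  ∞-≤ = pow₂-suc {a = 2 + e} (≤-trans (≤-reflexive (sym (pow₂≡2^ (2 + l)))) (pow₂-mono (+-monoʳ-≤ 2 l≤e)))

  -- The widest message is an optional packet with relay target, final target and entry: four
  -- vertices of `6 + e` bits, a value of `3 + e` bits, and one bit for the option.
  room : suc (N * (N * (N * (N * suc (2 ^ (2 + l)))))) ≤ 2 ^ L
  room = fits 28 5 (pow₂-suc (pow₂-* N≤ (pow₂-* N≤ (pow₂-* N≤ (pow₂-* N≤ ∞-≤))))) (arith e) (m≤m+n 28 4) (m≤m+n 5 27)
    where
    arith : ∀ e → suc ((6 + e) + ((6 + e) + ((6 + e) + ((6 + e) + (3 + e))))) ≡ 28 + 5 * e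
    arith = solve-∀

  N+N< : N + N < 2 ^ L
  N+N< = fits 8 1 (pow₂-suc (pow₂-+ N≤ N≤)) (cong (8 +_) (sym (+-identityʳ e))) (m≤m+n 8 24) (m≤m+n 1 31)

  ∞< : 2 ^ (2 + l) < 2 ^ L
  ∞< = fits 3 1 ∞-≤ (cong (3 +_) (sym (+-identityʳ e))) (m≤m+n 3 29) (m≤m+n 1 31)

nearest-positive : ∀ n k d L p .{{_ : NonZero n}} .{{_ : NonZero p}} → 1 ≤ k → n ≤ p ^ 6 → p ^ 6 ≤ 64 * n → 32 * suc ⌈log₂ n ⌉ ≤ L →
  Σ (CCAlgorithm n L) λ A → Σ ℕ λ T → SolvesNearest A k d T ×
    (∀ q → k ^ 3 ≤ q ^ 3 * n ^ 2 → T ≤ factor * ((q + ⌈log₂ d ⌉) * ⌈log₂ d ⌉))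
nearest-positive n k d L p 1≤k lower upper wide = proj₁ solved , proj₁ (proj₂ solved) , proj₂ (proj₂ (proj₂ solved)) ,
    λ q le → ≤-trans (proj₁ (proj₂ (proj₂ solved)))
      (time-≤ A.l ⌈log₂ d ⌉ (k / A.Q) q (⌈log₂⌉-mono-≤ (m⊓n≤m d n)) (quotient-≤ k q n A.P n≤N le) factor-def)
  where
  module A = Assembly n k d L p 1≤k
  arith : ∀ p → p * (p * (p * (p * (p * (p * 1))))) ≡ (p * p) * ((p * p) * (p * p))
  arith = solve-∀
  n≤N : n ≤ A.N
  n≤N = ≤-trans lower (≤-reflexive (arith p))
  N≤64n : A.N ≤ 64 * n
  N≤64n = ≤-trans (≤-reflexive (sym (arith p))) upper
  N≤ : A.N ≤ pow₂ (6 + ⌈log₂ n ⌉)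
  N≤ = ≤-trans N≤64n (pow₂-* (≤-reflexive (sym (pow₂≡2^ 6))) (≤-trans (n≤2^⌈log₂n⌉ n) (≤-reflexive (sym (pow₂≡2^ ⌈log₂ n ⌉)))))
  module S = Sizes ⌈log₂ n ⌉ A.l A.N L (⌈log₂⌉-mono-≤ (m⊓n≤n d n)) N≤ wide
  solved : Σ (CCAlgorithm n L) λ A → Σ ℕ λ T → T ≤ A.l * A.phaseTime * (64 * 64) × SolvesNearest A k d T
  solved = A.solve n≤N N≤64n S.room S.N+N< S.∞<

nearest : ∀ n k d L → 32 * suc ⌈log₂ n ⌉ ≤ L →
  Σ (CCAlgorithm n L) λ A → Σ ℕ λ T → SolvesNearest A k d T ×
    (∀ q → k ^ 3 ≤ q ^ 3 * n ^ 2 → T ≤ factor * ((q + ⌈log₂ d ⌉) * ⌈log₂ d ⌉))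
nearest zero k d L wide = idle , 0 , (λ G ()) , λ _ _ → z≤n
nearest (suc _) zero d L wide = idle , 0 , (λ G v → idle-correct G d v) , λ _ _ → z≤n
nearest n@(suc _) (suc k) d L wide = case sixth-root n (s≤s z≤n) of λ where
  (p , 1≤p , lower , upper) → nearest-positive n (suc k) d L p {{it}} {{>-nonZero 1≤p}} (s≤s z≤n) lower upper wide

theorem2p3 : Σ ℕ λ c → Σ ℕ λ C →
    ∀ (n k d : ℕ) →
    Σ (CCAlgorithm n (bandwidth c n)) λ A → Σ ℕ λ T →
    SolvesNearest A k d T
    × (∀ (q : ℕ) → k ^ 3 ≤ q ^ 3 * n ^ 2 →
    T ≤ C * ((q + ⌈log₂ d ⌉) * ⌈log₂ d ⌉) + C)
theorem2p3 = 32 , factor , λ n k d →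
  case nearest n k d (bandwidth 32 n) ≤-refl of λ where
    (A , T , solves , fast) → A , T , solves , λ q le → ≤-trans (fast q le) (m≤m+n _ factor)
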